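{- Let $p\ge 11$ be a prime. Then the following two congruences hold modulo $p$ (all terms on the right-hand sides are $p$-adic integers, most of them integers given as Hensel digits): (i) \begin{align*} \mathcal{T}(p-3)\equiv\;&3\big(\mathcal{C}(p-3)\big)_1-\tfrac{11}{4}\mathcal{B}_{p-5}+6\big(\mathcal{B}_{3p-5}-3\mathcal{B}_{2p-4}+2\mathcal{B}_{p-3}\big)_2\\ &+\Big[6(\mathcal{B}_{p-3}-\mathcal{B}_{2p-4})_1\Big]_1+\Big[3\big(2(\mathcal{B}_{2p-4}-\mathcal{B}_{p-3})_1+2(w_p)_0\mathcal{B}_{p-3}\big)_0\Big]_1\\ &+(w_p)_1\Big[-6\mathcal{B}_{p-3}\Big]_0+(w_p)_0\Big[6(\mathcal{B}_{2p-4}-2\mathcal{B}_{p-3})\Big]_1+\Big[(w_p)_0(-6\mathcal{B}_{p-3})_0\Big]_1\\ &+\Big\{\Big[6(\mathcal{B}_{p-3}-\mathcal{B}_{2p-4})_1\Big]_0+\Big[-6(w_p)_0\mathcal{B}_{p-3}\Big]_0+\Big[3\big(2(\mathcal{B}_{2p-4}-\mathcal{B}_{p-3})_1+2(w_p)_0\mathcal{B}_{p-3}\big)_0\Big]_0\Big\}_1 \pmod p; \end{align*} (ii) \begin{align*} \mathcal{T}(p-5)\equiv\;&3\big(\mathcal{C}(p-5)\big)_1-\tfrac{15}{4}\mathcal{B}_{p-7}+\big[3(\mathcal{B}_{p-3})_0^2\big]_1+6\mathcal{B}_{p-3}\big(2\mathcal{B}_{p-3}-\mathcal{B}_{2p-4}\big)_1\\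 &+6\big(\mathcal{B}_{3p-7}-3\mathcal{B}_{2p-6}+2\mathcal{B}_{p-5}\big)_2+\Big[6(\mathcal{B}_{p-5}-\mathcal{B}_{2p-6})_1\Big]_1\\ &+(w_p)_0(-6\mathcal{B}_{p-5})_1+(w_p)_1(-6\mathcal{B}_{p-5})_0+\Big((w_p)_0(-6\mathcal{B}_{p-5})_0\Big)_1+\Big(-6(w_p)_0^2\mathcal{B}_{p-5}\Big)_0\\ &+\Big[3(w_p)_0\big(2(w_p)_0\mathcal{B}_{p-5}+2(\mathcal{B}_{2p-6}-\mathcal{B}_{p-5})_1-\mathcal{B}_{p-3}^2\big)_0\Big]_0\\ &+\Big[3\big(2(w_p)_0\mathcal{B}_{p-5}+2(\mathcal{B}_{2p-6}-\mathcal{B}_{p-5})_1-\mathcal{B}_{p-3}^2\big)_0\Big]_1\\ &+\Big\{\Big[3(\mathcal{B}_{p-3})_0^2\Big]_0+\Big[6(\mathcal{B}_{p-5}-\mathcal{B}_{2p-6})_1\Big]_0+\Big[-6(w_p)_0(\mathcal{B}_{p-5})_0\Big]_0\\ &\qquad+\Big[3\big(2(w_p)_0\mathcal{B}_{p-5}+2(\mathcal{B}_{2p-6}-\mathcal{B}_{p-5})_1-\mathcal{B}_{p-3}^2\big)_0\Big]_0\Big\}_1 \pmod p. \end{align*}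
   Context: $B_n$ denotes the $n$-th Bernoulli number, and for $n\ge1$ the divided Bernoulli number is $\mathcal{B}_n:=B_n/n$ (a rational number, viewed in $\mathbb{Q}_p$). For an even integer $n\ge4$, $\mathcal{C}(n):=\sum_{i=2}^{n-2}\mathcal{B}_i\mathcal{B}_{n-i}$, and $\mathcal{T}(n):=\sum_{i=2}^{n-4}\mathcal{B}_i\,\mathcal{C}(n-i)$ is the sum of products $\mathcal{B}_i\mathcal{B}_j\mathcal{B}_k$ over ordered triples $(i,j,k)$ with $i,j,k\ge2$ and $i+j+k=n$ (empty sums are $0$). The Wilson quotient is $w_p:=\frac{(p-1)!+1}{p}\in\mathbb{Z}$. Hensel digit notation: every $x\in\mathbb{Q}_p$ has a unique expansion $x=\sum_{i\ge -m}x_ip^i$ with $x_i\in\{0,1,\dots,p-1\}$; for an integer $i$, $(x)_i$, $[x]_i$ and $\{x\}_i$ all denote the digit $x_i$ (an integer), and these are applied iteratively to expressions built from such digits. In particular $(\mathcal{B}_{p-3})_0^2$ means $\big((\mathcal{B}_{p-3})_0\big)^2$ and $(w_p)_0,(w_p)_1$ are the first two $p$-adic digits of $w_p$. A congruence modulo $p$ between elements of $\mathbb{Z}_p$ means their difference lies in $p\mathbb{Z}_p$. -}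

module Defs where

open import Data.Bool using (Bool; true; false; if_then_else_; not)
open import Data.Nat as ℕ using (ℕ; zero; suc; _∸_; _^_)
open import Data.Nat.Divisibility using (_∣_; _∣?_)
open import Data.Nat.Combinatorics using (_C_)
open import Data.Nat using (_!)
import Data.Nat.DivMod as ℕD
open import Data.Integer as ℤ using (ℤ; +_)
open import Data.Rational using (ℚ; 0ℚ; 1ℚ; _+_; _*_; _-_; -_; _/_; ↥_; ↧ₙ_)
open import Data.List using (List; []; _∷_; _++_; upTo; zipWith; map; foldr)
open import Data.Product using (_×_)
open import Relation.Nullary using (¬_)
open import Relation.Nullary.Decidable using (⌊_⌋)

ι : ℕ → ℚ
ι n = (+ n) / 1

ιℤ : ℤ → ℚ
ιℤ z = z / 1

sumℚ : List ℚ → ℚ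
sumℚ = foldr _+_ 0ℚ

sumFromTo : ℕ → ℕ → (ℕ → ℚ) → ℚ
sumFromTo a b f = sumℚ (map (λ k → f (a ℕ.+ k)) (upTo (suc b ∸ a)))

nth : List ℚ → ℕ → ℚ
nth []       _       = 0ℚ
nth (x ∷ _)  zero    = x
nth (_ ∷ xs) (suc k) = nth xs k

-- Bernoulli numbers:  B_0 = 1,  Σ_{k=0}^{n} C(n+1,k) B_k = 0 (n ≥ 1),
-- i.e. B_1 = -1/2 (irrelevant here: only even indices ≥ 2 are used).

Bs : ℕ → List ℚ
Bs zero    = 1ℚ ∷ []
Bs (suc n) = Bs n ++ (next ∷ [])
  where
  next : ℚ
  next = - ((+ 1 / suc (suc n)) *
            sumℚ (zipWith (λ k b → ι (suc (suc n) C k) * b) (upTo (suc n)) (Bs n)))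

B : ℕ → ℚ
B n = nth (Bs n) n

-- divided Bernoulli number 𝓑_n = B_n / n  (n ≥ 1; value at 0 unused)
𝓑 : ℕ → ℚ
𝓑 zero    = 0ℚ
𝓑 (suc n) = B (suc n) * (+ 1 / suc n)

𝓒 : ℕ → ℚ
𝓒 n = sumFromTo 2 (n ∸ 2) (λ i → 𝓑 i * 𝓑 (n ∸ i))

𝓣 : ℕ → ℚ
𝓣 n = sumFromTo 2 (n ∸ 4) (λ i → 𝓑 i * 𝓒 (n ∸ i))

-- Wilson quotient w_p = ((p-1)! + 1) / p   (exact division for p prime)
wilson : ℕ → ℕ
wilson zero    = 0
wilson (suc q) = ℕD._/_ (q ! ℕ.+ 1) (suc q)

-- smallest k < n with f k = true (0 if none)
search : ℕ → (ℕ → Bool) → ℕ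
search n f = go n 0
  where
  go : ℕ → ℕ → ℕ
  go zero    _ = 0
  go (suc m) k = if f k then k else go m (suc k)

divN : ℕ → ℕ → ℕ
divN a zero    = 0
divN a (suc b) = ℕD._/_ a (suc b)

-- m = v_p(denominator of x): least m with p^(m+1) ∤ denominator
denVal : ℕ → ℚ → ℕ
denVal p x = search (suc (↧ₙ x)) (λ m → not ⌊ (p ^ suc m) ∣? (↧ₙ x) ⌋)

-- for a p-integral y: the unique r ∈ [0, p^k) with y ≡ r (mod p^k),
-- i.e. p^k ∣ numerator(y) - denominator(y) * r
residue : ℕ → ℕ → ℚ → ℕ
residue p k y =
  search (p ^ k) (λ r → ⌊ (p ^ k) ∣? ℤ.∣ (↥ y) ℤ.- (+ (↧ₙ y)) ℤ.* (+ r) ∣ ⌋)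

-- digit p i x = x_i, where x = Σ_{j ≥ -m} x_j p^j, x_j ∈ {0,…,p-1}
-- (computed as the digit of index i+m of the p-integral number p^m x)
digit : ℕ → ℕ → ℚ → ℕ
digit p i x =
  let m = denVal p x
      y = ι (p ^ m) * x
  in  divN (residue p (suc (i ℕ.+ m)) y) (p ^ (i ℕ.+ m))

D : ℕ → ℕ → ℚ → ℚ
D p i x = ι (digit p i x)

-- Congruence modulo p in ℤ_p ∩ ℚ:  x - y ∈ pℤ_p, i.e. (in lowest terms)
-- p divides the numerator and does not divide the denominator of x - y.
_≡_[modₚ_] : ℚ → ℚ → ℕ → Set
x ≡ y [modₚ p ] = (p ∣ ℤ.∣ ↥ (x - y) ∣) × ¬ (p ∣ ↧ₙ (x - y))

{-# OPTIONS --safe #-}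
-- Let F = ∏_{a<p} (1 - a X) = exp P, where the coefficients of P are the power sums -S_k / k.  By Faulhaber's formula
-- P ≡ -p ∑ 𝓑_k X^k modulo p², with explicit corrections modulo p⁴, so that in even degree n ≤ p - 3 the expansion
-- F ≡ 1 + P + P²/2 + P³/6 modulo p⁴ expresses the n-th coefficient of F through p 𝓑_n, p² 𝓒(n), p³ 𝓣(n) and p³ 𝓑_{n-2}.
-- On the other hand, reversing F, the coefficient of degree p - 1 - r is (p-1)! = p w_p - 1 times the r-th coefficient of
-- ∏ (1 - X / a), which Newton's identities reduce, for r = 2 and r = 4, to the harmonic sums h_r = ∑ a^{-r} modulo p⁴.
-- Expanding ∑ a^{-r} (a^{p-1} - 1)⁴ ≡ 0 interpolates h_r from the power sums with exponents j (p-1) - r, and Kummer's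
-- congruences turn this into h_r ≡ -r p (3 x - 3 y + z) - r (r+1) (r+2) / 6 · p³ 𝓑_{p-3-r}, where x, y, z are the divided
-- Bernoulli numbers with index j (p-1) - r for j = 1, 2, 3.  Comparing both expressions gives 𝓣(n) modulo p; the digits in
-- the statement are those of this formula.  Kummer's congruences come from sorting the residues 2a modulo p³: they give
-- (2^k - 1) 𝓑_k ≡ ∑ c^{k-1} modulo p³, over the odd c < p³.

module Submission where

open import Defs
open import Data.Bool using (Bool; true; false; if_then_else_; not)
open import Data.Nat as ℕ using (ℕ; zero; suc; _≤_; _<_; z≤n; s≤s; _∸_; _^_; _!)
import Data.Nat.Properties as ℕP
import Data.Nat.DivMod as ℕD
open import Data.Nat.Combinatorics using (_C_)
import Data.Nat.Combinatorics as ℕC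
open import Data.Nat.Divisibility using (_∣_; _∣?_; divides)
import Data.Nat.Divisibility as Div
open import Data.Nat.Coprimality using (Coprime)
import Data.Nat.Coprimality as Cop
open import Data.Nat.Primality using (Prime; euclidsLemma)
import Data.Nat.Primality as Pr
open import Data.Nat.Induction using (<-rec)
import Data.Nat.Solver as ℕSolver
import Data.Rational.Solver
open import Data.Integer as ℤ using (ℤ; -[1+_])
import Data.Integer.Properties as ℤP
open import Data.Rational using (ℚ; 0ℚ; 1ℚ; _+_; _*_; _-_; -_; _/_; ↥_; ↧ₙ_; mkℚ; toℚᵘ)
import Data.Rational.Properties as ℚP
import Data.Rational.Unnormalised as ℚᵘ
import Data.Rational.Unnormalised.Properties as ℚᵘP
open import Data.List using ([]; _∷_; _++_; map; upTo; applyUpTo; length; zipWith)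
import Data.List.Properties as ListP
open import Data.Product using (Σ-syntax; _×_; _,_; proj₁; proj₂)
open import Data.Sum using (_⊎_; inj₁; inj₂)
open import Data.Empty using (⊥-elim)
open import Function using (_∘_; id; case_of_)
open import Relation.Nullary using (¬_; Dec; yes; no)
open import Relation.Nullary.Decidable using (⌊_⌋; dec⇒maybe)
open import Relation.Binary.PropositionalEquality
open import Tactic.RingSolver using (solve-∀)
open import Tactic.RingSolver.Core.AlmostCommutativeRing using (AlmostCommutativeRing; fromCommutativeRing)
open import Algebra.Bundles using (CommutativeRing)
import Data.Maybe
import Algebra.Solver.Ring
import Algebra.Solver.Ring.AlmostCommutativeRing as ACR
open import Algebra.Solver.Ring.AlmostCommutativeRing using (_-Raw-AlmostCommutative⟶_)
import Data.Integer.DivMod as ℤD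
open import Data.Nat.GCD using (module Bézout)

-- Dividing the comparison of coefficients by p leaves a congruence modulo p³ in which 𝓣 carries p²,
-- 𝓒 carries p, and the combination z - 3 y + 2 x of divided Bernoulli numbers carries no explicit
-- factor. So 𝓣 modulo p appears only after every other quantity is expanded in digits and the
-- orders 1 and p are removed. Order 1 vanishes by Kummer's congruences. Order p vanishes because
-- the same congruence, read modulo p², determines the units digit of 𝓒: this is the origin of E₁
-- and E₂ in the statement, and the carry of the vanishing sum into order p² is the last digit term
-- there. The multiplier 2 in the sorting argument accounts for p ≥ 11. For k = j (p - 1) - r one
-- has 2^k ≡ 2^(-r) modulo p, so division by 2^k - 1 asks that p be prime to 2^r - 1, which is 3,
-- 15, 63 for r = 2, 4, 6; division by k for j ≤ 4 uses r + 4 < p. At indices beyond p only p B_k is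
-- known in advance to be integral, hence the estimates of p^j / (j + 1) in the tails of Faulhaber's
-- formula.

ℚ-ring : AlmostCommutativeRing _ _
ℚ-ring = fromCommutativeRing ℚP.+-*-commutativeRing (λ x → dec⇒maybe (0ℚ ℚP.≟ x))

module ℚSolver = Data.Rational.Solver.+-*-Solver

-- Integers, powers and finite sums in ℚ

toℚᵘ-/ : ∀ i d → toℚᵘ (i / suc d) ℚᵘ.≃ ℚᵘ.mkℚᵘ i d
toℚᵘ-/ i d = ℚP.toℚᵘ-fromℚᵘ (ℚᵘ.mkℚᵘ i d)

ιℤ-+ : ∀ i j → ιℤ (i ℤ.+ j) ≡ ιℤ i + ιℤ j
ιℤ-+ i j = ℚP.toℚᵘ-injective (begin
  toℚᵘ (ιℤ (i ℤ.+ j))                      ≈⟨ toℚᵘ-/ (i ℤ.+ j) 0 ⟩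
  ℚᵘ.mkℚᵘ (i ℤ.+ j) 0                      ≈⟨ ℚᵘ.*≡* (cong (ℤ._* ℤ.+ 1) (cong₂ ℤ._+_ (sym (ℤP.*-identityʳ i)) (sym (ℤP.*-identityʳ j)))) ⟩
  ℚᵘ.mkℚᵘ i 0 ℚᵘ.+ ℚᵘ.mkℚᵘ j 0              ≈⟨ ℚᵘP.+-cong (ℚᵘP.≃-sym (toℚᵘ-/ i 0)) (ℚᵘP.≃-sym (toℚᵘ-/ j 0)) ⟩
  toℚᵘ (ιℤ i) ℚᵘ.+ toℚᵘ (ιℤ j)             ≈⟨ ℚᵘP.≃-sym (ℚP.toℚᵘ-homo-+ (ιℤ i) (ιℤ j)) ⟩
  toℚᵘ (ιℤ i + ιℤ j)                       ∎)
  where open ℚᵘP.≃-Reasoning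

ιℤ-* : ∀ i j → ιℤ (i ℤ.* j) ≡ ιℤ i * ιℤ j
ιℤ-* i j = ℚP.toℚᵘ-injective (begin
  toℚᵘ (ιℤ (i ℤ.* j))                      ≈⟨ toℚᵘ-/ (i ℤ.* j) 0 ⟩
  ℚᵘ.mkℚᵘ i 0 ℚᵘ.* ℚᵘ.mkℚᵘ j 0              ≈⟨ ℚᵘP.*-cong (ℚᵘP.≃-sym (toℚᵘ-/ i 0)) (ℚᵘP.≃-sym (toℚᵘ-/ j 0)) ⟩
  toℚᵘ (ιℤ i) ℚᵘ.* toℚᵘ (ιℤ j)             ≈⟨ ℚᵘP.≃-sym (ℚP.toℚᵘ-homo-* (ιℤ i) (ιℤ j)) ⟩
  toℚᵘ (ιℤ i * ιℤ j)                       ∎)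
  where open ℚᵘP.≃-Reasoning

ιℤ-neg : ∀ i → ιℤ (ℤ.- i) ≡ - ιℤ i
ιℤ-neg i = begin
  ιℤ (ℤ.- i)                      ≡⟨ ring (ιℤ (ℤ.- i)) (ιℤ i) ⟩
  (ιℤ (ℤ.- i) + ιℤ i) - ιℤ i      ≡⟨ cong (_- ιℤ i) (trans (sym (ιℤ-+ (ℤ.- i) i)) (cong ιℤ (ℤP.+-inverseˡ i))) ⟩
  0ℚ - ιℤ i                       ≡⟨ ℚP.+-identityˡ _ ⟩
  - ιℤ i                          ∎
  where
  open ≡-Reasoning
  ring : ∀ a b → a ≡ (a + b) - b
  ring = solve-∀ ℚ-ring

ιℤ-injective : ∀ {i j} → ιℤ i ≡ ιℤ j → i ≡ j
ιℤ-injective {i} {j} e with ℚᵘP.≃-trans (ℚᵘP.≃-sym (toℚᵘ-/ i 0)) (ℚᵘP.≃-trans (ℚP.toℚᵘ-cong e) (toℚᵘ-/ j 0))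
... | ℚᵘ.*≡* q = trans (sym (ℤP.*-identityʳ i)) (trans q (ℤP.*-identityʳ j))

ι-+ : ∀ m n → ι (m ℕ.+ n) ≡ ι m + ι n
ι-+ m n = ιℤ-+ (ℤ.+ m) (ℤ.+ n)

ι-* : ∀ m n → ι (m ℕ.* n) ≡ ι m * ι n
ι-* m n = trans (cong ιℤ (ℤP.pos-* m n)) (ιℤ-* (ℤ.+ m) (ℤ.+ n))

ι-suc : ∀ n → ι (suc n) ≡ 1ℚ + ι n
ι-suc n = ι-+ 1 n

rec : ℕ → ℚ
rec n = ℤ.+ 1 / suc n

/-ι : ∀ i n → ι (suc n) * (i / suc n) ≡ ιℤ i
/-ι i n = ℚP.toℚᵘ-injective (begin
  toℚᵘ (ι (suc n) * (i / suc n))                ≈⟨ ℚP.toℚᵘ-homo-* (ι (suc n)) (i / suc n) ⟩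
  toℚᵘ (ι (suc n)) ℚᵘ.* toℚᵘ (i / suc n)        ≈⟨ ℚᵘP.*-cong (toℚᵘ-/ (ℤ.+ suc n) 0) (toℚᵘ-/ i n) ⟩
  ℚᵘ.mkℚᵘ (ℤ.+ suc n) 0 ℚᵘ.* ℚᵘ.mkℚᵘ i n          ≈⟨ ℚᵘ.*≡* (trans (ℤP.*-identityʳ (ℤ.+ suc n ℤ.* i)) (trans (ℤP.*-comm (ℤ.+ suc n) i) (cong (λ z → i ℤ.* ℤ.+ suc z) (sym (ℕP.+-identityʳ n))))) ⟩
  ℚᵘ.mkℚᵘ i 0                                   ≈⟨ ℚᵘP.≃-sym (toℚᵘ-/ i 0) ⟩
  toℚᵘ (ιℤ i)                                   ∎)
  where open ℚᵘP.≃-Reasoning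

rec-inv : ∀ n → ι (suc n) * rec n ≡ 1ℚ
rec-inv n = /-ι (ℤ.+ 1) n

ι-cancel : ∀ n {x y} → ι (suc n) * x ≡ ι (suc n) * y → x ≡ y
ι-cancel n {x} {y} e = begin
  x                          ≡⟨ lem x ⟩
  rec n * (ι (suc n) * x)    ≡⟨ cong (rec n *_) e ⟩
  rec n * (ι (suc n) * y)    ≡⟨ sym (lem y) ⟩
  y                          ∎
  where
  open ≡-Reasoning
  ring : ∀ a b x → b * (a * x) ≡ (a * b) * x
  ring = solve-∀ ℚ-ring
  lem : ∀ x → x ≡ rec n * (ι (suc n) * x)
  lem x = sym (trans (ring (ι (suc n)) (rec n) x) (trans (cong (_* x) (rec-inv n)) (ℚP.*-identityˡ x)))

ι-nonZero : ∀ n .{{_ : ℕ.NonZero n}} {x} → ι n * x ≡ 0ℚ → x ≡ 0ℚ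
ι-nonZero (suc n) {x} e = ι-cancel n (trans e (sym (ℚP.*-zeroʳ (ι (suc n)))))

↧*-↥ : ∀ x → ι (↧ₙ x) * x ≡ ιℤ (↥ x)
↧*-↥ x@(mkℚ n d c) = trans (cong (ι (suc d) *_) (sym (ℚP.↥p/↧p≡p x))) (/-ι n d)

infixr 8 _^ℚ_
_^ℚ_ : ℚ → ℕ → ℚ
x ^ℚ zero  = 1ℚ
x ^ℚ suc n = x * x ^ℚ n

^ℚ-+ : ∀ x m n → x ^ℚ (m ℕ.+ n) ≡ x ^ℚ m * x ^ℚ n
^ℚ-+ x zero    n = sym (ℚP.*-identityˡ _)
^ℚ-+ x (suc m) n = trans (cong (x *_) (^ℚ-+ x m n)) (sym (ℚP.*-assoc x (x ^ℚ m) (x ^ℚ n)))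

^ℚ-*-distrib : ∀ x y n → (x * y) ^ℚ n ≡ x ^ℚ n * y ^ℚ n
^ℚ-*-distrib x y zero    = refl
^ℚ-*-distrib x y (suc n) = trans (cong ((x * y) *_) (^ℚ-*-distrib x y n)) (ring x y (x ^ℚ n) (y ^ℚ n))
  where
  ring : ∀ a b c d → a * b * (c * d) ≡ a * c * (b * d)
  ring = solve-∀ ℚ-ring

^ℚ-* : ∀ x m n → x ^ℚ (m ℕ.* n) ≡ (x ^ℚ n) ^ℚ m
^ℚ-* x zero    n = refl
^ℚ-* x (suc m) n = trans (^ℚ-+ x n (m ℕ.* n)) (cong (x ^ℚ n *_) (^ℚ-* x m n))

1^ℚ : ∀ n → 1ℚ ^ℚ n ≡ 1ℚ
1^ℚ zero    = refl
1^ℚ (suc n) = trans (ℚP.*-identityˡ _) (1^ℚ n)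

0^ℚ : ∀ n → 0ℚ ^ℚ suc n ≡ 0ℚ
0^ℚ n = ℚP.*-zeroˡ (0ℚ ^ℚ n)

ι-^ : ∀ m n → ι (m ^ n) ≡ ι m ^ℚ n
ι-^ m zero    = refl
ι-^ m (suc n) = trans (ι-* m (m ^ n)) (cong (ι m *_) (ι-^ m n))

∑ : ℕ → (ℕ → ℚ) → ℚ
∑ zero    f = 0ℚ
∑ (suc n) f = ∑ n f + f n

∑-cong : ∀ n {f g} → (∀ i → i < n → f i ≡ g i) → ∑ n f ≡ ∑ n g
∑-cong zero    e = refl
∑-cong (suc n) e = cong₂ _+_ (∑-cong n (λ i i<n → e i (ℕP.m<n⇒m<1+n i<n))) (e n ℕP.≤-refl)

∑-head : ∀ n f → ∑ (suc n) f ≡ f 0 + ∑ n (f ∘ suc)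
∑-head zero    f = ℚP.+-comm 0ℚ (f 0)
∑-head (suc n) f = trans (cong (_+ f (suc n)) (∑-head n f)) (ℚP.+-assoc (f 0) (∑ n (f ∘ suc)) (f (suc n)))

∑-+ : ∀ n f g → ∑ n (λ i → f i + g i) ≡ ∑ n f + ∑ n g
∑-+ zero    f g = refl
∑-+ (suc n) f g = trans (cong (_+ (f n + g n)) (∑-+ n f g)) (ring (∑ n f) (∑ n g) (f n) (g n))
  where
  ring : ∀ a b c d → a + b + (c + d) ≡ a + c + (b + d)
  ring = solve-∀ ℚ-ring

∑-* : ∀ n c f → ∑ n (λ i → c * f i) ≡ c * ∑ n f
∑-* zero    c f = sym (ℚP.*-zeroʳ c)
∑-* (suc n) c f = trans (cong (_+ c * f n) (∑-* n c f)) (sym (ℚP.*-distribˡ-+ c (∑ n f) (f n)))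

∑-split : ∀ m n f → ∑ (m ℕ.+ n) f ≡ ∑ m f + ∑ n (λ i → f (m ℕ.+ i))
∑-split m zero    f = trans (cong (λ z → ∑ z f) (ℕP.+-identityʳ m)) (sym (ℚP.+-identityʳ _))
∑-split m (suc n) f rewrite ℕP.+-suc m n = trans (cong (_+ f (m ℕ.+ n)) (∑-split m n f)) (ℚP.+-assoc (∑ m f) _ _)

-- Formal power series

Series : Set
Series = ℕ → ℚ

infixl 6 _⊕_
infixl 7 _⋆_
infix  8 ⊖_

𝟘 X : Series
𝟘 _ = 0ℚ
X zero          = 0ℚ
X (suc zero)    = 1ℚ
X (suc (suc _)) = 0ℚ

const : ℚ → Series
const c zero    = c
const c (suc _) = 0ℚ

𝟙 : Series
𝟙 = const 1ℚ

_⊕_ _⋆_ : Series → Series → Series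
(f ⊕ g) n = f n + g n
(f ⋆ g) zero    = f 0 * g 0
(f ⋆ g) (suc n) = f 0 * g (suc n) + (f ∘ suc ⋆ g) n

⊖_ : Series → Series
(⊖ f) n = - f n

⋆-cong-≤ : ∀ n {f f′ g g′} → (∀ i → i ≤ n → f i ≡ f′ i) → (∀ i → i ≤ n → g i ≡ g′ i) → (f ⋆ g) n ≡ (f′ ⋆ g′) n
⋆-cong-≤ zero    ef eg = cong₂ _*_ (ef 0 z≤n) (eg 0 z≤n)
⋆-cong-≤ (suc n) ef eg = cong₂ _+_ (cong₂ _*_ (ef 0 z≤n) (eg (suc n) ℕP.≤-refl))
  (⋆-cong-≤ n (λ i i≤n → ef (suc i) (s≤s i≤n)) (λ i i≤n → eg i (ℕP.m≤n⇒m≤1+n i≤n)))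

⋆-cong : ∀ {f f′ g g′} → f ≗ f′ → g ≗ g′ → f ⋆ g ≗ f′ ⋆ g′
⋆-cong ef eg n = ⋆-cong-≤ n (λ i _ → ef i) (λ i _ → eg i)

⋆-last : ∀ f g n → (f ⋆ g) (suc n) ≡ (f ⋆ (g ∘ suc)) n + f (suc n) * g 0
⋆-last f g zero    = refl
⋆-last f g (suc n) = trans (cong ((f 0 * g (suc (suc n))) +_) (⋆-last (f ∘ suc) g n))
  (sym (ℚP.+-assoc (f 0 * g (suc (suc n))) _ _))

⋆-comm : ∀ f g → f ⋆ g ≗ g ⋆ f
⋆-comm f g zero    = ℚP.*-comm (f 0) (g 0)
⋆-comm f g (suc n) = begin
  f 0 * g (suc n) + (f ∘ suc ⋆ g) n   ≡⟨ cong₂ _+_ (ℚP.*-comm (f 0) (g (suc n))) (⋆-comm (f ∘ suc) g n) ⟩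
  g (suc n) * f 0 + (g ⋆ f ∘ suc) n   ≡⟨ ℚP.+-comm (g (suc n) * f 0) _ ⟩
  (g ⋆ f ∘ suc) n + g (suc n) * f 0   ≡⟨ sym (⋆-last g f n) ⟩
  (g ⋆ f) (suc n)                     ∎
  where open ≡-Reasoning

⋆-distribʳ : ∀ h f g → (f ⊕ g) ⋆ h ≗ (f ⋆ h) ⊕ (g ⋆ h)
⋆-distribʳ h f g zero    = ℚP.*-distribʳ-+ (h 0) (f 0) (g 0)
⋆-distribʳ h f g (suc n) = trans (cong (((f 0 + g 0) * h (suc n)) +_) (⋆-distribʳ h (f ∘ suc) (g ∘ suc) n))
  (ring (f 0) (g 0) (h (suc n)) ((f ∘ suc ⋆ h) n) ((g ∘ suc ⋆ h) n))
  where
  ring : ∀ a b c d e → (a + b) * c + (d + e) ≡ (a * c + d) + (b * c + e)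
  ring = solve-∀ ℚ-ring

⋆-distribˡ : ∀ h f g → h ⋆ (f ⊕ g) ≗ (h ⋆ f) ⊕ (h ⋆ g)
⋆-distribˡ h f g n = trans (⋆-comm h (f ⊕ g) n) (trans (⋆-distribʳ h f g n)
  (cong₂ _+_ (⋆-comm f h n) (⋆-comm g h n)))

⋆-scaleˡ : ∀ c f g n → ((λ i → c * f i) ⋆ g) n ≡ c * (f ⋆ g) n
⋆-scaleˡ c f g zero    = ℚP.*-assoc c (f 0) (g 0)
⋆-scaleˡ c f g (suc n) = trans (cong ((c * f 0 * g (suc n)) +_) (⋆-scaleˡ c (f ∘ suc) g n))
  (ring c (f 0) (g (suc n)) _)
  where
  ring : ∀ c a b d → c * a * b + c * d ≡ c * (a * b + d)
  ring = solve-∀ ℚ-ring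

⋆-scaleʳ : ∀ c f g n → (f ⋆ (λ i → c * g i)) n ≡ c * (f ⋆ g) n
⋆-scaleʳ c f g n = trans (⋆-comm f _ n) (trans (⋆-scaleˡ c g f n) (cong (c *_) (⋆-comm g f n)))

⋆-assoc : ∀ f g h → (f ⋆ g) ⋆ h ≗ f ⋆ (g ⋆ h)
⋆-assoc f g h zero    = ℚP.*-assoc (f 0) (g 0) (h 0)
⋆-assoc f g h (suc n) = begin
  f 0 * g 0 * h (suc n) + (((λ i → f 0 * g (suc i)) ⊕ (f ∘ suc ⋆ g)) ⋆ h) n
    ≡⟨ cong ((f 0 * g 0 * h (suc n)) +_) (⋆-distribʳ h (λ i → f 0 * g (suc i)) (f ∘ suc ⋆ g) n) ⟩
  f 0 * g 0 * h (suc n) + (((λ i → f 0 * g (suc i)) ⋆ h) n + ((f ∘ suc ⋆ g) ⋆ h) n)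
    ≡⟨ cong ((f 0 * g 0 * h (suc n)) +_) (cong₂ _+_ (⋆-scaleˡ (f 0) (g ∘ suc) h n) (⋆-assoc (f ∘ suc) g h n)) ⟩
  f 0 * g 0 * h (suc n) + (f 0 * (g ∘ suc ⋆ h) n + (f ∘ suc ⋆ (g ⋆ h)) n)
    ≡⟨ ring (f 0) (g 0) (h (suc n)) _ _ ⟩
  f 0 * (g 0 * h (suc n) + (g ∘ suc ⋆ h) n) + (f ∘ suc ⋆ (g ⋆ h)) n ∎
  where
  open ≡-Reasoning
  ring : ∀ a b c d e → a * b * c + (a * d + e) ≡ a * (b * c + d) + e
  ring = solve-∀ ℚ-ring

⋆-zeroˡ : ∀ f → 𝟘 ⋆ f ≗ 𝟘
⋆-zeroˡ f zero    = ℚP.*-zeroˡ (f 0)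
⋆-zeroˡ f (suc n) = trans (cong₂ _+_ (ℚP.*-zeroˡ (f (suc n))) (⋆-zeroˡ f n)) refl

const-⋆ : ∀ c f n → (const c ⋆ f) n ≡ c * f n
const-⋆ c f zero    = refl
const-⋆ c f (suc n) = trans (cong ((c * f (suc n)) +_) (⋆-zeroˡ f n)) (ℚP.+-identityʳ _)

⋆-identityˡ : ∀ f → 𝟙 ⋆ f ≗ f
⋆-identityˡ f n = trans (const-⋆ 1ℚ f n) (ℚP.*-identityˡ (f n))

X-⋆-zero : ∀ f → (X ⋆ f) 0 ≡ 0ℚ
X-⋆-zero f = ℚP.*-zeroˡ (f 0)

X-⋆-suc : ∀ f n → (X ⋆ f) (suc n) ≡ f n
X-⋆-suc f n = trans (cong₂ _+_ (ℚP.*-zeroˡ (f (suc n))) (trans (⋆-cong {g = f} X∘suc (λ _ → refl) n) (⋆-identityˡ f n))) (ℚP.+-identityˡ (f n))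
  where
  X∘suc : X ∘ suc ≗ 𝟙
  X∘suc zero    = refl
  X∘suc (suc _) = refl

Series-commutativeRing : CommutativeRing _ _
Series-commutativeRing = record
  { Carrier = Series
  ; _≈_ = _≗_
  ; _+_ = _⊕_
  ; _*_ = _⋆_
  ; -_ = ⊖_
  ; 0# = 𝟘
  ; 1# = 𝟙
  ; isCommutativeRing = record
    { isRing = record
      { +-isAbelianGroup = record
        { isGroup = record
          { isMonoid = record
            { isSemigroup = record
              { isMagma = record
                { isEquivalence = record { refl = λ _ → refl ; sym = λ e n → sym (e n) ; trans = λ e e′ n → trans (e n) (e′ n) }
                ; ∙-cong = λ e e′ n → cong₂ _+_ (e n) (e′ n) }
              ; assoc = λ f g h n → ℚP.+-assoc (f n) (g n) (h n) }
            ; identity = (λ f n → ℚP.+-identityˡ (f n)) , (λ f n → ℚP.+-identityʳ (f n)) }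
          ; inverse = (λ f n → ℚP.+-inverseˡ (f n)) , (λ f n → ℚP.+-inverseʳ (f n))
          ; ⁻¹-cong = λ e n → cong -_ (e n) }
        ; comm = λ f g n → ℚP.+-comm (f n) (g n) }
      ; *-cong = ⋆-cong
      ; *-assoc = ⋆-assoc
      ; *-identity = ⋆-identityˡ , (λ f n → trans (⋆-comm f 𝟙 n) (⋆-identityˡ f n))
      ; distrib = ⋆-distribˡ , ⋆-distribʳ }
    ; *-comm = ⋆-comm } }

-- Rational coefficients enter the solver for series as constant series, so that identities
-- involving `½` or `ι 6` can be normalised.
const-morphism : CommutativeRing.rawRing ℚP.+-*-commutativeRing -Raw-AlmostCommutative⟶ ACR.fromCommutativeRing Series-commutativeRing
const-morphism = record
  { ⟦_⟧    = const
  ; +-homo = λ { a b zero → refl ; a b (suc n) → refl }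
  ; *-homo = λ { a b zero → refl ; a b (suc n) → sym (trans (const-⋆ a (const b) (suc n)) (ℚP.*-zeroʳ a)) }
  ; -‿homo = λ { a zero → refl ; a (suc n) → refl }
  ; 0-homo = λ { zero → refl ; (suc n) → refl }
  ; 1-homo = λ _ → refl
  }

module SeriesSolver = Algebra.Solver.Ring (CommutativeRing.rawRing ℚP.+-*-commutativeRing)
  (ACR.fromCommutativeRing Series-commutativeRing) const-morphism
  (λ a b → Data.Maybe.map (λ e n → cong (λ c → const c n) e) (dec⇒maybe (a ℚP.≟ b)))

∂ : Series → Series
∂ f n = ι (suc n) * f (suc n)

∂-⋆ : ∀ f g → ∂ (f ⋆ g) ≗ (∂ f ⋆ g) ⊕ (f ⋆ ∂ g)
∂-⋆ f g zero = ring (f 0) (f 1) (g 0) (g 1)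
  where
  ring : ∀ a b c d → ι 1 * (a * d + b * c) ≡ ι 1 * b * c + a * (ι 1 * d)
  ring = solve-∀ ℚ-ring
∂-⋆ f g (suc n) = begin
  ι (2 ℕ.+ n) * (f 0 * g (2 ℕ.+ n) + h)
    ≡⟨ ℚP.*-distribˡ-+ (ι (2 ℕ.+ n)) (f 0 * g (2 ℕ.+ n)) h ⟩
  ι (2 ℕ.+ n) * (f 0 * g (2 ℕ.+ n)) + ι (2 ℕ.+ n) * h
    ≡⟨ cong₂ _+_ (ring₁ (ι (2 ℕ.+ n)) (f 0) (g (2 ℕ.+ n))) (trans (cong (_* h) (ι-suc (suc n))) (ring₂ (ι (suc n)) h)) ⟩
  f 0 * ∂ g (suc n) + (h + ∂ (f ∘ suc ⋆ g) n)
    ≡⟨ cong (λ z → f 0 * ∂ g (suc n) + (h + z)) (∂-⋆ (f ∘ suc) g n) ⟩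
  f 0 * ∂ g (suc n) + (h + ((∂ (f ∘ suc) ⋆ g) n + (f ∘ suc ⋆ ∂ g) n))
    ≡⟨ ring₃ (f 0 * ∂ g (suc n)) h _ _ ⟩
  (h + (∂ (f ∘ suc) ⋆ g) n) + (f 0 * ∂ g (suc n) + (f ∘ suc ⋆ ∂ g) n)
    ≡⟨ cong (_+ (f ⋆ ∂ g) (suc n)) (trans (cong (_+ (∂ (f ∘ suc) ⋆ g) n) (split g n)) (sym (∂f-eq))) ⟩
  (∂ f ⋆ g) (suc n) + (f ⋆ ∂ g) (suc n) ∎
  where
  open ≡-Reasoning
  h = (f ∘ suc ⋆ g) (suc n)
  ring₁ : ∀ a b c → a * (b * c) ≡ b * (a * c)
  ring₁ = solve-∀ ℚ-ring
  ring₂ : ∀ a b → (1ℚ + a) * b ≡ b + a * b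
  ring₂ = solve-∀ ℚ-ring
  ring₃ : ∀ a b c d → a + (b + (c + d)) ≡ (b + c) + (a + d)
  ring₃ = solve-∀ ℚ-ring
  split : ∀ g n → (f ∘ suc ⋆ g) (suc n) ≡ f 1 * g (suc n) + ((f ∘ suc ∘ suc) ⋆ g) n
  split g n = refl
  tail : ∂ f ∘ suc ≗ (f ∘ suc ∘ suc) ⊕ ∂ (f ∘ suc)
  tail m = trans (cong (_* f (2 ℕ.+ m)) (ι-suc (suc m))) (ring₂ (ι (suc m)) (f (2 ℕ.+ m)))
  ring₄ : ∀ a b c d → ι 1 * a * b + (c + d) ≡ a * b + c + d
  ring₄ = solve-∀ ℚ-ring
  ∂f-eq : (∂ f ⋆ g) (suc n) ≡ f 1 * g (suc n) + ((f ∘ suc ∘ suc) ⋆ g) n + (∂ (f ∘ suc) ⋆ g) n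
  ∂f-eq = trans (cong ((ι 1 * f 1 * g (suc n)) +_)
            (trans (⋆-cong {g = g} tail (λ _ → refl) n) (⋆-distribʳ g (f ∘ suc ∘ suc) (∂ (f ∘ suc)) n)))
            (ring₄ (f 1) (g (suc n)) _ _)

-- Substitution of - X for X.
σ : Series → Series
σ f n = (- 1ℚ) ^ℚ n * f n

σ-⋆ : ∀ f g → σ (f ⋆ g) ≗ σ f ⋆ σ g
σ-⋆ f g zero    = ring (f 0) (g 0)
  where
  ring : ∀ a b → 1ℚ * (a * b) ≡ 1ℚ * a * (1ℚ * b)
  ring = solve-∀ ℚ-ring
σ-⋆ f g (suc n) = begin
  (- 1ℚ) ^ℚ suc n * (f 0 * g (suc n) + (f ∘ suc ⋆ g) n)
    ≡⟨ ring ((- 1ℚ) ^ℚ n) (f 0) (g (suc n)) ((f ∘ suc ⋆ g) n) ⟩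
  1ℚ * f 0 * σ g (suc n) + - 1ℚ * σ (f ∘ suc ⋆ g) n
    ≡⟨ cong (λ z → 1ℚ * f 0 * σ g (suc n) + - 1ℚ * z) (σ-⋆ (f ∘ suc) g n) ⟩
  1ℚ * f 0 * σ g (suc n) + - 1ℚ * (σ (f ∘ suc) ⋆ σ g) n
    ≡⟨ cong ((1ℚ * f 0 * σ g (suc n)) +_) (sym (⋆-scaleˡ (- 1ℚ) (σ (f ∘ suc)) (σ g) n)) ⟩
  1ℚ * f 0 * σ g (suc n) + ((λ i → - 1ℚ * σ (f ∘ suc) i) ⋆ σ g) n
    ≡⟨ cong ((1ℚ * f 0 * σ g (suc n)) +_) (⋆-cong {g = σ g} (λ i → sym (ℚP.*-assoc (- 1ℚ) ((- 1ℚ) ^ℚ i) (f (suc i)))) (λ _ → refl) n) ⟩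
  (σ f ⋆ σ g) (suc n) ∎
  where
  open ≡-Reasoning
  ring : ∀ a b c d → - 1ℚ * a * (b * c + d) ≡ 1ℚ * b * (- 1ℚ * a * c) + - 1ℚ * (a * d)
  ring = solve-∀ ℚ-ring

-- Bernoulli numbers

ifact : ℕ → ℚ
ifact zero    = 1ℚ
ifact (suc n) = rec n * ifact n

fact-ifact : ∀ n → ι (n !) * ifact n ≡ 1ℚ
fact-ifact zero    = refl
fact-ifact (suc n) = begin
  ι (suc n ℕ.* n !) * (rec n * ifact n)        ≡⟨ cong (_* (rec n * ifact n)) (ι-* (suc n) (n !)) ⟩
  ι (suc n) * ι (n !) * (rec n * ifact n)      ≡⟨ ring (ι (suc n)) (ι (n !)) (rec n) (ifact n) ⟩
  ι (suc n) * rec n * (ι (n !) * ifact n)      ≡⟨ cong₂ _*_ (rec-inv n) (fact-ifact n) ⟩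
  1ℚ                                           ∎
  where
  open ≡-Reasoning
  ring : ∀ a b c d → a * b * (c * d) ≡ a * c * (b * d)
  ring = solve-∀ ℚ-ring

nC0≡1 : ∀ n → n C 0 ≡ 1
nC0≡1 n = trans (ℕC.nCk≡nC[n∸k] {k = 0} {n = n} z≤n) (ℕC.nCn≡1 n)

-- In this form a binomial sum becomes a Cauchy product of exponential generating functions.
C-ifact : ∀ {n k} → k ≤ n → ι (n C k) ≡ ι (n !) * (ifact k * ifact (n ∸ k))
C-ifact {n} {k} k≤n = begin
  c                                       ≡⟨ sym (ℚP.*-identityʳ c) ⟩
  c * (1ℚ * 1ℚ)                           ≡⟨ cong (c *_) (sym (cong₂ _*_ (fact-ifact k) (fact-ifact (n ∸ k)))) ⟩
  c * ((x * ifact k) * (y * ifact (n ∸ k))) ≡⟨ ring c x (ifact k) y (ifact (n ∸ k)) ⟩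
  c * (x * y) * (ifact k * ifact (n ∸ k)) ≡⟨ cong (_* (ifact k * ifact (n ∸ k))) (trans (cong (c *_) (sym (ι-* (k !) ((n ∸ k) !)))) (sym (ι-* (n C k) (k ! ℕ.* (n ∸ k) !)))) ⟩
  ι ((n C k) ℕ.* (k ! ℕ.* (n ∸ k) !)) * (ifact k * ifact (n ∸ k)) ≡⟨ cong (λ z → ι z * (ifact k * ifact (n ∸ k))) C-fact ⟩
  ι (n !) * (ifact k * ifact (n ∸ k))     ∎
  where
  open ≡-Reasoning
  c = ι (n C k)
  x = ι (k !)
  y = ι ((n ∸ k) !)
  instance
    k!≢0 = ℕP._!≢0 k
    n∸k!≢0 = ℕP._!≢0 (n ∸ k)
    k![n∸k]!≢0 = ℕP._!*_!≢0 k (n ∸ k)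
  C-fact : (n C k) ℕ.* (k ! ℕ.* (n ∸ k) !) ≡ n !
  C-fact = trans (cong (ℕ._* (k ! ℕ.* (n ∸ k) !)) (ℕC.nCk≡n!/k![n-k]! k≤n)) (ℕD.m/n*n≡m (ℕC.k![n∸k]!∣n! k≤n))
  ring : ∀ c x i y j → c * ((x * i) * (y * j)) ≡ c * (x * y) * (i * j)
  ring = solve-∀ ℚ-ring

⋆-∑ : ∀ f g n → (f ⋆ g) n ≡ ∑ (suc n) (λ k → f k * g (n ∸ k))
⋆-∑ f g zero    = sym (ℚP.+-identityˡ _)
⋆-∑ f g (suc n) = trans (cong (λ z → f 0 * g (suc n) + z) (⋆-∑ (f ∘ suc) g n))
  (sym (∑-head (suc n) (λ k → f k * g (suc n ∸ k))))

nth-++ˡ : ∀ xs ys k → k < length xs → nth (xs ++ ys) k ≡ nth xs k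
nth-++ˡ (x ∷ xs) ys zero    _         = refl
nth-++ˡ (x ∷ xs) ys (suc k) (s≤s k<n) = nth-++ˡ xs ys k k<n

nth-last : ∀ xs y → nth (xs ++ y ∷ []) (length xs) ≡ y
nth-last []       y = refl
nth-last (x ∷ xs) y = nth-last xs y

length-Bs : ∀ n → length (Bs n) ≡ suc n
length-Bs zero    = refl
length-Bs (suc n) = trans (ListP.length-++ (Bs n)) (trans (ℕP.+-comm (length (Bs n)) 1) (cong suc (length-Bs n)))

nth-Bs : ∀ n k → k ≤ n → nth (Bs n) k ≡ B k
nth-Bs n k k≤n with ℕP.m≤n⇒m<n∨m≡n k≤n
nth-Bs n       k k≤n | inj₂ refl = refl
nth-Bs (suc n) k k≤n | inj₁ (s≤s k≤n′) =
  trans (nth-++ˡ (Bs n) _ k (subst (k <_) (sym (length-Bs n)) (s≤s k≤n′))) (nth-Bs n k k≤n′)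

sum-zipWith : ∀ (f : ℕ → ℚ → ℚ) (g : ℕ → ℕ) m xs → length xs ≡ m →
              sumℚ (zipWith f (applyUpTo g m) xs) ≡ ∑ m (λ k → f (g k) (nth xs k))
sum-zipWith f g zero    []       _ = refl
sum-zipWith f g (suc m) (x ∷ xs) e = trans (cong (λ z → f (g 0) x + z) (sum-zipWith f (g ∘ suc) m xs (ℕP.suc-injective e)))
  (sym (∑-head m (λ k → f (g k) (nth (x ∷ xs) k))))

B-suc : ∀ n → B (suc n) ≡ - (rec (suc n) * ∑ (suc n) (λ k → ι (suc (suc n) C k) * B k))
B-suc n = trans last (cong (λ z → - (rec (suc n) * z))
  (trans (sum-zipWith (λ k b → ι (suc (suc n) C k) * b) id (suc n) (Bs n) (length-Bs n))
         (∑-cong (suc n) (λ k k<n → cong (ι (suc (suc n) C k) *_) (nth-Bs n k (ℕP.≤-pred k<n))))))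
  where
  last : B (suc n) ≡ - (rec (suc n) * sumℚ (zipWith (λ k b → ι (suc (suc n) C k) * b) (upTo (suc n)) (Bs n)))
  last = trans (cong (nth (Bs (suc n))) (sym (length-Bs n))) (nth-last (Bs n) _)

bern expm1/X : Series
bern n = B n * ifact n
expm1/X n = ifact (suc n)

-- `bern` is X / (e^X - 1) and `expm1/X` is (e^X - 1) / X. Multiplied by (n + 2)!, the coefficient
-- of degree n + 1 of their product is the sum that the recurrence for B sets to zero.
bern-inverse : bern ⋆ expm1/X ≗ 𝟙
bern-inverse zero    = refl
bern-inverse (suc n) = begin
  (bern ⋆ expm1/X) (suc n)
    ≡⟨ ⋆-∑ bern expm1/X (suc n) ⟩
  ∑ (2 ℕ.+ n) (λ k → bern k * expm1/X (suc n ∸ k))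
    ≡⟨ ∑-cong (2 ℕ.+ n) term ⟩
  ∑ (2 ℕ.+ n) (λ k → c * (ι (m C k) * B k))
    ≡⟨ ∑-* (2 ℕ.+ n) c (λ k → ι (m C k) * B k) ⟩
  c * (s + ι (m C suc n) * B (suc n))
    ≡⟨ cong (λ z → c * (s + z)) (trans (cong₂ _*_ (cong ι mCsn) (B-suc n)) (ring₂ (ι m) (rec (suc n)) s)) ⟩
  c * (s - (ι m * rec (suc n)) * s)
    ≡⟨ cong (λ z → c * (s - z * s)) (rec-inv (suc n)) ⟩
  c * (s - 1ℚ * s)
    ≡⟨ ring₃ c s ⟩
  0ℚ ∎
  where
  open ≡-Reasoning
  m = suc (suc n)
  c = ifact m
  s = ∑ (suc n) (λ k → ι (m C k) * B k)
  mCsn : m C suc n ≡ m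
  mCsn = trans (ℕC.nCk≡nC[n∸k] {k = suc n} {n = m} (ℕP.n≤1+n (suc n)))
    (trans (cong (m C_) (trans (ℕP.+-∸-assoc 1 {n} ℕP.≤-refl) (cong suc (ℕP.n∸n≡0 n)))) (ℕC.nC1≡n m))
  ring₂ : ∀ m r s → m * - (r * s) ≡ - ((m * r) * s)
  ring₂ = solve-∀ ℚ-ring
  ring₃ : ∀ c s → c * (s - 1ℚ * s) ≡ 0ℚ
  ring₃ = solve-∀ ℚ-ring
  ring₄ : ∀ f c b i j → (f * c) * (b * i * j) ≡ c * (f * (i * j) * b)
  ring₄ = solve-∀ ℚ-ring
  term : ∀ k → k < 2 ℕ.+ n → bern k * expm1/X (suc n ∸ k) ≡ c * (ι (m C k) * B k)
  term k k<m = begin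
    B k * ifact k * ifact (suc (suc n ∸ k))
      ≡⟨ cong (λ z → B k * ifact k * ifact z) (sym (ℕP.+-∸-assoc 1 (ℕP.≤-pred k<m))) ⟩
    B k * ifact k * ifact (m ∸ k)
      ≡⟨ sym (ℚP.*-identityˡ _) ⟩
    1ℚ * (B k * ifact k * ifact (m ∸ k))
      ≡⟨ cong (_* (B k * ifact k * ifact (m ∸ k))) (sym (fact-ifact m)) ⟩
    (ι (m !) * c) * (B k * ifact k * ifact (m ∸ k))
      ≡⟨ ring₄ (ι (m !)) c (B k) (ifact k) (ifact (m ∸ k)) ⟩
    c * (ι (m !) * (ifact k * ifact (m ∸ k)) * B k)
      ≡⟨ cong (λ z → c * (z * B k)) (sym (C-ifact {m} {k} (ℕP.<⇒≤ k<m))) ⟩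
    c * (ι (m C k) * B k) ∎

exp : ℚ → Series
exp c n = c ^ℚ n * ifact n

∂-exp : ∀ c n → ∂ (exp c) n ≡ c * exp c n
∂-exp c n = trans (ring (ι (suc n)) c (c ^ℚ n) (rec n) (ifact n))
  (trans (cong (_* (c * (c ^ℚ n * ifact n))) (rec-inv n)) (ℚP.*-identityˡ _))
  where
  ring : ∀ a c d r i → a * (c * d * (r * i)) ≡ (a * r) * (c * (d * i))
  ring = solve-∀ ℚ-ring

-- The equation f′ = c f determines each coefficient from the preceding one, because n + 1 is
-- invertible in ℚ. The addition law of `exp` follows from it.
linear-ode-unique : ∀ c (f g : Series) → f 0 ≡ g 0 → (∀ n → ∂ f n ≡ c * f n) → (∀ n → ∂ g n ≡ c * g n) → f ≗ g
linear-ode-unique c f g e₀ ef eg zero    = e₀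
linear-ode-unique c f g e₀ ef eg (suc n) =
  ι-cancel n (trans (ef n) (trans (cong (c *_) (linear-ode-unique c f g e₀ ef eg n)) (sym (eg n))))

exp-⋆ : ∀ c d → exp c ⋆ exp d ≗ exp (c + d)
exp-⋆ c d = linear-ode-unique (c + d) (exp c ⋆ exp d) (exp (c + d)) refl ode (∂-exp (c + d))
  where
  ode : ∀ n → ∂ (exp c ⋆ exp d) n ≡ (c + d) * (exp c ⋆ exp d) n
  ode n = begin
    ∂ (exp c ⋆ exp d) n                                         ≡⟨ ∂-⋆ (exp c) (exp d) n ⟩
    (∂ (exp c) ⋆ exp d) n + (exp c ⋆ ∂ (exp d)) n               ≡⟨ cong₂ _+_ (⋆-cong {g = exp d} (∂-exp c) (λ _ → refl) n) (⋆-cong {f = exp c} (λ _ → refl) (∂-exp d) n) ⟩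
    ((λ i → c * exp c i) ⋆ exp d) n + (exp c ⋆ (λ i → d * exp d i)) n ≡⟨ cong₂ _+_ (⋆-scaleˡ c (exp c) (exp d) n) (⋆-scaleʳ d (exp c) (exp d) n) ⟩
    c * (exp c ⋆ exp d) n + d * (exp c ⋆ exp d) n               ≡⟨ sym (ℚP.*-distribʳ-+ _ c d) ⟩
    (c + d) * (exp c ⋆ exp d) n                                 ∎
    where open ≡-Reasoning

exp-0 : exp 0ℚ ≗ 𝟙
exp-0 zero    = refl
exp-0 (suc n) = trans (cong (_* ifact (suc n)) (0^ℚ n)) (ℚP.*-zeroˡ (ifact (suc n)))

exp-1 : ∀ n → exp 1ℚ n ≡ ifact n
exp-1 n = trans (cong (_* ifact n) (1^ℚ n)) (ℚP.*-identityˡ _)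

powerSum : ℕ → ℕ → ℚ
powerSum k N = ∑ N (λ a → ι a ^ℚ k)

-- The sum of e^(aX) over a < N, multiplied by (e^X - 1) / X, telescopes to (e^(NX) - 1) / X, whose
-- coefficients are on the right; multiplication by `bern` then isolates the power sums.
faulhaber : ∀ N k → powerSum k N * ifact k ≡ (bern ⋆ (λ n → ι N ^ℚ suc n * ifact (suc n))) k
faulhaber N k = begin
  SE N k                              ≡⟨ sym (⋆-identityˡ (SE N) k) ⟩
  (𝟙 ⋆ SE N) k                        ≡⟨ ⋆-cong {g = SE N} (λ i → sym (bern-inverse i)) (λ _ → refl) k ⟩
  ((bern ⋆ expm1/X) ⋆ SE N) k         ≡⟨ ring bern expm1/X (SE N) k ⟩
  (bern ⋆ (SE N ⋆ expm1/X)) k         ≡⟨ ⋆-cong {f = bern} (λ _ → refl) (telescope N) k ⟩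
  (bern ⋆ EN N) k                     ∎
  where
  open ≡-Reasoning
  SE EN : ℕ → Series
  SE N k = powerSum k N * ifact k
  EN N n = ι N ^ℚ suc n * ifact (suc n)
  ring : ∀ a b c → (a ⋆ b) ⋆ c ≗ a ⋆ (c ⋆ b)
  ring = let open SeriesSolver in solve 3 (λ a b c → (a :* b) :* c := a :* (c :* b)) (λ _ → refl)
  telescope : ∀ N → SE N ⋆ expm1/X ≗ EN N
  telescope zero n = begin
    ((λ k → 0ℚ * ifact k) ⋆ expm1/X) n    ≡⟨ ⋆-scaleˡ 0ℚ ifact expm1/X n ⟩
    0ℚ * (ifact ⋆ expm1/X) n              ≡⟨ ℚP.*-zeroˡ ((ifact ⋆ expm1/X) n) ⟩
    0ℚ                                    ≡⟨ sym (ℚP.*-zeroˡ (ifact (suc n))) ⟩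
    0ℚ * ifact (suc n)                    ≡⟨ cong (_* ifact (suc n)) (sym (0^ℚ n)) ⟩
    0ℚ ^ℚ suc n * ifact (suc n)           ∎
  telescope (suc N) n = begin
    (SE (suc N) ⋆ expm1/X) n                       ≡⟨ ⋆-cong {g = expm1/X} (λ k → ℚP.*-distribʳ-+ (ifact k) (powerSum k N) (ι N ^ℚ k)) (λ _ → refl) n ⟩
    ((SE N ⊕ exp (ι N)) ⋆ expm1/X) n               ≡⟨ ⋆-distribʳ expm1/X (SE N) (exp (ι N)) n ⟩
    (SE N ⋆ expm1/X) n + (exp (ι N) ⋆ expm1/X) n   ≡⟨ cong₂ _+_ (telescope N n) (⋆-cong {f = exp (ι N)} (λ _ → refl) (λ k → sym (exp-1 (suc k))) n) ⟩
    exp (ι N) (suc n) + (exp (ι N) ⋆ (exp 1ℚ ∘ suc)) n ≡⟨ ring₂ (exp (ι N) (suc n)) _ ⟩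
    (exp (ι N) ⋆ (exp 1ℚ ∘ suc)) n + exp (ι N) (suc n) * 1ℚ ≡⟨ sym (⋆-last (exp (ι N)) (exp 1ℚ) n) ⟩
    (exp (ι N) ⋆ exp 1ℚ) (suc n)                   ≡⟨ exp-⋆ (ι N) 1ℚ (suc n) ⟩
    exp (ι N + 1ℚ) (suc n)                         ≡⟨ cong (λ z → exp z (suc n)) (trans (ℚP.+-comm (ι N) 1ℚ) (sym (ι-suc N))) ⟩
    EN (suc N) n                                   ∎
    where
    ring₂ : ∀ a b → a + b ≡ b + a * 1ℚ
    ring₂ = solve-∀ ℚ-ring

-- The identity - X / (e^(-X) - 1) = X e^X / (e^X - 1) = X / (e^X - 1) + X. It makes every odd
-- coefficient beyond the first its own negative.
σ-bern : σ bern ≗ bern ⊕ X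
σ-bern n = begin
  σ bern n                                ≡⟨ sym (⋆-identityˡ (σ bern) n) ⟩
  (𝟙 ⋆ σ bern) n                          ≡⟨ ⋆-cong {g = σ bern} (λ i → sym (bern-inverse i)) (λ _ → refl) n ⟩
  ((bern ⋆ expm1/X) ⋆ σ bern) n           ≡⟨ ring₁ bern expm1/X (σ bern) n ⟩
  (bern ⋆ (σ bern ⋆ expm1/X)) n           ≡⟨ ⋆-cong {f = bern} (λ _ → refl) σbern⋆ n ⟩
  (bern ⋆ (𝟙 ⊕ (X ⋆ expm1/X))) n          ≡⟨ ring₂ bern X expm1/X n ⟩
  (bern ⊕ (X ⋆ (bern ⋆ expm1/X))) n       ≡⟨ cong (λ z → bern n + z) (⋆-cong {f = X} (λ _ → refl) bern-inverse n) ⟩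
  (bern ⊕ (X ⋆ 𝟙)) n                      ≡⟨ ring₃ bern X n ⟩
  (bern ⊕ X) n                            ∎
  where
  open ≡-Reasoning
  ring₁ : ∀ a b c → (a ⋆ b) ⋆ c ≗ a ⋆ (c ⋆ b)
  ring₁ = let open SeriesSolver in solve 3 (λ a b c → (a :* b) :* c := a :* (c :* b)) (λ _ → refl)
  ring₂ : ∀ a b c → a ⋆ (𝟙 ⊕ (b ⋆ c)) ≗ a ⊕ (b ⋆ (a ⋆ c))
  ring₂ = let open SeriesSolver in solve 3 (λ a b c → a :* (con 1ℚ :+ (b :* c)) := a :+ (b :* (a :* c))) (λ _ → refl)
  ring₃ : ∀ a b → a ⊕ (b ⋆ 𝟙) ≗ a ⊕ b
  ring₃ = let open SeriesSolver in solve 2 (λ a b → a :+ (b :* con 1ℚ) := a :+ b) (λ _ → refl)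
  ring₅ : ∀ a b c → a ⋆ (b ⋆ c) ≗ b ⋆ (a ⋆ c)
  ring₅ = let open SeriesSolver in solve 3 (λ a b c → a :* (b :* c) := b :* (a :* c)) (λ _ → refl)
  ring₆ : ∀ a b → a * b ≡ - 1ℚ * (- 1ℚ * a * b)
  ring₆ = solve-∀ ℚ-ring
  σ-expm1/X : exp 1ℚ ⋆ σ expm1/X ≗ expm1/X
  σ-expm1/X n = begin
    (exp 1ℚ ⋆ σ expm1/X) n
      ≡⟨ ⋆-cong {f = exp 1ℚ} (λ _ → refl) (λ i → ring₆ ((- 1ℚ) ^ℚ i) (ifact (suc i))) n ⟩
    (exp 1ℚ ⋆ (λ i → - 1ℚ * exp (- 1ℚ) (suc i))) n
      ≡⟨ ⋆-scaleʳ (- 1ℚ) (exp 1ℚ) (exp (- 1ℚ) ∘ suc) n ⟩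
    - 1ℚ * (exp 1ℚ ⋆ (exp (- 1ℚ) ∘ suc)) n
      ≡⟨ ring₇ (exp 1ℚ (suc n)) ((exp 1ℚ ⋆ (exp (- 1ℚ) ∘ suc)) n) ⟩
    exp 1ℚ (suc n) - ((exp 1ℚ ⋆ (exp (- 1ℚ) ∘ suc)) n + exp 1ℚ (suc n) * 1ℚ)
      ≡⟨ cong (λ z → exp 1ℚ (suc n) - z) (trans (sym (⋆-last (exp 1ℚ) (exp (- 1ℚ)) n)) (trans (exp-⋆ 1ℚ (- 1ℚ) (suc n)) (exp-0 (suc n)))) ⟩
    exp 1ℚ (suc n) - 0ℚ
      ≡⟨ trans (ℚP.+-identityʳ _) (exp-1 (suc n)) ⟩
    expm1/X n ∎
    where
    ring₇ : ∀ a b → - 1ℚ * b ≡ a - (b + a * 1ℚ)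
    ring₇ = solve-∀ ℚ-ring
  σ-𝟙 : σ 𝟙 ≗ 𝟙
  σ-𝟙 zero    = refl
  σ-𝟙 (suc n) = ℚP.*-zeroʳ ((- 1ℚ) ^ℚ suc n)
  exp-1-split : exp 1ℚ ≗ 𝟙 ⊕ (X ⋆ expm1/X)
  exp-1-split zero    = refl
  exp-1-split (suc n) = trans (exp-1 (suc n)) (sym (trans (ℚP.+-identityˡ _) (X-⋆-suc expm1/X n)))
  σbern⋆ : σ bern ⋆ expm1/X ≗ 𝟙 ⊕ (X ⋆ expm1/X)
  σbern⋆ n = begin
    (σ bern ⋆ expm1/X) n                     ≡⟨ ⋆-cong {f = σ bern} (λ _ → refl) (λ i → sym (σ-expm1/X i)) n ⟩
    (σ bern ⋆ (exp 1ℚ ⋆ σ expm1/X)) n        ≡⟨ ring₅ (σ bern) (exp 1ℚ) (σ expm1/X) n ⟩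
    (exp 1ℚ ⋆ (σ bern ⋆ σ expm1/X)) n        ≡⟨ ⋆-cong {f = exp 1ℚ} exp-1-split (λ i → trans (sym (σ-⋆ bern expm1/X i)) (trans (cong ((- 1ℚ) ^ℚ i *_) (bern-inverse i)) (σ-𝟙 i))) n ⟩
    ((𝟙 ⊕ (X ⋆ expm1/X)) ⋆ 𝟙) n              ≡⟨ trans (⋆-comm _ 𝟙 n) (⋆-identityˡ _ n) ⟩
    (𝟙 ⊕ (X ⋆ expm1/X)) n                    ∎

[-1]^-even : ∀ m → (- 1ℚ) ^ℚ (2 ℕ.* m) ≡ 1ℚ
[-1]^-even m = trans (cong ((- 1ℚ) ^ℚ_) (ℕP.*-comm 2 m)) (trans (^ℚ-* (- 1ℚ) m 2) (1^ℚ m))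

[-1]^-odd : ∀ m → (- 1ℚ) ^ℚ suc (2 ℕ.* m) ≡ - 1ℚ
[-1]^-odd m = cong ((- 1ℚ) *_) ([-1]^-even m)

self-negative : ∀ {x} → - 1ℚ * x ≡ x → x ≡ 0ℚ
self-negative {x} e = ι-nonZero 2 (trans (ring x) (trans (cong (x +_) (sym e)) (ring′ x)))
  where
  ring : ∀ x → ι 2 * x ≡ x + x
  ring = solve-∀ ℚ-ring
  ring′ : ∀ x → x + - 1ℚ * x ≡ 0ℚ
  ring′ = solve-∀ ℚ-ring

B-ifact : ∀ n → ι (n !) * bern n ≡ B n
B-ifact n = trans (ring (ι (n !)) (B n) (ifact n)) (trans (cong (B n *_) (fact-ifact n)) (ℚP.*-identityʳ _))
  where
  ring : ∀ a b c → a * (b * c) ≡ b * (a * c)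
  ring = solve-∀ ℚ-ring

B-odd : ∀ m → B (suc (2 ℕ.* suc m)) ≡ 0ℚ
B-odd m = trans (sym (B-ifact n)) (trans (cong (ι (n !) *_) bern-n≡0) (ℚP.*-zeroʳ (ι (n !))))
  where
  n = suc (2 ℕ.* suc m)
  bern-n≡0 : bern n ≡ 0ℚ
  bern-n≡0 = self-negative (trans (cong (_* bern n) (sym ([-1]^-odd (suc m)))) (trans (σ-bern n) (ℚP.+-identityʳ (bern n))))

parity : ∀ n → (Σ[ h ∈ ℕ ] n ≡ 2 ℕ.* h) ⊎ (Σ[ h ∈ ℕ ] n ≡ suc (2 ℕ.* h))
parity zero    = inj₁ (0 , refl)
parity (suc n) with parity n
... | inj₁ (h , e) = inj₂ (h , cong suc e)
... | inj₂ (h , e) = inj₁ (suc h , trans (cong suc e) (sym (ℕP.*-suc 2 h)))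

odd^ : ∀ q n → Σ[ h ∈ ℕ ] suc (2 ℕ.* q) ^ n ≡ suc (2 ℕ.* h)
odd^ q zero    = 0 , refl
odd^ q (suc n) with odd^ q n
... | h , e = h ℕ.+ q ℕ.* suc (2 ℕ.* h) , trans (cong (suc (2 ℕ.* q) ℕ.*_) e)
  (solve 2 (λ q h → (con 1 :+ con 2 :* q) :* (con 1 :+ con 2 :* h) := con 1 :+ con 2 :* (h :+ q :* (con 1 :+ con 2 :* h))) refl q h)
  where open ℕSolver.+-*-Solver

𝓑-B : ∀ n → B (suc n) ≡ ι (suc n) * 𝓑 (suc n)
𝓑-B n = sym (trans (ring (ι (suc n)) (B (suc n)) (rec n)) (trans (cong (_* B (suc n)) (rec-inv n)) (ℚP.*-identityˡ (B (suc n)))))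
  where
  ring : ∀ a b c → a * (b * c) ≡ (a * c) * b
  ring = solve-∀ ℚ-ring

∑-even-odd : ∀ h f → ∑ (suc (2 ℕ.* h)) f ≡ ∑ (suc h) (λ a → f (2 ℕ.* a)) + ∑ h (λ a → f (suc (2 ℕ.* a)))
∑-even-odd zero    f = ring (f 0)
  where
  ring : ∀ a → 0ℚ + a ≡ 0ℚ + a + 0ℚ
  ring = solve-∀ ℚ-ring
∑-even-odd (suc h) f = begin
  ∑ (suc (2 ℕ.* suc h)) f
    ≡⟨ cong (λ n → ∑ (suc n) f) (ℕP.*-suc 2 h) ⟩
  ∑ (suc (2 ℕ.* h)) f + f (suc (2 ℕ.* h)) + f (2 ℕ.+ 2 ℕ.* h)
    ≡⟨ cong₂ (λ x n → x + f (suc (2 ℕ.* h)) + f n) (∑-even-odd h f) (sym (ℕP.*-suc 2 h)) ⟩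
  E + O + f (suc (2 ℕ.* h)) + f (2 ℕ.* suc h)
    ≡⟨ ring E O (f (suc (2 ℕ.* h))) (f (2 ℕ.* suc h)) ⟩
  (E + f (2 ℕ.* suc h)) + (O + f (suc (2 ℕ.* h))) ∎
  where
  open ≡-Reasoning
  E = ∑ (suc h) (λ a → f (2 ℕ.* a))
  O = ∑ h (λ a → f (suc (2 ℕ.* a)))
  ring : ∀ a b c d → a + b + c + d ≡ (a + d) + (b + c)
  ring = solve-∀ ℚ-ring

-- Sorting the doubled residues 2a (a < N = 2h + 1) modulo N into those below and above N.
powerSum-doubling : ∀ h k → let N = suc (2 ℕ.* h) in
  powerSum k N - ι 2 ^ℚ k * powerSum k N ≡ ∑ h (λ a → ι (suc (2 ℕ.* a)) ^ℚ k) - ∑ h (λ a → (ι (suc (2 ℕ.* a)) + ι N) ^ℚ k)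
powerSum-doubling h k = begin
  powerSum k N - ι 2 ^ℚ k * powerSum k N
    ≡⟨ cong₂ _-_ (∑-even-odd h (λ a → ι a ^ℚ k)) (trans (sym (∑-* N (ι 2 ^ℚ k) (λ a → ι a ^ℚ k)))
         (trans (cong (λ n → ∑ n doubled) (solve 1 (λ h → con 1 :+ con 2 :* h := con 1 :+ h :+ h) refl h)) (∑-split (suc h) h doubled))) ⟩
  (E + O) - (∑ (suc h) doubled + ∑ h (λ a → doubled (suc h ℕ.+ a)))
    ≡⟨ cong₂ (λ x y → (E + O) - (x + y)) (∑-cong (suc h) (λ a _ → trans (sym (^ℚ-*-distrib (ι 2) (ι a) k)) (cong (_^ℚ k) (sym (ι-* 2 a)))))
         (∑-cong h (λ a _ → trans (sym (^ℚ-*-distrib (ι 2) (ι (suc h ℕ.+ a)) k)) (cong (_^ℚ k) (upper a)))) ⟩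
  (E + O) - (E + U)
    -- The doubles 2a with a ≤ h are exactly the even numbers below N and cancel; the doubles of h +
    -- 1 + a are 2a + 1 + N and form `U`.
    ≡⟨ ring E O U ⟩
  O - U ∎
  where
  open ≡-Reasoning
  open ℕSolver.+-*-Solver
  N = suc (2 ℕ.* h)
  doubled : ℕ → ℚ
  doubled a = ι 2 ^ℚ k * ι a ^ℚ k
  E = ∑ (suc h) (λ a → ι (2 ℕ.* a) ^ℚ k)
  O = ∑ h (λ a → ι (suc (2 ℕ.* a)) ^ℚ k)
  U = ∑ h (λ a → (ι (suc (2 ℕ.* a)) + ι N) ^ℚ k)
  upper : ∀ a → ι 2 * ι (suc h ℕ.+ a) ≡ ι (suc (2 ℕ.* a)) + ι N
  upper a = trans (sym (ι-* 2 (suc h ℕ.+ a))) (trans (cong ι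
    (solve 2 (λ h a → con 2 :* (con 1 :+ h :+ a) := con 1 :+ con 2 :* a :+ (con 1 :+ con 2 :* h)) refl h a)) (ι-+ (suc (2 ℕ.* a)) N))
  ring : ∀ a b c → (a + b) - (a + c) ≡ b - c
  ring = solve-∀ ℚ-ring

-- Five summands match the expansion of (T - 1)⁴; the interpolation of order two pads with zero
-- weights.
∑-lin : ∀ n (f g h k l : ℕ → ℚ) a b c d e →
  ∑ n (λ i → a * f i + b * g i + c * h i + d * k i + e * l i) ≡ a * ∑ n f + b * ∑ n g + c * ∑ n h + d * ∑ n k + e * ∑ n l
∑-lin zero    f g h k l a b c d e = ring a b c d e
  where
  ring : ∀ a b c d e → 0ℚ ≡ a * 0ℚ + b * 0ℚ + c * 0ℚ + d * 0ℚ + e * 0ℚ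
  ring = solve-∀ ℚ-ring
∑-lin (suc n) f g h k l a b c d e = trans (cong (_+ (a * f n + b * g n + c * h n + d * k n + e * l n)) (∑-lin n f g h k l a b c d e))
  (ring a b c d e (∑ n f) (∑ n g) (∑ n h) (∑ n k) (∑ n l) (f n) (g n) (h n) (k n) (l n))
  where
  ring : ∀ a b c d e F G H K L f g h k l → a * F + b * G + c * H + d * K + e * L + (a * f + b * g + c * h + d * k + e * l)
       ≡ a * (F + f) + b * (G + g) + c * (H + h) + d * (K + k) + e * (L + l)
  ring = solve-∀ ℚ-ring

-- Since `rec a` is 1 / (a + 1), the choice q = p - 1 gives the harmonic sum h_r over 1, ..., p - 1.
inversePowerSum : ℕ → ℕ → ℚ
inversePowerSum q r = ∑ q (λ a → rec a ^ℚ r)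

C-2 : ∀ m → ι ((2 ℕ.+ m) C 2) * ι 2 ≡ ι (2 ℕ.+ m) * ι (1 ℕ.+ m)
C-2 m = begin
  ι ((2 ℕ.+ m) C 2) * ι 2                                            ≡⟨ cong (_* ι 2) (C-ifact {2 ℕ.+ m} {2} (s≤s (s≤s z≤n))) ⟩
  ι ((2 ℕ.+ m) ℕ.* ((1 ℕ.+ m) ℕ.* m !)) * (ifact 2 * ifact m) * ι 2  ≡⟨ cong (λ z → z * (ifact 2 * ifact m) * ι 2) (trans (ι-* (2 ℕ.+ m) ((1 ℕ.+ m) ℕ.* m !)) (cong (ι (2 ℕ.+ m) *_) (ι-* (1 ℕ.+ m) (m !)))) ⟩
  ι (2 ℕ.+ m) * (ι (1 ℕ.+ m) * ι (m !)) * (ifact 2 * ifact m) * ι 2  ≡⟨ ring₁ (ι (2 ℕ.+ m)) (ι (1 ℕ.+ m)) (ι (m !)) (ifact 2) (ifact m) ⟩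
  ι (2 ℕ.+ m) * ι (1 ℕ.+ m) * (ifact 2 * ι 2) * (ι (m !) * ifact m)  ≡⟨ cong ((ι (2 ℕ.+ m) * ι (1 ℕ.+ m) * 1ℚ) *_) (fact-ifact m) ⟩
  ι (2 ℕ.+ m) * ι (1 ℕ.+ m) * 1ℚ * 1ℚ                                ≡⟨ ring₂ (ι (2 ℕ.+ m)) (ι (1 ℕ.+ m)) ⟩
  ι (2 ℕ.+ m) * ι (1 ℕ.+ m)                                          ∎
  where
  open ≡-Reasoning
  ring₁ : ∀ a b f i j → a * (b * f) * (i * j) * ι 2 ≡ a * b * (i * ι 2) * (f * j)
  ring₁ = solve-∀ ℚ-ring
  ring₂ : ∀ a b → a * b * 1ℚ * 1ℚ ≡ a * b
  ring₂ = solve-∀ ℚ-ring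

B-odd′ : ∀ {n} m → n ≡ suc (2 ℕ.* suc m) → B n ≡ 0ℚ
B-odd′ m refl = B-odd m

-- Products of linear factors and the divided Bernoulli series

mulLinear : ℚ → Series → Series
mulLinear c f zero    = f 0
mulLinear c f (suc n) = f (suc n) - c * f n

factorProduct : (ℕ → ℚ) → ℕ → Series
factorProduct x zero    = 𝟙
factorProduct x (suc n) = mulLinear (x n) (factorProduct x n)

powerSumSeries : (ℕ → ℚ) → ℕ → Series
powerSumSeries x n k = ∑ n (λ a → x a ^ℚ suc k)

linear : ℚ → Series
linear c = 𝟙 ⊕ ⊖ (const c ⋆ X)

mulLinear-⋆ : ∀ c f → mulLinear c f ≗ linear c ⋆ f
mulLinear-⋆ c f n = sym (trans (ring (const c) X f n)
  (trans (cong (λ z → f n - z) (const-⋆ c (X ⋆ f) n)) (at n)))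
  where
  ring : ∀ k x f → (𝟙 ⊕ ⊖ (k ⋆ x)) ⋆ f ≗ f ⊕ ⊖ (k ⋆ (x ⋆ f))
  ring = let open SeriesSolver in solve 3 (λ k x f → (con 1ℚ :+ :- (k :* x)) :* f := f :+ :- (k :* (x :* f))) (λ _ → refl)
  at : ∀ n → f n - c * (X ⋆ f) n ≡ mulLinear c f n
  at zero    = trans (cong (λ z → f 0 - c * z) (X-⋆-zero f)) (trans (cong (λ z → f 0 - z) (ℚP.*-zeroʳ c)) (ℚP.+-identityʳ (f 0)))
  at (suc n) = cong (λ z → f (suc n) - c * z) (X-⋆-suc f n)

∂-linear : ∀ c → ∂ (linear c) ≗ ⊖ const c
∂-linear c n = trans (cong (λ z → ι (suc n) * (0ℚ - z)) (trans (const-⋆ c X (suc n)) refl)) (at n)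
  where
  ring₀ : ∀ c → ι 1 * (0ℚ - c * 1ℚ) ≡ - c
  ring₀ = solve-∀ ℚ-ring
  ring₁ : ∀ c s → s * (0ℚ - c * 0ℚ) ≡ 0ℚ
  ring₁ = solve-∀ ℚ-ring
  at : ∀ n → ι (suc n) * (0ℚ - c * X (suc n)) ≡ (⊖ const c) n
  at zero    = ring₀ c
  at (suc n) = ring₁ c (ι (2 ℕ.+ n))

geometric-linear : ∀ c → linear c ⋆ (λ k → c ^ℚ suc k) ≗ const c
geometric-linear c n = trans (sym (mulLinear-⋆ c (λ k → c ^ℚ suc k) n)) (at n)
  where
  at : ∀ n → mulLinear c (λ k → c ^ℚ suc k) n ≡ const c n
  at zero    = ℚP.*-identityʳ c
  at (suc n) = ℚP.+-inverseʳ (c * c ^ℚ suc n)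

-- Logarithmic differentiation: a factor 1 - c X contributes - c / (1 - c X), which
-- `geometric-linear` expands as a geometric series. Multiplying back by the factor avoids any
-- inversion of series.
newton : ∀ x n → ∂ (factorProduct x n) ≗ ⊖ (powerSumSeries x n ⋆ factorProduct x n)
newton x zero    k = trans (ℚP.*-zeroʳ (ι (suc k))) (sym (cong -_ (trans (⋆-cong {g = 𝟙} (λ _ → refl) (λ _ → refl) k) (⋆-zeroˡ 𝟙 k))))
newton x (suc n) k = begin
  ∂ (mulLinear c F) k                                     ≡⟨ cong (ι (suc k) *_) (mulLinear-⋆ c F (suc k)) ⟩
  ∂ (linear c ⋆ F) k                                      ≡⟨ ∂-⋆ (linear c) F k ⟩
  (∂ (linear c) ⋆ F) k + (linear c ⋆ ∂ F) k               ≡⟨ cong₂ _+_ (⋆-cong {g = F} (∂-linear c) (λ _ → refl) k) (⋆-cong {f = linear c} (λ _ → refl) (newton x n) k) ⟩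
  (⊖ const c ⋆ F) k + (linear c ⋆ ⊖ (Q ⋆ F)) k            ≡⟨ cong (_+ (linear c ⋆ ⊖ (Q ⋆ F)) k) (⋆-cong {g = F} (λ i → cong -_ (sym (geometric-linear c i))) (λ _ → refl) k) ⟩
  (⊖ (linear c ⋆ g) ⋆ F) k + (linear c ⋆ ⊖ (Q ⋆ F)) k     ≡⟨ ring (linear c) g F Q k ⟩
  - ((Q ⊕ g) ⋆ (linear c ⋆ F)) k                          ≡⟨ cong -_ (⋆-cong {f = Q ⊕ g} (λ _ → refl) (λ i → sym (mulLinear-⋆ c F i)) k) ⟩
  - ((Q ⊕ g) ⋆ mulLinear c F) k                           ∎
  where
  open ≡-Reasoning
  c = x n
  F = factorProduct x n
  Q = powerSumSeries x n
  g : Series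
  g k = c ^ℚ suc k
  ring : ∀ l g f q → (⊖ (l ⋆ g)) ⋆ f ⊕ l ⋆ ⊖ (q ⋆ f) ≗ ⊖ ((q ⊕ g) ⋆ (l ⋆ f))
  ring = let open SeriesSolver in solve 4 (λ l g f q → (:- (l :* g)) :* f :+ l :* (:- (q :* f)) := :- ((q :+ g) :* (l :* f))) (λ _ → refl)

factorProduct-0 : ∀ x n → factorProduct x n 0 ≡ 1ℚ
factorProduct-0 x zero    = refl
factorProduct-0 x (suc n) = factorProduct-0 x n

factorProduct-> : ∀ x n k → n < k → factorProduct x n k ≡ 0ℚ
factorProduct-> x zero    (suc k) _         = refl
factorProduct-> x (suc n) (suc k) (s≤s n<k) = trans (cong₂ (λ a b → a - x n * b) (factorProduct-> x n (suc k) (ℕP.m<n⇒m<1+n n<k)) (factorProduct-> x n k n<k))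
  (ring (x n))
  where
  ring : ∀ c → 0ℚ - c * 0ℚ ≡ 0ℚ
  ring = solve-∀ ℚ-ring

signedProduct : (ℕ → ℚ) → ℕ → ℚ
signedProduct x zero    = 1ℚ
signedProduct x (suc n) = - x n * signedProduct x n

-- ∏ (1 - x_a X) has the reversed coefficients of ∏ (X - x_a) = ∏ (- x_a) ∏ (1 - X / x_a).
factorProduct-reverse : ∀ x y → (∀ a → x a * y a ≡ 1ℚ) → ∀ n k j → k ℕ.+ j ≡ n →
                        factorProduct x n k ≡ signedProduct x n * factorProduct y n j
factorProduct-reverse x y xy zero    zero    zero    _ = refl
factorProduct-reverse x y xy (suc n) zero    (suc j) refl = begin
  factorProduct x n 0                                       ≡⟨ factorProduct-reverse x y xy n 0 n refl ⟩
  c * Fy n                                                  ≡⟨ ring₁ c (Fy n) ⟩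
  c * 1ℚ * Fy n                                             ≡⟨ cong (λ z → c * z * Fy n) (sym (xy n)) ⟩
  c * (x n * y n) * Fy n                                    ≡⟨ ring₂ c (x n) (y n) (Fy n) ⟩
  - x n * c * (0ℚ - y n * Fy n)                             ≡⟨ cong (λ z → - x n * c * (z - y n * Fy n)) (sym (factorProduct-> y n (suc n) ℕP.≤-refl)) ⟩
  - x n * c * (Fy (suc n) - y n * Fy n)                     ∎
  where
  open ≡-Reasoning
  c = signedProduct x n
  Fy = factorProduct y n
  ring₁ : ∀ c f → c * f ≡ c * 1ℚ * f
  ring₁ = solve-∀ ℚ-ring
  ring₂ : ∀ c x y f → c * (x * y) * f ≡ - x * c * (0ℚ - y * f)
  ring₂ = solve-∀ ℚ-ring
factorProduct-reverse x y xy (suc n) (suc k) zero    e = begin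
  factorProduct x n (suc k) - x n * factorProduct x n k
    ≡⟨ cong₂ (λ a b → a - x n * b) (factorProduct-> x n (suc k) (ℕP.≤-reflexive (cong suc (sym k≡n)))) (factorProduct-reverse x y xy n k 0 (trans (ℕP.+-identityʳ k) k≡n)) ⟩
  0ℚ - x n * (signedProduct x n * factorProduct y n 0)
    ≡⟨ ring (x n) (signedProduct x n) (factorProduct y n 0) ⟩
  - x n * signedProduct x n * factorProduct y n 0 ∎
  where
  open ≡-Reasoning
  k≡n : k ≡ n
  k≡n = ℕP.suc-injective (trans (sym (ℕP.+-identityʳ (suc k))) e)
  ring : ∀ x c f → 0ℚ - x * (c * f) ≡ - x * c * f
  ring = solve-∀ ℚ-ring
factorProduct-reverse x y xy (suc n) (suc k) (suc j) e = begin
  factorProduct x n (suc k) - x n * factorProduct x n k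
    ≡⟨ cong₂ (λ a b → a - x n * b) (factorProduct-reverse x y xy n (suc k) j (trans (sym (ℕP.+-suc k j)) (ℕP.suc-injective e))) (factorProduct-reverse x y xy n k (suc j) (ℕP.suc-injective e)) ⟩
  c * Fy j - x n * (c * Fy (suc j))
    ≡⟨ ring₁ c (x n) (Fy j) (Fy (suc j)) ⟩
  c * 1ℚ * Fy j - x n * (c * Fy (suc j))
    ≡⟨ cong (λ z → c * z * Fy j - x n * (c * Fy (suc j))) (sym (xy n)) ⟩
  c * (x n * y n) * Fy j - x n * (c * Fy (suc j))
    ≡⟨ ring₂ c (x n) (y n) (Fy j) (Fy (suc j)) ⟩
  - x n * c * (Fy (suc j) - y n * Fy j) ∎
  where
  open ≡-Reasoning
  c = signedProduct x n
  Fy = factorProduct y n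
  ring₁ : ∀ c x f g → c * f - x * (c * g) ≡ c * 1ℚ * f - x * (c * g)
  ring₁ = solve-∀ ℚ-ring
  ring₂ : ∀ c x y f g → c * (x * y) * f - x * (c * g) ≡ - x * c * (g - y * f)
  ring₂ = solve-∀ ℚ-ring

signedProduct-! : ∀ n → signedProduct (ι ∘ suc) n ≡ (- 1ℚ) ^ℚ n * ι (n !)
signedProduct-! zero    = refl
signedProduct-! (suc n) = trans (cong ((- ι (suc n)) *_) (signedProduct-! n)) (trans (ring (ι (suc n)) ((- 1ℚ) ^ℚ n) (ι (n !)))
  (cong ((- 1ℚ) ^ℚ suc n *_) (sym (ι-* (suc n) (n !)))))
  where
  ring : ∀ a s f → - a * (s * f) ≡ - 1ℚ * s * (a * f)
  ring = solve-∀ ℚ-ring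

-- Dropping 𝓑₁ makes the series even.
β : Series
β zero          = 0ℚ
β (suc zero)    = 0ℚ
β (suc (suc n)) = 𝓑 (suc (suc n))

Even : Series → Set
Even f = σ f ≗ f

Even-odd : ∀ {f} → Even f → ∀ m → f (suc (2 ℕ.* m)) ≡ 0ℚ
Even-odd {f} e m = self-negative (trans (cong (_* f (suc (2 ℕ.* m))) (sym ([-1]^-odd m))) (e (suc (2 ℕ.* m))))

odd-Even : ∀ {f} → (∀ m → f (suc (2 ℕ.* m)) ≡ 0ℚ) → Even f
odd-Even {f} z n = case parity n of λ where
  (inj₁ (h , refl)) → trans (cong (_* f (2 ℕ.* h)) ([-1]^-even h)) (ℚP.*-identityˡ (f (2 ℕ.* h)))
  (inj₂ (h , refl)) → trans (cong ((- 1ℚ) ^ℚ n *_) (z h)) (trans (ℚP.*-zeroʳ ((- 1ℚ) ^ℚ n)) (sym (z h)))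

Even-⋆ : ∀ {f g} → Even f → Even g → Even (f ⋆ g)
Even-⋆ {f} {g} ef eg n = trans (σ-⋆ f g n) (⋆-cong ef eg n)

Even-β : Even β
Even-β = odd-Even λ where
  zero    → refl
  (suc m) → subst (λ n → β (suc n) ≡ 0ℚ) (sym (ℕP.*-suc 2 m)) (trans (cong (_* rec (2 ℕ.+ 2 ℕ.* m))
              (trans (cong (B ∘ suc) (sym (ℕP.*-suc 2 m))) (B-odd m))) (ℚP.*-zeroˡ (rec (2 ℕ.+ 2 ℕ.* m))))

sumℚ-map-upTo : ∀ n (f : ℕ → ℚ) → sumℚ (map f (upTo n)) ≡ ∑ n f
sumℚ-map-upTo n f = go n id
  where
  go : ∀ n (g : ℕ → ℕ) → sumℚ (map f (applyUpTo g n)) ≡ ∑ n (f ∘ g)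
  go zero    g = refl
  go (suc n) g = trans (cong (λ z → f (g 0) + z) (go n (g ∘ suc))) (sym (∑-head n (f ∘ g)))

β-⋆ : ∀ g m → (β ⋆ g) (2 ℕ.+ m) ≡ ∑ (suc m) (λ k → 𝓑 (2 ℕ.+ k) * g (m ∸ k))
β-⋆ g m = trans (cong₂ (λ a b → a + (b + (β ∘ suc ∘ suc ⋆ g) m)) (ℚP.*-zeroˡ (g (2 ℕ.+ m))) (ℚP.*-zeroˡ (g (1 ℕ.+ m))))
  (trans (ring ((β ∘ suc ∘ suc ⋆ g) m)) (⋆-∑ (β ∘ suc ∘ suc) g m))
  where
  ring : ∀ a → 0ℚ + (0ℚ + a) ≡ a
  ring = solve-∀ ℚ-ring

∸-split : ∀ {m k} c → k < m → c ℕ.+ m ∸ k ≡ suc (c ℕ.+ (m ∸ suc k))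
∸-split {m} {k} c k<m = trans (ℕP.+-∸-assoc c (ℕP.<⇒≤ k<m)) (trans (cong (c ℕ.+_) (ℕP.+-∸-assoc 1 {m} {suc k} k<m)) (ℕP.+-suc c (m ∸ suc k)))

+-vanish : ∀ {a b c} → c ≡ 0ℚ → a + b * c ≡ a
+-vanish {a} {b} refl = trans (cong (λ z → a + z) (ℚP.*-zeroʳ b)) (ℚP.+-identityʳ a)

-- The vanishing entries of `β` at 0 and 1 remove the last two terms of the Cauchy product, which
-- leaves the range from 2 to n - 2 of 𝓒.
β² : ∀ m → (β ⋆ β) (3 ℕ.+ m) ≡ 𝓒 (3 ℕ.+ m)
β² m = trans (β-⋆ β (suc m)) (trans (+-vanish {b = 𝓑 (3 ℕ.+ m)} (cong β (ℕP.n∸n≡0 m))) (trans (+-vanish {b = 𝓑 (2 ℕ.+ m)} (cong β (trans (ℕP.+-∸-assoc 1 {m} ℕP.≤-refl) (cong suc (ℕP.n∸n≡0 m)))))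
  (trans (∑-cong m (λ k k<m → cong (𝓑 (2 ℕ.+ k) *_) (trans (cong β (∸-split 1 k<m)) (cong 𝓑 (sym (∸-split 1 k<m))))))
    (sym (sumℚ-map-upTo m (λ k → 𝓑 (2 ℕ.+ k) * 𝓑 (suc m ∸ k)))))))

-- β ⋆ β begins in degree 4, so the last four terms drop out and the range ends at n - 4 as in 𝓣.
β³ : ∀ m → (β ⋆ (β ⋆ β)) (5 ℕ.+ m) ≡ 𝓣 (5 ℕ.+ m)
β³ m = begin
  (β ⋆ γ) (5 ℕ.+ m)                                  ≡⟨ β-⋆ γ (3 ℕ.+ m) ⟩
  ∑ (4 ℕ.+ m) (λ k → 𝓑 (2 ℕ.+ k) * γ (3 ℕ.+ m ∸ k))  ≡⟨ +-vanish {b = 𝓑 (5 ℕ.+ m)} (cong γ (ℕP.n∸n≡0 m)) ⟩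
  ∑ (3 ℕ.+ m) f                                      ≡⟨ +-vanish {b = 𝓑 (4 ℕ.+ m)} (cong γ (low 1)) ⟩
  ∑ (2 ℕ.+ m) f                                      ≡⟨ +-vanish {b = 𝓑 (3 ℕ.+ m)} (cong γ (low 2)) ⟩
  ∑ (1 ℕ.+ m) f                                      ≡⟨ +-vanish {b = 𝓑 (2 ℕ.+ m)} (cong γ (low 3)) ⟩
  ∑ m f                                              ≡⟨ ∑-cong m (λ k k<m → cong (𝓑 (2 ℕ.+ k) *_) (trans (cong γ (∸-split 3 k<m)) (trans (β² (suc (m ∸ suc k))) (cong 𝓒 (sym (∸-split 3 k<m)))))) ⟩
  ∑ m (λ k → 𝓑 (2 ℕ.+ k) * 𝓒 (3 ℕ.+ m ∸ k))          ≡⟨ sym (sumℚ-map-upTo m (λ k → 𝓑 (2 ℕ.+ k) * 𝓒 (3 ℕ.+ m ∸ k))) ⟩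
  𝓣 (5 ℕ.+ m)                                        ∎
  where
  open ≡-Reasoning
  γ = β ⋆ β
  f : ℕ → ℚ
  f k = 𝓑 (2 ℕ.+ k) * γ (3 ℕ.+ m ∸ k)
  low : ∀ c → c ℕ.+ m ∸ m ≡ c
  low c = ℕP.m+n∸n≡m c m

-- The truncated exponential and the convolutions in even degree

¼ ½ ¾ ⅛ 1½ : ℚ
¼ = ℤ.+ 1 / 4
½ = ℤ.+ 1 / 2
¾ = ℤ.+ 3 / 4
⅛ = ℤ.+ 1 / 8
1½ = ℤ.+ 3 / 2

∂-⊕ : ∀ f g → ∂ (f ⊕ g) ≗ ∂ f ⊕ ∂ g
∂-⊕ f g n = ℚP.*-distribˡ-+ (ι (suc n)) (f (suc n)) (g (suc n))

∂-const : ∀ c → ∂ (const c) ≗ 𝟘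
∂-const c n = ℚP.*-zeroʳ (ι (suc n))

∂-const-⋆ : ∀ c f → ∂ (const c ⋆ f) ≗ const c ⋆ ∂ f
∂-const-⋆ c f n = trans (∂-⋆ (const c) f n) (trans (cong (_+ (const c ⋆ ∂ f) n)
  (trans (⋆-cong {g = f} (∂-const c) (λ _ → refl) n) (⋆-zeroˡ f n))) (ℚP.+-identityˡ ((const c ⋆ ∂ f) n)))

-- 6 (1 + P + P²/2 + P³/6)
exp₃ : Series → Series
exp₃ P = const (ι 6) ⊕ const (ι 6) ⋆ P ⊕ const (ι 3) ⋆ (P ⋆ P) ⊕ P ⋆ (P ⋆ P)

-- Truncation violates the differential equation of 6 exp P by the cube alone. In the application ∂
-- P carries p and the cube p³, so the defect is of order p⁴.
∂-exp₃ : ∀ P → ∂ (exp₃ P) ≗ ∂ P ⋆ (exp₃ P ⊕ ⊖ (P ⋆ (P ⋆ P)))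
∂-exp₃ P n = begin
  ∂ (exp₃ P) n
    ≡⟨ trans (∂-⊕ (const (ι 6) ⊕ const (ι 6) ⋆ P ⊕ const (ι 3) ⋆ (P ⋆ P)) (P ⋆ (P ⋆ P)) n)
         (cong₂ _+_ (trans (∂-⊕ (const (ι 6) ⊕ const (ι 6) ⋆ P) (const (ι 3) ⋆ (P ⋆ P)) n)
           (cong₂ _+_ (trans (∂-⊕ (const (ι 6)) (const (ι 6) ⋆ P) n) (cong₂ _+_ (trans (∂-const (ι 6) n) (𝟘≗const n)) (∂-const-⋆ (ι 6) P n)))
             (trans (∂-const-⋆ (ι 3) (P ⋆ P) n) (⋆-cong {f = const (ι 3)} (λ _ → refl) (∂-⋆ P P) n))))
           (trans (∂-⋆ P (P ⋆ P) n) (cong (λ z → (∂ P ⋆ (P ⋆ P)) n + z) (⋆-cong {f = P} (λ _ → refl) (∂-⋆ P P) n)))) ⟩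
  (const 0ℚ ⊕ const (ι 6) ⋆ ∂ P ⊕ const (ι 3) ⋆ ((∂ P ⋆ P) ⊕ (P ⋆ ∂ P)) ⊕ ((∂ P ⋆ (P ⋆ P)) ⊕ (P ⋆ ((∂ P ⋆ P) ⊕ (P ⋆ ∂ P))))) n
    ≡⟨ ring P (∂ P) n ⟩
  (∂ P ⋆ (exp₃ P ⊕ ⊖ (P ⋆ (P ⋆ P)))) n ∎
  where
  open ≡-Reasoning
  𝟘≗const : ∀ n → 𝟘 n ≡ const 0ℚ n
  𝟘≗const zero    = refl
  𝟘≗const (suc n) = refl
  ring : ∀ P D → const 0ℚ ⊕ const (ι 6) ⋆ D ⊕ const (ι 3) ⋆ ((D ⋆ P) ⊕ (P ⋆ D)) ⊕ ((D ⋆ (P ⋆ P)) ⊕ (P ⋆ ((D ⋆ P) ⊕ (P ⋆ D))))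
             ≗ D ⋆ (exp₃ P ⊕ ⊖ (P ⋆ (P ⋆ P)))
  ring = let open SeriesSolver in solve 2 (λ P D →
      con 0ℚ :+ con (ι 6) :* D :+ con (ι 3) :* ((D :* P) :+ (P :* D)) :+ ((D :* (P :* P)) :+ (P :* ((D :* P) :+ (P :* D))))
      := D :* ((con (ι 6) :+ con (ι 6) :* P :+ con (ι 3) :* (P :* P) :+ P :* (P :* P)) :+ :- (P :* (P :* P)))) (λ _ → refl)

-- `𝒜` and `𝒢` are the coefficients of p and p² when Faulhaber's formula is inserted into P. `θ` is
-- X times the derivative of β; it turns divided Bernoulli numbers back into Bernoulli numbers.
𝒜 θ 𝒢 : Series
𝒜 n = - 𝓑 n
θ n = ι n * β n
𝒢 zero    = 0ℚ
𝒢 (suc n) = - (½ * B n)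

𝒜-β : 𝒜 ≗ ⊖ β ⊕ const ½ ⋆ X
𝒜-β zero          = refl
𝒜-β (suc zero)    = refl
𝒜-β (suc (suc n)) = trans (sym (ℚP.+-identityʳ (- 𝓑 (2 ℕ.+ n)))) (cong (λ z → - 𝓑 (2 ℕ.+ n) + z)
  (sym (trans (const-⋆ ½ X (2 ℕ.+ n)) (ℚP.*-zeroʳ ½))))

B-θ : B ≗ const 1ℚ ⊕ ⊖ (const ½ ⋆ X) ⊕ θ
B-θ zero          = refl
B-θ (suc zero)    = refl
B-θ (suc (suc n)) = trans (𝓑-B (suc n)) (trans (sym (ℚP.+-identityˡ (θ (2 ℕ.+ n)))) (cong (λ z → 0ℚ + - z + θ (2 ℕ.+ n))
  (sym (trans (const-⋆ ½ X (2 ℕ.+ n)) (ℚP.*-zeroʳ ½)))))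

𝒢-B : 𝒢 ≗ ⊖ (const ½ ⋆ (X ⋆ B))
𝒢-B zero    = refl
𝒢-B (suc n) = cong -_ (sym (trans (const-⋆ ½ (X ⋆ B) (suc n)) (cong (½ *_) (X-⋆-suc B n))))

X²-⋆ : ∀ f n → (X ⋆ (X ⋆ f)) (2 ℕ.+ n) ≡ f n
X²-⋆ f n = trans (X-⋆-suc (X ⋆ f) (suc n)) (X-⋆-suc f n)

module Coefficients (v : ℕ) where

  -- The degree n = 2v + 6 is even; the detour through l gives it the shape 5 + l under which `β³`
  -- applies, and 3 + l is n - 2.
  l n : ℕ
  l = suc (2 ℕ.* v)
  n = 5 ℕ.+ l

  b : ℚ
  b = 𝓑 (3 ℕ.+ l)

  private
    odd-vanish : ∀ {f} → Even f → f (4 ℕ.+ l) ≡ 0ℚ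
    odd-vanish {f} e = subst (λ k → f k ≡ 0ℚ) (sym (solve 1 (λ v → con 4 :+ (con 1 :+ con 2 :* v) := con 1 :+ con 2 :* (con 2 :+ v)) refl v)) (Even-odd e (2 ℕ.+ v))
      where open ℕSolver.+-*-Solver

    Even-θ : Even θ
    Even-θ = odd-Even (λ m → trans (cong (ι (suc (2 ℕ.* m)) *_) (Even-odd Even-β m)) (ℚP.*-zeroʳ (ι (suc (2 ℕ.* m)))))

  -- The cross term X β picks out β in the odd degree n - 1, where it vanishes, so 𝓑₁ has no effect
  -- here.
  𝒜² : (𝒜 ⋆ 𝒜) n ≡ 𝓒 n
  𝒜² = begin
    (𝒜 ⋆ 𝒜) n                                                           ≡⟨ ⋆-cong 𝒜-β 𝒜-β n ⟩
    ((⊖ β ⊕ const ½ ⋆ X) ⋆ (⊖ β ⊕ const ½ ⋆ X)) n                       ≡⟨ ring β X n ⟩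
    (β ⋆ β) n + - (X ⋆ β) n + (const ¼ ⋆ (X ⋆ X)) n                     ≡⟨ cong₂ _+_ (cong₂ (λ a b → a + - b) (β² (2 ℕ.+ l)) (trans (X-⋆-suc β (4 ℕ.+ l)) (odd-vanish Even-β)))
                                                                             (trans (const-⋆ ¼ (X ⋆ X) n) (cong (¼ *_) (X-⋆-suc X (4 ℕ.+ l)))) ⟩
    𝓒 n + - 0ℚ + ¼ * 0ℚ                                                 ≡⟨ ring′ (𝓒 n) ⟩
    𝓒 n                                                                 ∎
    where
    open ≡-Reasoning
    ring : ∀ β X → (⊖ β ⊕ const ½ ⋆ X) ⋆ (⊖ β ⊕ const ½ ⋆ X) ≗ β ⋆ β ⊕ ⊖ (X ⋆ β) ⊕ const ¼ ⋆ (X ⋆ X)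
    ring = let open SeriesSolver in solve 2 (λ β X → (:- β :+ con ½ :* X) :* (:- β :+ con ½ :* X) := β :* β :+ :- (X :* β) :+ con ¼ :* (X :* X)) (λ _ → refl)
    ring′ : ∀ c → c + - 0ℚ + ¼ * 0ℚ ≡ c
    ring′ = solve-∀ ℚ-ring

  -- In the cube of - β + X / 2 parity removes the term with X β², but - ¾ X² β keeps an even
  -- degree: this is the contribution of 𝓑₁.
  𝒜³ : (𝒜 ⋆ (𝒜 ⋆ 𝒜)) n ≡ - 𝓣 n - ¾ * b
  𝒜³ = begin
    (𝒜 ⋆ (𝒜 ⋆ 𝒜)) n
      ≡⟨ ⋆-cong 𝒜-β (⋆-cong 𝒜-β 𝒜-β) n ⟩
    ((⊖ β ⊕ const ½ ⋆ X) ⋆ ((⊖ β ⊕ const ½ ⋆ X) ⋆ (⊖ β ⊕ const ½ ⋆ X))) n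
      ≡⟨ ring β X n ⟩
    - (β ⋆ (β ⋆ β)) n + (const 1½ ⋆ (X ⋆ (β ⋆ β))) n + - (const ¾ ⋆ (X ⋆ (X ⋆ β))) n + (const ⅛ ⋆ (X ⋆ (X ⋆ X))) n
      ≡⟨ cong₂ _+_ (cong₂ _+_ (cong₂ (λ a b → - a + b) (β³ l)
           (trans (const-⋆ 1½ (X ⋆ (β ⋆ β)) n) (cong (1½ *_) (trans (X-⋆-suc (β ⋆ β) (4 ℕ.+ l)) (odd-vanish (Even-⋆ Even-β Even-β))))))
           (cong -_ (trans (const-⋆ ¾ (X ⋆ (X ⋆ β)) n) (cong (¾ *_) (X²-⋆ β (3 ℕ.+ l))))))
           (trans (const-⋆ ⅛ (X ⋆ (X ⋆ X)) n) (cong (⅛ *_) (X²-⋆ X (3 ℕ.+ l)))) ⟩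
    - 𝓣 n + 1½ * 0ℚ + - (¾ * b) + ⅛ * 0ℚ
      ≡⟨ ring′ (𝓣 n) b ⟩
    - 𝓣 n - ¾ * b ∎
    where
    open ≡-Reasoning
    ring : ∀ β X → (⊖ β ⊕ const ½ ⋆ X) ⋆ ((⊖ β ⊕ const ½ ⋆ X) ⋆ (⊖ β ⊕ const ½ ⋆ X))
         ≗ ⊖ (β ⋆ (β ⋆ β)) ⊕ const 1½ ⋆ (X ⋆ (β ⋆ β)) ⊕ ⊖ (const ¾ ⋆ (X ⋆ (X ⋆ β))) ⊕ const ⅛ ⋆ (X ⋆ (X ⋆ X))
    ring = let open SeriesSolver in solve 2 (λ β X → (:- β :+ con ½ :* X) :* ((:- β :+ con ½ :* X) :* (:- β :+ con ½ :* X))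
      := :- (β :* (β :* β)) :+ con 1½ :* (X :* (β :* β)) :+ :- (con ¾ :* (X :* (X :* β))) :+ con ⅛ :* (X :* (X :* X))) (λ _ → refl)
    ring′ : ∀ t b → - t + 1½ * 0ℚ + - (¾ * b) + ⅛ * 0ℚ ≡ - t - ¾ * b
    ring′ = solve-∀ ℚ-ring

  -- By parity only two products survive: that of β with the linear term of B and that of the linear
  -- term of 𝒜 with `θ`. They contribute in the proportion 1 to n - 2, hence the factor n - 1.
  𝒜𝒢 : (𝒜 ⋆ 𝒢) n ≡ - (¼ * (ι (4 ℕ.+ l) * b))
  𝒜𝒢 = begin
    (𝒜 ⋆ 𝒢) n
      ≡⟨ ⋆-cong 𝒜-β (λ i → trans (𝒢-B i) (cong -_ (⋆-cong {f = const ½} (λ _ → refl) (⋆-cong {f = X} (λ _ → refl) B-θ) i))) n ⟩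
    ((⊖ β ⊕ const ½ ⋆ X) ⋆ ⊖ (const ½ ⋆ (X ⋆ (const 1ℚ ⊕ ⊖ (const ½ ⋆ X) ⊕ θ)))) n
      ≡⟨ ring β X θ n ⟩
    (const (- ½) ⋆ (X ⋆ inner)) n
      ≡⟨ trans (const-⋆ (- ½) (X ⋆ inner) n) (cong ((- ½) *_) (X-⋆-suc inner (4 ℕ.+ l))) ⟩
    - ½ * inner (4 ℕ.+ l)
      ≡⟨ cong ((- ½) *_) (cong₂ _+_ (cong₂ _+_ (cong₂ _+_ (cong₂ _+_ (cong₂ _+_
           (cong -_ (odd-vanish Even-β))
           (trans (const-⋆ ½ (X ⋆ β) (4 ℕ.+ l)) (cong (½ *_) (X-⋆-suc β (3 ℕ.+ l)))))
           (cong -_ (odd-vanish (Even-⋆ Even-β Even-θ))))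
           (trans (const-⋆ ½ X (4 ℕ.+ l)) (ℚP.*-zeroʳ ½)))
           (cong -_ (trans (const-⋆ ¼ (X ⋆ X) (4 ℕ.+ l)) (cong (¼ *_) (X-⋆-suc X (3 ℕ.+ l))))))
           (trans (const-⋆ ½ (X ⋆ θ) (4 ℕ.+ l)) (cong (½ *_) (X-⋆-suc θ (3 ℕ.+ l))))) ⟩
    - ½ * (- 0ℚ + ½ * b + - 0ℚ + 0ℚ + - (¼ * 0ℚ) + ½ * (ι (3 ℕ.+ l) * b))
      ≡⟨ trans (ring′ b (ι (3 ℕ.+ l))) (cong (λ z → - (¼ * (z * b))) (sym (ι-suc (3 ℕ.+ l)))) ⟩
    - (¼ * (ι (4 ℕ.+ l) * b)) ∎
    where
    open ≡-Reasoning
    inner : Series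
    inner = ⊖ β ⊕ const ½ ⋆ (X ⋆ β) ⊕ ⊖ (β ⋆ θ) ⊕ const ½ ⋆ X ⊕ ⊖ (const ¼ ⋆ (X ⋆ X)) ⊕ const ½ ⋆ (X ⋆ θ)
    ring : ∀ β X θ → (⊖ β ⊕ const ½ ⋆ X) ⋆ ⊖ (const ½ ⋆ (X ⋆ (const 1ℚ ⊕ ⊖ (const ½ ⋆ X) ⊕ θ)))
         ≗ const (- ½) ⋆ (X ⋆ (⊖ β ⊕ const ½ ⋆ (X ⋆ β) ⊕ ⊖ (β ⋆ θ) ⊕ const ½ ⋆ X ⊕ ⊖ (const ¼ ⋆ (X ⋆ X)) ⊕ const ½ ⋆ (X ⋆ θ)))
    ring = let open SeriesSolver in solve 3 (λ β X θ → (:- β :+ con ½ :* X) :* (:- (con ½ :* (X :* (con 1ℚ :+ :- (con ½ :* X) :+ θ))))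
      := con (- ½) :* (X :* (:- β :+ con ½ :* (X :* β) :+ :- (β :* θ) :+ con ½ :* X :+ :- (con ¼ :* (X :* X)) :+ con ½ :* (X :* θ)))) (λ _ → refl)
    ring′ : ∀ b m → - ½ * (- 0ℚ + ½ * b + - 0ℚ + 0ℚ + - (¼ * 0ℚ) + ½ * (m * b)) ≡ - (¼ * ((1ℚ + m) * b))
    ring′ = solve-∀ ℚ-ring

-- The loop of `search` is local to Defs and has no name here.  The metavariable is solved by
-- unification with it, once the arguments of the loop have been generalised to variables.
mutual

  search-loop : ℕ → (ℕ → Bool) → ℕ → ℕ → ℕ
  search-loop = _

  search-unfold : ∀ m f → f 0 ≡ false → search (suc m) f ≡ search-loop (suc m) f m 1
  search-unfold m f f0 rewrite f0 with suc m | m | 1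
  ... | a | b | c = refl {x = search-loop a f b c}

search-loop-sound : ∀ n f m k r → k ≤ r → r < k ℕ.+ m → f r ≡ true →
                    f (search-loop n f m k) ≡ true × search-loop n f m k < k ℕ.+ m
search-loop-sound n f zero    k r k≤r r<k _ = ⊥-elim (ℕP.<⇒≱ (subst (r <_) (ℕP.+-identityʳ k) r<k) k≤r)
search-loop-sound n f (suc m) k r k≤r r<k+m fr with f k in fk
... | true  = fk , ℕP.m<m+n k (s≤s z≤n)
... | false with ℕP.m≤n⇒m<n∨m≡n k≤r
...   | inj₁ k<r  = subst (λ b → f (search-loop n f m (suc k)) ≡ true × search-loop n f m (suc k) < b) (sym (ℕP.+-suc k m))
                      (search-loop-sound n f m (suc k) r k<r (subst (r <_) (ℕP.+-suc k m) r<k+m) fr)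
...   | inj₂ refl with () ← trans (sym fk) fr

search-sound : ∀ n f r → r < n → f r ≡ true → f (search n f) ≡ true × search n f < n
search-sound n f r r<n fr = search-loop-sound n f n 0 r z≤n r<n fr

⌊⌋-true : ∀ {A : Set} (d : Dec A) → A → ⌊ d ⌋ ≡ true
⌊⌋-true (yes _) _ = refl
⌊⌋-true (no ¬a) a = ⊥-elim (¬a a)

⌊⌋-sound : ∀ {A : Set} (d : Dec A) → ⌊ d ⌋ ≡ true → A
⌊⌋-sound (yes a) _ = a

not-⌊⌋-true : ∀ {A : Set} (d : Dec A) → ¬ A → not ⌊ d ⌋ ≡ true
not-⌊⌋-true (yes a) ¬a = ⊥-elim (¬a a)
not-⌊⌋-true (no _)  _  = refl

-- Polynomial identities over ℚ, stated in the empty context because the ring solver is costly inside the modules below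

¬V-u-identity : ∀ T a c → (- (1ℚ + c) * (a * T - 1ℚ)) + ((1ℚ + c) * a) * (T - 1ℚ) - (- (a * (1ℚ + c) - 1ℚ)) ≡ c
¬V-u-identity = solve-∀ ℚ-ring

rearrange₁ : ∀ a b c → (a - b) + (b - c) ≡ a - c
rearrange₁ = solve-∀ ℚ-ring

V-h₂-identity : ∀ π h u v z b → ι 6 * h + ι 6 * ι 2 * π * (ι 3 * u - ι 3 * v + z) + ι 2 * (ι 2 + 1ℚ) * (ι 2 + ι 2) * (π * π * π) * b
  - ι 12 * (π * (z - ι 2 * v + u)) - ι 24 * (π * π * π * b) ≡ ι 6 * (h + ι 2 * π * (ι 2 * u - v))
V-h₂-identity = solve 6 (λ π h u v z b →
  con (ι 6) :* h :+ con (ι 6) :* con (ι 2) :* π :* (con (ι 3) :* u :- con (ι 3) :* v :+ z) :+ con (ι 2) :* (con (ι 2) :+ con 1ℚ) :* (con (ι 2) :+ con (ι 2)) :* (π :* π :* π) :* b :- con (ι 12) :* (π :* (z :- con (ι 2) :* v :+ u)) :- con (ι 24) :* (π :* π :* π :* b)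
  := con (ι 6) :* (h :+ con (ι 2) :* π :* (con (ι 2) :* u :- v))) refl
  where open ℚSolver

V-h₂²-identity : ∀ π h m → h + ι 2 * π * m - ι 4 * (π * m) ≡ h - ι 2 * π * m
V-h₂²-identity = solve-∀ ℚ-ring

x≡y-identity : ∀ x y → - (y - x) ≡ x - y
x≡y-identity = solve-∀ ℚ-ring

6Y≡-6x-identity₀ : ∀ x y → ι 6 * (y - x) ≡ ι 6 * (y - ι 2 * x) - - ι 6 * x
6Y≡-6x-identity₀ = solve-∀ ℚ-ring

δ₂≡-identity₀ : ∀ w x a → w * (- ι 6 * x - a) ≡ - ι 6 * w * x - w * a
δ₂≡-identity₀ = solve-∀ ℚ-ring

v-j-identity₀ : ∀ u v → - (v - u) ≡ ι 2 * u - v - u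
v-j-identity₀ = solve-∀ ℚ-ring

δ₂≡-identity₀′ : ∀ w x x₀ a → w * (- ι 6 * x - a) + ι 6 * w * (x - x₀) ≡ - ι 6 * w * x₀ - w * a
δ₂≡-identity₀′ = solve-∀ ℚ-ring

T^≡1-identity : ∀ a b → a * (b - 1ℚ) + (a - 1ℚ) ≡ a * b - 1ℚ
T^≡1-identity = solve-∀ ℚ-ring

rearrange₂ : ∀ a → 1ℚ + a - 1ℚ ≡ a
rearrange₂ = solve-∀ ℚ-ring

∑---identity : ∀ a → - 1ℚ * a ≡ - a
∑---identity = solve-∀ ℚ-ring

V-P³-A³-identity′ : ∀ a b → b ≡ (a + b) - a
V-P³-A³-identity′ = solve-∀ ℚ-ring

V-P³-A³-identity″ : ∀ x a → x * (x * (x * a)) ≡ x * x * x * a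
V-P³-A³-identity″ = solve-∀ ℚ-ring

V-W²-identity′ : ∀ x a b c → (x * (x * (x * x))) * c ≡ x * (x * a) + ι 2 * (x * (x * (x * b))) + x * (x * (x * (x * c))) - x * x * a - ι 2 * (x * x * x) * b
V-W²-identity′ = solve 4 (λ x a b c →
  (x :* (x :* (x :* x))) :* c
  := x :* (x :* a) :+ con (ι 2) :* (x :* (x :* (x :* b))) :+ x :* (x :* (x :* (x :* c))) :- x :* x :* a :- con (ι 2) :* (x :* x :* x) :* b) refl
  where open ℚSolver

V-Pn-identity₁ : ∀ s π n x b → - (ι 6 * s - ι 6 * π * n * x - π * π * π * (n * (n - 1ℚ) * (n - ι 2)) * b) ≡ ι 6 * - (s * 1ℚ) + ι 6 * π * n * x + π * π * π * (n * (n - 1ℚ) * (n - ι 2)) * b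
V-Pn-identity₁ = solve 5 (λ s π n x b →
  :- (con (ι 6) :* s :- con (ι 6) :* π :* n :* x :- π :* π :* π :* (n :* (n :- con 1ℚ) :* (n :- con (ι 2))) :* b)
  := con (ι 6) :* :- (s :* con 1ℚ) :+ con (ι 6) :* π :* n :* x :+ π :* π :* π :* (n :* (n :- con 1ℚ) :* (n :- con (ι 2))) :* b) refl
  where open ℚSolver

V-Pn-identity₂ : ∀ s r π n x b → ι 6 * - (s * (n * r)) + ι 6 * π * n * x + π * π * π * (n * (n - 1ℚ) * (n - ι 2)) * b ≡ n * (ι 6 * - (s * r) + ι 6 * π * x + π * π * π * ((n - 1ℚ) * (n - ι 2)) * b)
V-Pn-identity₂ = solve 6 (λ s r π n x b →
  con (ι 6) :* :- (s :* (n :* r)) :+ con (ι 6) :* π :* n :* x :+ π :* π :* π :* (n :* (n :- con 1ℚ) :* (n :- con (ι 2))) :* b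
  := n :* (con (ι 6) :* :- (s :* r) :+ con (ι 6) :* π :* x :+ π :* π :* π :* ((n :- con 1ℚ) :* (n :- con (ι 2))) :* b)) refl
  where open ℚSolver

rearrange₃ : ∀ a → a ≡ 1ℚ + a - 1ℚ
rearrange₃ = solve-∀ ℚ-ring

F*₁-identity : ∀ a → a ≡ ι 1 * a
F*₁-identity = solve-∀ ℚ-ring

F*₁-identity′ : ∀ a → - (a * 1ℚ) ≡ - a
F*₁-identity′ = solve-∀ ℚ-ring

V-F*₂-identity : ∀ a b c → - (a * b + c * 1ℚ) + c ≡ - (a * b)
V-F*₂-identity = solve-∀ ℚ-ring

V-F*₄-identity : ∀ a b c d e f g → - ι 2 * (a * b) - c * (ι 2 * d + c) - ι 2 * (e * f) ≡ ι 2 * - (a * b + (c * d + (e * f + g * 1ℚ))) - c * c + ι 2 * g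
V-F*₄-identity = solve 7 (λ a b c d e f g →
  :- con (ι 2) :* (a :* b) :- c :* (con (ι 2) :* d :+ c) :- con (ι 2) :* (e :* f)
  := con (ι 2) :* :- (a :* b :+ (c :* d :+ (e :* f :+ g :* con 1ℚ))) :- c :* c :+ con (ι 2) :* g) refl
  where open ℚSolver

V-F*₄-identity′ : ∀ a c g → ι 2 * (ι 4 * a) - c * c + ι 2 * g ≡ ι 8 * a - c * c + ι 2 * g
V-F*₄-identity′ = solve-∀ ℚ-ring

F-tail-identity : ∀ π n f x b c t → ι 24 * f + ι 24 * π * x + ι 4 * (π * π * π) * ((n - 1ℚ) * (n - ι 2)) * b - ι 12 * (π * π) * c
                 + ι 6 * (π * π * π) * (n - 1ℚ) * b + ι 4 * (π * π * π) * t + ι 3 * (π * π * π) * b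
  ≡ ι 24 * f + (ι 24 * π * x + ι 4 * (π * π * π) * ((n - 1ℚ) * (n - ι 2)) * b - ι 12 * (π * π) * c
                 + ι 6 * (π * π * π) * (n - 1ℚ) * b + ι 4 * (π * π * π) * t + ι 3 * (π * π * π) * b)
F-tail-identity = solve 7 (λ π n f x b c t →
  con (ι 24) :* f :+ con (ι 24) :* π :* x :+ con (ι 4) :* (π :* π :* π) :* ((n :- con 1ℚ) :* (n :- con (ι 2))) :* b :- con (ι 12) :* (π :* π) :* c :+ con (ι 6) :* (π :* π :* π) :* (n :- con 1ℚ) :* b :+ con (ι 4) :* (π :* π :* π) :* t :+ con (ι 3) :* (π :* π :* π) :* b
  := con (ι 24) :* f :+ (con (ι 24) :* π :* x :+ con (ι 4) :* (π :* π :* π) :* ((n :- con 1ℚ) :* (n :- con (ι 2))) :* b :- con (ι 12) :* (π :* π) :* c :+ con (ι 6) :* (π :* π :* π) :* (n :- con 1ℚ) :* b :+ con (ι 4) :* (π :* π :* π) :* t :+ con (ι 3) :* (π :* π :* π) :* b)) refl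
  where open ℚSolver

rearrange₄ : ∀ a b → a ≡ a + b - b
rearrange₄ = solve-∀ ℚ-ring

-- The multiples of the relations for F and h are chosen so that both cancel, and the last bracket
-- collects terms of order p³. The coefficient 11 comes from k ≡ - 3 and u ≡ - 1 modulo p: the
-- expansion of the coefficient gives 80 - 24 + 3 and the harmonic sum - 48.
first-congruence-identity₁ : ∀ π w F h x y z b c t → let u = π * w - 1ℚ ; k = π - ι 3 in
  ι 24 * (u * F) + (ι 24 * π * x + ι 4 * (π * π * π) * ((k - 1ℚ) * (k - ι 2)) * b - ι 12 * (π * π) * c
                 + ι 6 * (π * π * π) * (k - 1ℚ) * b + ι 4 * (π * π * π) * t + ι 3 * (π * π * π) * b)
  - ι 12 * (u * (ι 2 * F + h)) + ι 2 * (u * (ι 6 * h + ι 6 * ι 2 * π * (ι 3 * x - ι 3 * y + z) + ι 2 * (ι 2 + 1ℚ) * (ι 2 + ι 2) * (π * π * π) * b))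
  ≡ π * (ι 4 * (π * π) * t - ι 12 * π * c + ι 11 * (π * π) * b - ι 24 * (z - ι 3 * y + ι 2 * x) - ι 24 * π * w * (y - ι 2 * x)
    + (ι 24 * w * (π * (z - ι 2 * y + x)) + (ι 48 * w + ι 4 * π - ι 30) * b * (π * π * π)))
first-congruence-identity₁ = solve 10 (λ π w F h x y z b c t →
  con (ι 24) :* ((π :* w :- con 1ℚ) :* F) :+ (con (ι 24) :* π :* x :+ con (ι 4) :* (π :* π :* π) :* (((π :- con (ι 3)) :- con 1ℚ) :* ((π :- con (ι 3)) :- con (ι 2))) :* b :- con (ι 12) :* (π :* π) :* c :+ con (ι 6) :* (π :* π :* π) :* ((π :- con (ι 3)) :- con 1ℚ) :* b :+ con (ι 4) :* (π :* π :* π) :* t :+ con (ι 3) :* (π :* π :* π) :* b) :- con (ι 12) :* ((π :* w :- con 1ℚ) :* (con (ι 2) :* F :+ h)) :+ con (ι 2) :* ((π :* w :- con 1ℚ) :* (con (ι 6) :* h :+ con (ι 6) :* con (ι 2) :* π :* (con (ι 3) :* x :- con (ι 3) :* y :+ z) :+ con (ι 2) :* (con (ι 2) :+ con 1ℚ) :* (con (ι 2) :+ con (ι 2)) :* (π :* π :* π) :* b))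
  := π :* (con (ι 4) :* (π :* π) :* t :- con (ι 12) :* π :* c :+ con (ι 11) :* (π :* π) :* b :- con (ι 24) :* (z :- con (ι 3) :* y :+ con (ι 2) :* x) :- con (ι 24) :* π :* w :* (y :- con (ι 2) :* x) :+ (con (ι 24) :* w :* (π :* (z :- con (ι 2) :* y :+ x)) :+ (con (ι 48) :* w :+ con (ι 4) :* π :- con (ι 30)) :* b :* (π :* π :* π)))) refl
  where open ℚSolver

rearrange₅ : ∀ a b → a + b - b ≡ a
rearrange₅ = solve-∀ ℚ-ring

-- Here h₂² is also eliminated, in favour of 4 π² m². Since m² = 3 r² - 2 r v + (v - r)², Kummer's
-- congruence makes the last square negligible and the rest appears in the result. The coefficient
-- 15 is 168 - 36 + 3 - 120, from k ≡ - 5 and u ≡ - 1.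
second-congruence-identity₁ : ∀ π w F h₂ h₄ x y z b c t r v → let u = π * w - 1ℚ ; k = π - ι 5 ; m = ι 2 * r - v in
  ι 24 * (u * F) + (ι 24 * π * x + ι 4 * (π * π * π) * ((k - 1ℚ) * (k - ι 2)) * b - ι 12 * (π * π) * c
                 + ι 6 * (π * π * π) * (k - 1ℚ) * b + ι 4 * (π * π * π) * t + ι 3 * (π * π * π) * b)
  - ι 3 * (u * (ι 8 * F - h₂ * h₂ + ι 2 * h₄)) + u * (ι 6 * h₄ + ι 6 * ι 4 * π * (ι 3 * x - ι 3 * y + z) + ι 4 * (ι 4 + 1ℚ) * (ι 4 + ι 2) * (π * π * π) * b)
  - ι 3 * (u * ((h₂ - ι 2 * π * m) * (h₂ + ι 2 * π * m)))
  ≡ π * (ι 4 * (π * π) * t - ι 12 * π * c + ι 15 * (π * π) * b - ι 24 * (z - ι 3 * y + ι 2 * x) - ι 24 * π * w * (y - ι 2 * x)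
    - ι 12 * π * (ι 3 * (r * r) - ι 2 * (r * v)) + ι 12 * (π * π) * w * (r * r)
    + (ι 24 * w * (π * (z - ι 2 * y + x)) + (ι 120 * w + ι 4 * π - ι 46) * b * (π * π * π)
      + ι 12 * w * (π * π * ((v - r) * (v - ι 3 * r))) - ι 12 * (π * ((v - r) * (v - r)))))
second-congruence-identity₁ = solve 13 (λ π w F h₂ h₄ x y z b c t r v →
  con (ι 24) :* ((π :* w :- con 1ℚ) :* F) :+ (con (ι 24) :* π :* x :+ con (ι 4) :* (π :* π :* π) :* (((π :- con (ι 5)) :- con 1ℚ) :* ((π :- con (ι 5)) :- con (ι 2))) :* b :- con (ι 12) :* (π :* π) :* c :+ con (ι 6) :* (π :* π :* π) :* ((π :- con (ι 5)) :- con 1ℚ) :* b :+ con (ι 4) :* (π :* π :* π) :* t :+ con (ι 3) :* (π :* π :* π) :* b) :- con (ι 3) :* ((π :* w :- con 1ℚ) :* (con (ι 8) :* F :- h₂ :* h₂ :+ con (ι 2) :* h₄)) :+ (π :* w :- con 1ℚ) :* (con (ι 6) :* h₄ :+ con (ι 6) :* con (ι 4) :* π :* (con (ι 3) :* x :- con (ι 3) :* y :+ z) :+ con (ι 4) :* (con (ι 4) :+ con 1ℚ) :* (con (ι 4) :+ con (ι 2)) :* (π :* π :* π) :* b) :- con (ι 3) :* ((π :* w :- con 1ℚ) :* ((h₂ :- con (ι 2) :* π :* (con (ι 2) :* r :- v)) :* (h₂ :+ con (ι 2) :* π :* (con (ι 2) :* r :- v))))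
  := π :* (con (ι 4) :* (π :* π) :* t :- con (ι 12) :* π :* c :+ con (ι 15) :* (π :* π) :* b :- con (ι 24) :* (z :- con (ι 3) :* y :+ con (ι 2) :* x) :- con (ι 24) :* π :* w :* (y :- con (ι 2) :* x) :- con (ι 12) :* π :* (con (ι 3) :* (r :* r) :- con (ι 2) :* (r :* v)) :+ con (ι 12) :* (π :* π) :* w :* (r :* r) :+ (con (ι 24) :* w :* (π :* (z :- con (ι 2) :* y :+ x)) :+ (con (ι 120) :* w :+ con (ι 4) :* π :- con (ι 46)) :* b :* (π :* π :* π) :+ con (ι 12) :* w :* (π :* π :* ((v :- r) :* (v :- con (ι 3) :* r))) :- con (ι 12) :* (π :* ((v :- r) :* (v :- r)))))) refl
  where open ℚSolver

fp-identity₀ : ∀ x → 1ℚ * (x * 1ℚ) ≡ x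
fp-identity₀ = solve-∀ ℚ-ring

∑-combine-identity : ∀ F G E f g e c → F - G - c * E + (f - g - c * e) ≡ (F + f) - (G + g) - c * (E + e)
∑-combine-identity = solve-∀ ℚ-ring

V-error-identity-a : ∀ a b c → a - b - c ≡ - (b - a) - c
V-error-identity-a = solve-∀ ℚ-ring

V-error-identity-b : ∀ s t c → - (s - t * s) - c ≡ (t - 1ℚ) * s - c
V-error-identity-b = solve-∀ ℚ-ring

v-e+ε-identity : ∀ x y π e ε → - ((x - y - 0ℚ - π * e) + (y - x - 0ℚ - π * ε)) ≡ π * (e + ε)
v-e+ε-identity = solve-∀ ℚ-ring

v-Zc-identity : ∀ x y z → (z - ι 2 * y + x) + (x - y) ≡ z - ι 3 * y + ι 2 * x
v-Zc-identity = solve-∀ ℚ-ring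

v-Zc-identity′ : ∀ x y z → z - ι 2 * y + x ≡ (z - ι 3 * y + ι 2 * x) - (x - y)
v-Zc-identity′ = solve-∀ ℚ-ring

v₁-δ₂-identity : ∀ w x a δ → w * (- ι 6 * x - a) + (w * a - δ) ≡ - ι 6 * (w * x) - δ
v₁-δ₂-identity = solve-∀ ℚ-ring

power-K-identity : ∀ a b c → a * b * c ≡ b * (c * a)
power-K-identity = solve-∀ ℚ-ring

interpolation₄-identity : ∀ y T → y * ((T - 1ℚ) * ((T - 1ℚ) * ((T - 1ℚ) * ((T - 1ℚ) * 1ℚ))))
     ≡ 1ℚ * y + - ι 4 * (y * (T * 1ℚ)) + ι 6 * (y * (T * (T * 1ℚ))) + - ι 4 * (y * (T * (T * (T * 1ℚ)))) + 1ℚ * (y * (T * (T * (T * (T * 1ℚ)))))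
interpolation₄-identity = solve 2 (λ y T →
  y :* ((T :- con 1ℚ) :* ((T :- con 1ℚ) :* ((T :- con 1ℚ) :* ((T :- con 1ℚ) :* con 1ℚ))))
  := con 1ℚ :* y :+ :- con (ι 4) :* (y :* (T :* con 1ℚ)) :+ con (ι 6) :* (y :* (T :* (T :* con 1ℚ))) :+ :- con (ι 4) :* (y :* (T :* (T :* (T :* con 1ℚ)))) :+ con 1ℚ :* (y :* (T :* (T :* (T :* (T :* con 1ℚ)))))) refl
  where open ℚSolver

interpolation₄-identity′ : ∀ a b c d e → 1ℚ * a + - ι 4 * b + ι 6 * c + - ι 4 * d + 1ℚ * e ≡ a - ι 4 * b + ι 6 * c - ι 4 * d + e
interpolation₄-identity′ = solve-∀ ℚ-ring

interpolation₂-identity : ∀ y T x z → y * ((T - 1ℚ) * ((T - 1ℚ) * 1ℚ))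
     ≡ 1ℚ * y + - ι 2 * (y * (T * 1ℚ)) + 1ℚ * (y * (T * (T * 1ℚ))) + 0ℚ * x + 0ℚ * z
interpolation₂-identity = solve 4 (λ y T x z →
  y :* ((T :- con 1ℚ) :* ((T :- con 1ℚ) :* con 1ℚ))
  := con 1ℚ :* y :+ :- con (ι 2) :* (y :* (T :* con 1ℚ)) :+ con 1ℚ :* (y :* (T :* (T :* con 1ℚ))) :+ con 0ℚ :* x :+ con 0ℚ :* z) refl
  where open ℚSolver

interpolation₂-identity′ : ∀ a b c → 1ℚ * a + - ι 2 * b + 1ℚ * c + 0ℚ * b + 0ℚ * c ≡ a - ι 2 * b + c
interpolation₂-identity′ = solve-∀ ℚ-ring

aux-identity : ∀ r s q f → - r - (s - q) ≡ q * 1ℚ - (r + s * 1ℚ)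
aux-identity = solve-∀ ℚ-ring

aux-identity′ : ∀ q f → q * 1ℚ + q * f ≡ q * (f + 1ℚ)
aux-identity′ = solve-∀ ℚ-ring

F-expansion-identity : ∀ π f P P² P³ W² x c t b n → ι 4 * ((ι 6 * f - (0ℚ + ι 6 * P + ι 3 * P² + P³)) + (ι 6 * P + ι 6 * π * x + π * π * π * ((n - 1ℚ) * (n - ι 2)) * b) + ι 3 * (P² - W²)
    + ι 3 * (W² - π * π * c - ι 2 * (π * π * π) * - (¼ * ((n - 1ℚ) * b))) + (P³ - π * π * π * (- t - ¾ * b)))
  ≡ ι 24 * f + ι 24 * π * x + ι 4 * (π * π * π) * ((n - 1ℚ) * (n - ι 2)) * b - ι 12 * (π * π) * c + ι 6 * (π * π * π) * (n - 1ℚ) * b + ι 4 * (π * π * π) * t + ι 3 * (π * π * π) * b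
F-expansion-identity = solve 11 (λ π f P P² P³ W² x c t b n →
  con (ι 4) :* ((con (ι 6) :* f :- (con 0ℚ :+ con (ι 6) :* P :+ con (ι 3) :* P² :+ P³)) :+ (con (ι 6) :* P :+ con (ι 6) :* π :* x :+ π :* π :* π :* ((n :- con 1ℚ) :* (n :- con (ι 2))) :* b) :+ con (ι 3) :* (P² :- W²) :+ con (ι 3) :* (W² :- π :* π :* c :- con (ι 2) :* (π :* π :* π) :* :- (con ¼ :* ((n :- con 1ℚ) :* b))) :+ (P³ :- π :* π :* π :* (:- t :- con ¾ :* b)))
  := con (ι 24) :* f :+ con (ι 24) :* π :* x :+ con (ι 4) :* (π :* π :* π) :* ((n :- con 1ℚ) :* (n :- con (ι 2))) :* b :- con (ι 12) :* (π :* π) :* c :+ con (ι 6) :* (π :* π :* π) :* (n :- con 1ℚ) :* b :+ con (ι 4) :* (π :* π :* π) :* t :+ con (ι 3) :* (π :* π :* π) :* b) refl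
  where open ℚSolver

oddHarmonic-identity : ∀ h s₀ s₁ → h - ι 2 * s₀ + s₁ + ι 2 * s₀ - s₁ ≡ h
oddHarmonic-identity = solve-∀ ℚ-ring

integral-identity : ∀ a b c → a * b * c ≡ b * (a * c)
integral-identity = solve-∀ ℚ-ring

fermat-identity : ∀ x a m → x - a + m ≡ (1ℚ + (m + x)) - (1ℚ + a)
fermat-identity = solve-∀ ℚ-ring

fermat′-identity : ∀ a x → a * x - a ≡ a * (x - 1ℚ)
fermat′-identity = solve-∀ ℚ-ring

voronoi-identity : ∀ t s n b k g → (t - 1ℚ) * - (s - n * (k * b)) + ((t - 1ℚ) * s - k * n * g) ≡ n * (k * ((t - 1ℚ) * b - g))
voronoi-identity = solve-∀ ℚ-ring

int-identity : ∀ a b → a - b + b ≡ a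
int-identity = solve-∀ ℚ-ring

d¹-identity : ∀ b b′ u u′ g g′ → (u′ * b′ - g′ - (u * b - g)) + (g′ - g) - (u′ - u) * b′ ≡ u * (b′ - b)
d¹-identity = solve-∀ ℚ-ring

d²-identity : ∀ b b′ b″ u u′ u″ g g′ g″ → (u″ * b″ - g″ - ι 2 * (u′ * b′ - g′) + (u * b - g)) + (g″ - ι 2 * g′ + g) - ι 2 * ((u′ - u) * (b″ - b′)) - (u″ - ι 2 * u′ + u) * b″
  ≡ u * (b″ - ι 2 * b′ + b)
d²-identity = solve 9 (λ b b′ b″ u u′ u″ g g′ g″ →
  (u″ :* b″ :- g″ :- con (ι 2) :* (u′ :* b′ :- g′) :+ (u :* b :- g)) :+ (g″ :- con (ι 2) :* g′ :+ g) :- con (ι 2) :* ((u′ :- u) :* (b″ :- b′)) :- (u″ :- con (ι 2) :* u′ :+ u) :* b″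
  := u :* (b″ :- con (ι 2) :* b′ :+ b)) refl
  where open ℚSolver

combine₁-identity : ∀ π T γ c₀ c₁ b x y z s e δ₁ δ₁′ δ₂ m₁ k₀ k₁ a₀ a₁ w w₀ w₁ L₁ →
    (ι 4 * (π * π) * T - ι 12 * π * γ + ι 11 * (π * π) * b - ι 24 * (z - ι 3 * y + ι 2 * x) - ι 24 * π * w * (y - ι 2 * x)) + ι 12 * (π * (γ - c₀ - π * c₁)) + ι 24 * (z - ι 3 * y + ι 2 * x - 0ℚ - π * e - π * π * s) + ι 24 * (π * (w - w₀ - π * w₁) * (y - ι 2 * x))
    + ι 4 * (π * (ι 6 * (y - ι 2 * x) - a₀ - π * a₁) * w₀) + ι 4 * (π * π * (ι 6 * (y - ι 2 * x) - a₀) * w₁) + ι 4 * (π * (ι 6 * e - δ₁ - π * δ₁′))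
    + ι 4 * (π * (w₀ * a₀ - δ₂ - π * m₁)) + ι 4 * (π * (ι 3 * c₀ - k₀ - π * k₁)) + ι 4 * (π * (δ₁ + δ₂ + k₀ - 0ℚ - π * L₁))
    ≡ π * (π * 1ℚ) * (ι 4 * (T - (ι 3 * c₁ - ((ℤ.+ 11) / 4) * b + ι 6 * s + δ₁′ + k₁ + w₁ * a₀ + w₀ * a₁ + m₁ + L₁)))
combine₁-identity = solve 23 (λ π T γ c₀ c₁ b x y z s e δ₁ δ₁′ δ₂ m₁ k₀ k₁ a₀ a₁ w w₀ w₁ L₁ →
  (con (ι 4) :* (π :* π) :* T :- con (ι 12) :* π :* γ :+ con (ι 11) :* (π :* π) :* b :- con (ι 24) :* (z :- con (ι 3) :* y :+ con (ι 2) :* x) :- con (ι 24) :* π :* w :* (y :- con (ι 2) :* x)) :+ con (ι 12) :* (π :* (γ :- c₀ :- π :* c₁)) :+ con (ι 24) :* (z :- con (ι 3) :* y :+ con (ι 2) :* x :- con 0ℚ :- π :* e :- π :* π :* s) :+ con (ι 24) :* (π :* (w :- w₀ :- π :* w₁) :* (y :- con (ι 2) :* x)) :+ con (ι 4) :* (π :* (con (ι 6) :* (y :- con (ι 2) :* x) :- a₀ :- π :* a₁) :* w₀) :+ con (ι 4) :* (π :* π :* (con (ι 6) :* (y :- con (ι 2) :* x) :- a₀) :* w₁) :+ con (ι 4) :* (π :* (con (ι 6) :* e :- δ₁ :- π :* δ₁′)) :+ con (ι 4) :* (π :* (w₀ :* a₀ :- δ₂ :- π :* m₁)) :+ con (ι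 4) :* (π :* (con (ι 3) :* c₀ :- k₀ :- π :* k₁)) :+ con (ι 4) :* (π :* (δ₁ :+ δ₂ :+ k₀ :- con 0ℚ :- π :* L₁))
  := π :* (π :* con 1ℚ) :* (con (ι 4) :* (T :- (con (ι 3) :* c₁ :- con ((ℤ.+ 11) / 4) :* b :+ con (ι 6) :* s :+ δ₁′ :+ k₁ :+ w₁ :* a₀ :+ w₀ :* a₁ :+ m₁ :+ L₁)))) refl
  where open ℚSolver

combine₂-reduce₁ : ∀ π T γ b x y z w c₀ c₁ s e η₀ η₁ u v g j δ₁ δ₁′ →
    ι 4 * (π * π) * T - ι 12 * π * γ + ι 15 * (π * π) * b - ι 24 * (z - ι 3 * y + ι 2 * x) - ι 24 * π * w * (y - ι 2 * x)
    - ι 12 * π * (ι 3 * (u * u) - ι 2 * (u * v)) + ι 12 * (π * π) * w * (u * u)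
    + ι 12 * (π * (γ - c₀ - π * c₁))
    + ι 24 * (z - ι 3 * y + ι 2 * x - 0ℚ - π * e - π * π * s)
    + ι 4 * (π * (ι 3 * (g * g) - η₀ - π * η₁))
    + ι 24 * u * (π * (ι 2 * u - v - g - π * j))
    - ι 12 * (π * ((u - g) * (u - g)))
    + ι 4 * (π * (ι 6 * e - δ₁ - π * δ₁′))
    ≡ π * π * (ι 4 * (T - (ι 3 * c₁ - ((ℤ.+ 15) / 4) * b + η₁ + ι 6 * u * j + ι 6 * s + δ₁′)))
      - (ι 12 * π * c₀ + ι 4 * π * η₀ + ι 4 * π * δ₁ + ι 24 * π * w * (y - ι 2 * x) - ι 12 * (π * π) * w * (u * u))
combine₂-reduce₁ = solve 20 (λ π T γ b x y z w c₀ c₁ s e η₀ η₁ u v g j δ₁ δ₁′ →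
  con (ι 4) :* (π :* π) :* T :- con (ι 12) :* π :* γ :+ con (ι 15) :* (π :* π) :* b :- con (ι 24) :* (z :- con (ι 3) :* y :+ con (ι 2) :* x) :- con (ι 24) :* π :* w :* (y :- con (ι 2) :* x) :- con (ι 12) :* π :* (con (ι 3) :* (u :* u) :- con (ι 2) :* (u :* v)) :+ con (ι 12) :* (π :* π) :* w :* (u :* u) :+ con (ι 12) :* (π :* (γ :- c₀ :- π :* c₁)) :+ con (ι 24) :* (z :- con (ι 3) :* y :+ con (ι 2) :* x :- con 0ℚ :- π :* e :- π :* π :* s) :+ con (ι 4) :* (π :* (con (ι 3) :* (g :* g) :- η₀ :- π :* η₁)) :+ con (ι 24) :* u :* (π :* (con (ι 2) :* u :- v :- g :- π :* j)) :- con (ι 12) :* (π :* ((u :- g) :* (u :- g))) :+ con (ι 4) :* (π :* (con (ι 6) :* e :- δ₁ :- π :* δ₁′))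
  := π :* π :* (con (ι 4) :* (T :- (con (ι 3) :* c₁ :- con ((ℤ.+ 15) / 4) :* b :+ η₁ :+ con (ι 6) :* u :* j :+ con (ι 6) :* s :+ δ₁′))) :- (con (ι 12) :* π :* c₀ :+ con (ι 4) :* π :* η₀ :+ con (ι 4) :* π :* δ₁ :+ con (ι 24) :* π :* w :* (y :- con (ι 2) :* x) :- con (ι 12) :* (π :* π) :* w :* (u :* u))) refl
  where open ℚSolver

combine₂-reduce₂ : ∀ π x y w w₀ w₁ c₀ ε a₀ a₁ η₀ u δ₁ δ₂ m₁ o₁ o₂ k₀ k₁ L₁ →
    ι 4 * (w₀ * (π * (- ι 6 * x - a₀ - π * a₁)))
    - ι 24 * (π * (w - w₀ - π * w₁) * x)
    + ι 4 * (w₁ * (π * π * (- ι 6 * x - a₀)))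
    + ι 4 * (π * (w₀ * a₀ - δ₂ - π * m₁))
    + ι 4 * (π * π * (- ι 6 * (w₀ * w₀) * x - o₁ + (ι 3 * w₀ * c₀ - o₂)))
    - ι 12 * (π * π * (- w₀ * (ι 2 * w₀ * x + ι 2 * ε - u * u - c₀) + u * u * (w - w₀)))
    + ι 4 * (π * (ι 3 * c₀ - k₀ - π * k₁))
    + ι 4 * (π * (η₀ + δ₁ + δ₂ + k₀ - 0ℚ - π * L₁))
    + ι 24 * w * (π * (y - x - 0ℚ - π * ε))
    + ι 24 * (π * π * ((w - w₀) * ε))
    ≡ (ι 12 * π * c₀ + ι 4 * π * η₀ + ι 4 * π * δ₁ + ι 24 * π * w * (y - ι 2 * x) - ι 12 * (π * π) * w * (u * u))
      - π * π * (ι 4 * (w₀ * a₁ + w₁ * a₀ + m₁ + o₁ + o₂ + k₁ + L₁))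
combine₂-reduce₂ = solve 20 (λ π x y w w₀ w₁ c₀ ε a₀ a₁ η₀ u δ₁ δ₂ m₁ o₁ o₂ k₀ k₁ L₁ →
  con (ι 4) :* (w₀ :* (π :* (:- con (ι 6) :* x :- a₀ :- π :* a₁))) :- con (ι 24) :* (π :* (w :- w₀ :- π :* w₁) :* x) :+ con (ι 4) :* (w₁ :* (π :* π :* (:- con (ι 6) :* x :- a₀))) :+ con (ι 4) :* (π :* (w₀ :* a₀ :- δ₂ :- π :* m₁)) :+ con (ι 4) :* (π :* π :* (:- con (ι 6) :* (w₀ :* w₀) :* x :- o₁ :+ (con (ι 3) :* w₀ :* c₀ :- o₂))) :- con (ι 12) :* (π :* π :* (:- w₀ :* (con (ι 2) :* w₀ :* x :+ con (ι 2) :* ε :- u :* u :- c₀) :+ u :* u :* (w :- w₀))) :+ con (ι 4) :* (π :* (con (ι 3) :* c₀ :- k₀ :- π :* k₁)) :+ con (ι 4) :* (π :* (η₀ :+ δ₁ :+ δ₂ :+ k₀ :- con 0ℚ :- π :* L₁)) :+ con (ι 24) :* w :* (π :* (y :- x :- con 0ℚ :- π :* ε)) :+ con (ι 24) :* (π :* π :* ((w :- w₀) :* ε))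
  := (con (ι 12) :* π :* c₀ :+ con (ι 4) :* π :* η₀ :+ con (ι 4) :* π :* δ₁ :+ con (ι 24) :* π :* w :* (y :- con (ι 2) :* x) :- con (ι 12) :* (π :* π) :* w :* (u :* u)) :- π :* π :* (con (ι 4) :* (w₀ :* a₁ :+ w₁ :* a₀ :+ m₁ :+ o₁ :+ o₂ :+ k₁ :+ L₁))) refl
  where open ℚSolver

combine₂-assemble : ∀ U π T R a b c d e f g → π * π * (ι 4 * (T - R)) - U + (U - π * π * (ι 4 * (a + b + c + d + e + f + g))) ≡ π * (π * 1ℚ) * (ι 4 * (T - (R + a + b + c + d + e + f + g)))
combine₂-assemble = solve 11 (λ U π T R a b c d e f g →
  π :* π :* (con (ι 4) :* (T :- R)) :- U :+ (U :- π :* π :* (con (ι 4) :* (a :+ b :+ c :+ d :+ e :+ f :+ g)))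
  := π :* (π :* con 1ℚ) :* (con (ι 4) :* (T :- (R :+ a :+ b :+ c :+ d :+ e :+ f :+ g)))) refl
  where open ℚSolver

constant₁-identity₀ : ∀ π T γ b x y z w w₀ ε → π * π * (ι 4 * T + ι 11 * b) - (ι 4 * (π * π) * T - ι 12 * π * γ + ι 11 * (π * π) * b - ι 24 * (z - ι 3 * y + ι 2 * x) - ι 24 * π * w * (y - ι 2 * x))
  + ι 24 * (y - x - 0ℚ - π * ε) - ι 24 * (z - ι 2 * y + x) - ι 24 * w * (π * (y - x)) + ι 24 * x * (π * (w - w₀))
  ≡ π * (ι 12 * (γ - (ι 2 * ε + ι 2 * w₀ * x)))
constant₁-identity₀ = solve 10 (λ π T γ b x y z w w₀ ε →
  π :* π :* (con (ι 4) :* T :+ con (ι 11) :* b) :- (con (ι 4) :* (π :* π) :* T :- con (ι 12) :* π :* γ :+ con (ι 11) :* (π :* π) :* b :- con (ι 24) :* (z :- con (ι 3) :* y :+ con (ι 2) :* x) :- con (ι 24) :* π :* w :* (y :- con (ι 2) :* x)) :+ con (ι 24) :* (y :- x :- con 0ℚ :- π :* ε) :- con (ι 24) :* (z :- con (ι 2) :* y :+ x) :- con (ι 24) :* w :* (π :* (y :- x)) :+ con (ι 24) :* x :* (π :* (w :- w₀))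
  := π :* (con (ι 12) :* (γ :- (con (ι 2) :* ε :+ con (ι 2) :* w₀ :* x)))) refl
  where open ℚSolver

constant₂-identity₀ : ∀ π T γ b x y z w w₀ ε u v → π * π * (ι 4 * T + ι 15 * b + ι 12 * w * (u * u)) - (ι 4 * (π * π) * T - ι 12 * π * γ + ι 15 * (π * π) * b - ι 24 * (z - ι 3 * y + ι 2 * x) - ι 24 * π * w * (y - ι 2 * x)
    - ι 12 * π * (ι 3 * (u * u) - ι 2 * (u * v)) + ι 12 * (π * π) * w * (u * u))
  + ι 24 * (y - x - 0ℚ - π * ε) - ι 24 * (z - ι 2 * y + x) - ι 24 * w * (π * (y - x)) + ι 24 * x * (π * (w - w₀)) + ι 24 * u * (π * (v - u))
  ≡ π * (ι 12 * (γ - (ι 2 * w₀ * x + ι 2 * ε - u * u)))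
constant₂-identity₀ = solve 12 (λ π T γ b x y z w w₀ ε u v →
  π :* π :* (con (ι 4) :* T :+ con (ι 15) :* b :+ con (ι 12) :* w :* (u :* u)) :- (con (ι 4) :* (π :* π) :* T :- con (ι 12) :* π :* γ :+ con (ι 15) :* (π :* π) :* b :- con (ι 24) :* (z :- con (ι 3) :* y :+ con (ι 2) :* x) :- con (ι 24) :* π :* w :* (y :- con (ι 2) :* x) :- con (ι 12) :* π :* (con (ι 3) :* (u :* u) :- con (ι 2) :* (u :* v)) :+ con (ι 12) :* (π :* π) :* w :* (u :* u)) :+ con (ι 24) :* (y :- x :- con 0ℚ :- π :* ε) :- con (ι 24) :* (z :- con (ι 2) :* y :+ x) :- con (ι 24) :* w :* (π :* (y :- x)) :+ con (ι 24) :* x :* (π :* (w :- w₀)) :+ con (ι 24) :* u :* (π :* (v :- u))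
  := π :* (con (ι 12) :* (γ :- (con (ι 2) :* w₀ :* x :+ con (ι 2) :* ε :- u :* u)))) refl
  where open ℚSolver

rearrange₆ : ∀ f s i → f * (s * i) ≡ s * (f * i)
rearrange₆ = solve-∀ ℚ-ring

∂P-identity : ∀ a s r → a * - (s * r) ≡ - (s * (a * r))
∂P-identity = solve-∀ ℚ-ring

wilson-quotient-identity : ∀ a → a + 1ℚ - 1ℚ ≡ a
wilson-quotient-identity = solve-∀ ℚ-ring

F-exp₃-identity₁ : ∀ s f e → s * (ι 6 * f - e) ≡ ι 6 * (s * f) - s * e
F-exp₃-identity₁ = solve-∀ ℚ-ring

V-P-W-identity : ∀ x → 0ℚ - (x * - 0ℚ + x * x * 0ℚ) ≡ 0ℚ
V-P-W-identity = solve-∀ ℚ-ring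

V-P-W-identity₀ : ∀ c r x y b → (c * r) * ((x * (x * x)) * (y * b)) ≡ c * r * (x * (x * (x * y))) * b
V-P-W-identity₀ = solve-∀ ℚ-ring

V-P-W-identity₁ : ∀ r s x b b′ c → - (r * s) ≡ - ((0ℚ + 1ℚ * 1ℚ * (x * 1ℚ) * b + c * ½ * (x * (x * 1ℚ)) * b′ + s) * r) - (x * - (b * r) + x * x * - (½ * (c * r * b′)))
V-P-W-identity₁ = solve 6 (λ r s x b b′ c →
  :- (r :* s)
  := :- ((con 0ℚ :+ con 1ℚ :* con 1ℚ :* (x :* con 1ℚ) :* b :+ c :* con ½ :* (x :* (x :* con 1ℚ)) :* b′ :+ s) :* r) :- (x :* :- (b :* r) :+ x :* x :* :- (con ½ :* (c :* r :* b′)))) refl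
  where open ℚSolver

powerSum-even-identity₁ : ∀ s π k x c₁ c₂ c₃ b k₂ → ι 6 * (s - (0ℚ + 1ℚ * 1ℚ * (π * 1ℚ) * (k * x) + c₁ * rec 1 * (π * (π * 1ℚ)) * 0ℚ
  + c₂ * rec 2 * (π * (π * (π * 1ℚ))) * (k₂ * b) + c₃ * rec 3 * (π * (π * (π * (π * 1ℚ)))) * 0ℚ)) ≡ ι 6 * s - ι 6 * π * k * x - π * π * π * (c₂ * ι 2 * k₂) * b
powerSum-even-identity₁ = solve 9 (λ s π k x c₁ c₂ c₃ b k₂ →
  con (ι 6) :* (s :- (con 0ℚ :+ con 1ℚ :* con 1ℚ :* (π :* con 1ℚ) :* (k :* x) :+ c₁ :* con (rec 1) :* (π :* (π :* con 1ℚ)) :* con 0ℚ :+ c₂ :* con (rec 2) :* (π :* (π :* (π :* con 1ℚ))) :* (k₂ :* b) :+ c₃ :* con (rec 3) :* (π :* (π :* (π :* (π :* con 1ℚ)))) :* con 0ℚ))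
  := con (ι 6) :* s :- con (ι 6) :* π :* k :* x :- π :* π :* π :* (c₂ :* con (ι 2) :* k₂) :* b) refl
  where open ℚSolver

powerSum-even-identity₃ : ∀ a → 1ℚ + (1ℚ + a) - ι 2 ≡ a
powerSum-even-identity₃ = solve-∀ ℚ-ring

powerSum-odd-identity : ∀ s π c₀ c₁ c₂ c₃ b₁ b₃ → s - (0ℚ + c₀ * 1ℚ * (π * 1ℚ) * 0ℚ + c₁ * rec 1 * (π * (π * 1ℚ)) * b₁
  + c₂ * rec 2 * (π * (π * (π * 1ℚ))) * 0ℚ + c₃ * rec 3 * (π * (π * (π * (π * 1ℚ)))) * b₃)
  + c₁ * rec 1 * (π * π * b₁) + c₃ * rec 3 * (π * (π * π) * (π * b₃)) ≡ s
powerSum-odd-identity = solve 8 (λ s π c₀ c₁ c₂ c₃ b₁ b₃ →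
  s :- (con 0ℚ :+ c₀ :* con 1ℚ :* (π :* con 1ℚ) :* con 0ℚ :+ c₁ :* con (rec 1) :* (π :* (π :* con 1ℚ)) :* b₁ :+ c₂ :* con (rec 2) :* (π :* (π :* (π :* con 1ℚ))) :* con 0ℚ :+ c₃ :* con (rec 3) :* (π :* (π :* (π :* (π :* con 1ℚ)))) :* b₃) :+ c₁ :* con (rec 1) :* (π :* π :* b₁) :+ c₃ :* con (rec 3) :* (π :* (π :* π) :* (π :* b₃))
  := s) refl
  where open ℚSolver

combine-harmonic-identity₀ : ∀ a b c → (c - b) + (b - a) ≡ c - a
combine-harmonic-identity₀ = solve-∀ ℚ-ring

-- The arguments j π - (r + j) are affine in j and the fourth difference of a cubic polynomial
-- vanishes, so the weighted sum over j = 1, ..., 4 is the value at j = 0, where the argument is -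
-- r.
cubic-difference : ∀ π r → ι 4 * ((ι 1 * π - (r + ι 1)) * (ι 1 * π - (r + ι 1) - 1ℚ) * (ι 1 * π - (r + ι 1) - ι 2))
    - ι 6 * ((ι 2 * π - (r + ι 2)) * (ι 2 * π - (r + ι 2) - 1ℚ) * (ι 2 * π - (r + ι 2) - ι 2))
    + ι 4 * ((ι 3 * π - (r + ι 3)) * (ι 3 * π - (r + ι 3) - 1ℚ) * (ι 3 * π - (r + ι 3) - ι 2))
    - (ι 4 * π - (r + ι 4)) * (ι 4 * π - (r + ι 4) - 1ℚ) * (ι 4 * π - (r + ι 4) - ι 2)
    ≡ - (r * (r + 1ℚ) * (r + ι 2))
cubic-difference = solve 2 (λ π r →
  con (ι 4) :* ((con (ι 1) :* π :- (r :+ con (ι 1))) :* (con (ι 1) :* π :- (r :+ con (ι 1)) :- con 1ℚ) :* (con (ι 1) :* π :- (r :+ con (ι 1)) :- con (ι 2))) :- con (ι 6) :* ((con (ι 2) :* π :- (r :+ con (ι 2))) :* (con (ι 2) :* π :- (r :+ con (ι 2)) :- con 1ℚ) :* (con (ι 2) :* π :- (r :+ con (ι 2)) :- con (ι 2))) :+ con (ι 4) :* ((con (ι 3) :* π :- (r :+ con (ι 3))) :* (con (ι 3) :* π :- (r :+ con (ι 3)) :- con 1ℚ) :* (con (ι 3) :* π :- (r :+ con (ι 3)) :- con (ι 2))) :- (con (ι 4) :* π :- (r :+ con (ι 4))) :* (con (ι 4) :* π :- (r :+ con (ι 4)) :- con 1ℚ) :* (con (ι 4) :* π :- (r :+ con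 (ι 4)) :- con (ι 2))
  := :- (r :* (r :+ con 1ℚ) :* (r :+ con (ι 2)))) refl
  where open ℚSolver

combine-harmonic-identity₁ : ∀ π H s₀ s₁ s₂ s₃ y₀ y₁ y₂ y₃ k₀ k₁ k₂ k₃ c₀ c₁ c₂ c₃ z₀ z₁ z₂ z₃ →
  ι 6 * (H - ι 4 * s₀ + ι 6 * s₁ - ι 4 * s₂ + s₃)
  - ι 6 * (ι 6 * s₁ - ι 6 * π * k₁ * y₁ - π * π * π * c₁ * z₁)
  + ι 4 * (ι 6 * s₀ - ι 6 * π * k₀ * y₀ - π * π * π * c₀ * z₀)
  - ((ι 6 * s₃ - ι 6 * π * k₃ * y₃ - π * π * π * c₃ * z₃) - ι 4 * (ι 6 * s₂ - ι 6 * π * k₂ * y₂ - π * π * π * c₂ * z₂))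
  + π * π * π * (ι 4 * (c₂ * (z₂ - z₀)) - ι 6 * (c₁ * (z₁ - z₀)) - c₃ * (z₃ - z₀))
  + - (ι 6 * k₃) * (π * (y₃ - ι 3 * y₂ + ι 3 * y₁ - y₀))
  ≡ ι 6 * H - ι 6 * π * ((ι 4 * k₀ - k₃) * y₀ - (ι 6 * k₁ - ι 3 * k₃) * y₁ + (ι 4 * k₂ - ι 3 * k₃) * y₂) - (ι 4 * c₀ - ι 6 * c₁ + ι 4 * c₂ - c₃) * (π * π * π) * z₀
combine-harmonic-identity₁ = solve 22 (λ π H s₀ s₁ s₂ s₃ y₀ y₁ y₂ y₃ k₀ k₁ k₂ k₃ c₀ c₁ c₂ c₃ z₀ z₁ z₂ z₃ →
  con (ι 6) :* (H :- con (ι 4) :* s₀ :+ con (ι 6) :* s₁ :- con (ι 4) :* s₂ :+ s₃) :- con (ι 6) :* (con (ι 6) :* s₁ :- con (ι 6) :* π :* k₁ :* y₁ :- π :* π :* π :* c₁ :* z₁) :+ con (ι 4) :* (con (ι 6) :* s₀ :- con (ι 6) :* π :* k₀ :* y₀ :- π :* π :* π :* c₀ :* z₀) :- ((con (ι 6) :* s₃ :- con (ι 6) :* π :* k₃ :* y₃ :- π :* π :* π :* c₃ :* z₃) :- con (ι 4) :* (con (ι 6) :* s₂ :- con (ι 6) :* π :* k₂ :* y₂ :- π :* π :* π :* c₂ :* z₂)) :+ π :* π :* π :* (con (ι 4) :* (c₂ :* (z₂ :- z₀)) :- con (ι 6) :* (c₁ :* (z₁ :- z₀)) :- c₃ :*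 (z₃ :- z₀)) :+ :- (con (ι 6) :* k₃) :* (π :* (y₃ :- con (ι 3) :* y₂ :+ con (ι 3) :* y₁ :- y₀))
  := con (ι 6) :* H :- con (ι 6) :* π :* ((con (ι 4) :* k₀ :- k₃) :* y₀ :- (con (ι 6) :* k₁ :- con (ι 3) :* k₃) :* y₁ :+ (con (ι 4) :* k₂ :- con (ι 3) :* k₃) :* y₂) :- (con (ι 4) :* c₀ :- con (ι 6) :* c₁ :+ con (ι 4) :* c₂ :- c₃) :* (π :* π :* π) :* z₀) refl
  where open ℚSolver

-- With k_j = j π - (r + j), the weights left after the elimination of y₃ are 4 k₁ - k₄ = - 3 r, 6
-- k₂ - 3 k₄ = - 3 r and 4 k₃ - 3 k₄ = - r: the multiples of π cancel.
combine-harmonic-identity₂ : ∀ π r H y₀ y₁ y₂ z c → ι 6 * H - ι 6 * π * ((ι 4 * (ι 1 * π - (r + ι 1)) - (ι 4 * π - (r + ι 4))) * y₀ - (ι 6 * (ι 2 * π - (r + ι 2)) - ι 3 * (ι 4 * π - (r + ι 4))) * y₁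
    + (ι 4 * (ι 3 * π - (r + ι 3)) - ι 3 * (ι 4 * π - (r + ι 4))) * y₂) - - c * (π * π * π) * z
  ≡ ι 6 * H + ι 6 * r * π * (ι 3 * y₀ - ι 3 * y₁ + y₂) + c * (π * π * π) * z
combine-harmonic-identity₂ = solve 8 (λ π r H y₀ y₁ y₂ z c →
  con (ι 6) :* H :- con (ι 6) :* π :* ((con (ι 4) :* (con (ι 1) :* π :- (r :+ con (ι 1))) :- (con (ι 4) :* π :- (r :+ con (ι 4)))) :* y₀ :- (con (ι 6) :* (con (ι 2) :* π :- (r :+ con (ι 2))) :- con (ι 3) :* (con (ι 4) :* π :- (r :+ con (ι 4)))) :* y₁ :+ (con (ι 4) :* (con (ι 3) :* π :- (r :+ con (ι 3))) :- con (ι 3) :* (con (ι 4) :* π :- (r :+ con (ι 4)))) :* y₂) :- :- c :* (π :* π :* π) :* z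
  := con (ι 6) :* H :+ con (ι 6) :* r :* π :* (con (ι 3) :* y₀ :- con (ι 3) :* y₁ :+ y₂) :+ c :* (π :* π :* π) :* z) refl
  where open ℚSolver

V-bern-≤-identity : ∀ s b → - s ≡ b - (s + b * 1ℚ)
V-bern-≤-identity = solve-∀ ℚ-ring

faulhaber-C-identity₂ : ∀ f n r i b j → f * (n * (r * i) * (b * j)) ≡ (f * (i * j)) * r * n * b
faulhaber-C-identity₂ = solve-∀ ℚ-ring

rearrange₇ : ∀ c r x y b → c * ((y * r) * (x * b)) ≡ c * r * (x * y) * b
rearrange₇ = solve-∀ ℚ-ring

V-πB-identity′ : ∀ x b s → 1ℚ * 1ℚ * (x * 1ℚ) * b + s - s ≡ x * b
V-πB-identity′ = solve-∀ ℚ-ring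

powerSum-mod-p⁴-identity′ : ∀ a b → a ≡ b + a - b
powerSum-mod-p⁴-identity′ = solve-∀ ℚ-ring

powerSum-p³-identity : ∀ c r x y z b → c * ((y * r) * ((x * b) * z)) ≡ c * r * (x * y * z) * b
powerSum-p³-identity = solve-∀ ℚ-ring

powerSum-p³-identity′ : ∀ s n b → (0ℚ + 1ℚ * 1ℚ * (n * 1ℚ) * b + 0ℚ) + s - n * b ≡ s
powerSum-p³-identity′ = solve-∀ ℚ-ring

binomial-identity₂ : ∀ f a i b j → f * (a * i * (b * j)) ≡ f * (i * j) * (a * b)
binomial-identity₂ = solve-∀ ℚ-ring

V-shift-^-identity : ∀ c N → 0ℚ ≡ (c + N) * 1ℚ - c * 1ℚ - ι 1 * N * 1ℚ
V-shift-^-identity = solve-∀ ℚ-ring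

V-shift-^-identity′ : ∀ c N x y s → (c + N) * (y - c * x - s * N * x) + (N * N) * (s * x) ≡ (c + N) * y - c * (c * x) - (1ℚ + s) * N * (c * x)
V-shift-^-identity′ = solve 5 (λ c N x y s →
  (c :+ N) :* (y :- c :* x :- s :* N :* x) :+ (N :* N) :* (s :* x)
  := (c :+ N) :* y :- c :* (c :* x) :- (con 1ℚ :+ s) :* N :* (c :* x)) refl
  where open ℚSolver

Smooth-geometric-identity₀ : ∀ c x → c * 1ℚ * x ≡ c * x
Smooth-geometric-identity₀ = solve-∀ ℚ-ring

Smooth-geometric-identity₁ : ∀ c t x → c * ((t - 1ℚ) * 1ℚ) * x ≡ c * (t * x) - c * x
Smooth-geometric-identity₁ = solve-∀ ℚ-ring

Smooth-geometric-identity₂ : ∀ c t x → c * ((t - 1ℚ) * ((t - 1ℚ) * 1ℚ)) * x ≡ c * (t * (t * x)) - ι 2 * (c * (t * x)) + c * x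
Smooth-geometric-identity₂ = solve-∀ ℚ-ring

Smooth-geometric-identity₃ : ∀ c t x → c * ((t - 1ℚ) * ((t - 1ℚ) * ((t - 1ℚ) * 1ℚ))) * x ≡ c * (t * (t * (t * x))) - ι 3 * (c * (t * (t * x))) + ι 3 * (c * (t * x)) - c * x
Smooth-geometric-identity₃ = solve 3 (λ c t x →
  c :* ((t :- con 1ℚ) :* ((t :- con 1ℚ) :* ((t :- con 1ℚ) :* con 1ℚ))) :* x
  := c :* (t :* (t :* (t :* x))) :- con (ι 3) :* (c :* (t :* (t :* x))) :+ con (ι 3) :* (c :* (t :* x)) :- c :* x) refl
  where open ℚSolver

Smooth-∑-identity₁ : ∀ a b x y → (a - b) + (x - y) ≡ a + x - (b + y)
Smooth-∑-identity₁ = solve-∀ ℚ-ring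

Smooth-∑-identity₂ : ∀ a b c x y z → (a - ι 2 * b + c) + (x - ι 2 * y + z) ≡ a + x - ι 2 * (b + y) + (c + z)
Smooth-∑-identity₂ = solve-∀ ℚ-ring

Smooth-∑-identity₃ : ∀ a b c d x y z w → (a - ι 3 * b + ι 3 * c - d) + (x - ι 3 * y + ι 3 * z - w) ≡ a + x - ι 3 * (b + y) + ι 3 * (c + z) - (d + w)
Smooth-∑-identity₃ = solve 8 (λ a b c d x y z w →
  (a :- con (ι 3) :* b :+ con (ι 3) :* c :- d) :+ (x :- con (ι 3) :* y :+ con (ι 3) :* z :- w)
  := a :+ x :- con (ι 3) :* (b :+ y) :+ con (ι 3) :* (c :+ z) :- (d :+ w)) refl
  where open ℚSolver

Smooth-pred-identity₁ : ∀ a b → a - b ≡ (a - 1ℚ) - (b - 1ℚ)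
Smooth-pred-identity₁ = solve-∀ ℚ-ring

Smooth-pred-identity₂ : ∀ a b c → a - ι 2 * b + c ≡ (a - 1ℚ) - ι 2 * (b - 1ℚ) + (c - 1ℚ)
Smooth-pred-identity₂ = solve-∀ ℚ-ring

Smooth-pred-identity₃ : ∀ a b c d → a - ι 3 * b + ι 3 * c - d ≡ (a - 1ℚ) - ι 3 * (b - 1ℚ) + ι 3 * (c - 1ℚ) - (d - 1ℚ)
Smooth-pred-identity₃ = solve-∀ ℚ-ring

smooth-quotient-identity₃ : ∀ a b c d u v w x g h i j →
  (x * d - j - ι 3 * (w * c - i) + ι 3 * (v * b - h) - (u * a - g)) + (j - ι 3 * i + ι 3 * h - g)
    - ι 3 * ((v - u) * (d - ι 2 * c + b)) - ι 3 * ((w - ι 2 * v + u) * (d - c)) - (x - ι 3 * w + ι 3 * v - u) * d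
  ≡ u * (d - ι 3 * c + ι 3 * b - a)
smooth-quotient-identity₃ = solve 12 (λ a b c d u v w x g h i j →
  (x :* d :- j :- con (ι 3) :* (w :* c :- i) :+ con (ι 3) :* (v :* b :- h) :- (u :* a :- g)) :+ (j :- con (ι 3) :* i :+ con (ι 3) :* h :- g) :- con (ι 3) :* ((v :- u) :* (d :- con (ι 2) :* c :+ b)) :- con (ι 3) :* ((w :- con (ι 2) :* v :+ u) :* (d :- c)) :- (x :- con (ι 3) :* w :+ con (ι 3) :* v :- u) :* d
  := u :* (d :- con (ι 3) :* c :+ con (ι 3) :* b :- a)) refl
  where open ℚSolver

carry₁-identity : ∀ e ε w x c δ₁ δ₂ k → ι 6 * (e + ε) - (ι 6 * e - δ₁) - (- ι 6 * (w * x) - δ₂) - (ι 3 * c - k) - ι 3 * (ι 2 * ε + ι 2 * w * x - c) ≡ δ₁ + δ₂ + k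
carry₁-identity = solve 8 (λ e ε w x c δ₁ δ₂ k →
  con (ι 6) :* (e :+ ε) :- (con (ι 6) :* e :- δ₁) :- (:- con (ι 6) :* (w :* x) :- δ₂) :- (con (ι 3) :* c :- k) :- con (ι 3) :* (con (ι 2) :* ε :+ con (ι 2) :* w :* x :- c)
  := δ₁ :+ δ₂ :+ k) refl
  where open ℚSolver

carry₂-identity : ∀ e ε w x c δ₁ δ₂ k η u g → ι 6 * (e + ε) - (ι 6 * e - δ₁) - (- ι 6 * (w * x) - δ₂) - (ι 3 * c - k) - ι 3 * (ι 2 * w * x + ι 2 * ε - u * u - c)
  - (ι 3 * (g * g) - η) - ι 3 * ((u - g) * (u + g)) ≡ η + δ₁ + δ₂ + k
carry₂-identity = solve 11 (λ e ε w x c δ₁ δ₂ k η u g →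
  con (ι 6) :* (e :+ ε) :- (con (ι 6) :* e :- δ₁) :- (:- con (ι 6) :* (w :* x) :- δ₂) :- (con (ι 3) :* c :- k) :- con (ι 3) :* (con (ι 2) :* w :* x :+ con (ι 2) :* ε :- u :* u :- c) :- (con (ι 3) :* (g :* g) :- η) :- con (ι 3) :* ((u :- g) :* (u :+ g))
  := η :+ δ₁ :+ δ₂ :+ k) refl
  where open ℚSolver

V-+-identity₁ : ∀ a b x y → a * b * (x + y) ≡ b * (a * x) + a * (b * y)
V-+-identity₁ = solve-∀ ℚ-ring

V-+-identity₂ : ∀ a b q x y → b * (q * x) + a * (q * y) ≡ q * (b * x + a * y)
V-+-identity₂ = solve-∀ ℚ-ring

V-*-identity : ∀ a b x y → a * b * (x * y) ≡ (a * x) * (b * y)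
V-*-identity = solve-∀ ℚ-ring

V-π-cancel-identity₂ : ∀ a b x → a * b * x ≡ a * (b * x)
V-π-cancel-identity₂ = solve-∀ ℚ-ring

inverse-mod-identity : ∀ d y → - (1ℚ + y * d) ≡ d * - y - 1ℚ
inverse-mod-identity = solve-∀ ℚ-ring

integer-residue-identity : ∀ r x → x ≡ r + x - r
integer-residue-identity = solve-∀ ℚ-ring

residue-of-fraction-identity : ∀ y d s r → d * y * s - r - y * (d * s - 1ℚ) ≡ y - r
residue-of-fraction-identity = solve-∀ ℚ-ring

residue-test-identity : ∀ d y r → d * (y - r) ≡ d * y - d * r
residue-test-identity = solve-∀ ℚ-ring

residue-unique-≤-identity : ∀ a c → a + c - a ≡ c
residue-unique-≤-identity = solve-∀ ℚ-ring

residue-unique-identity : ∀ a b → - (a - b) ≡ b - a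
residue-unique-identity = solve-∀ ℚ-ring

residue-sound′-identity : ∀ x a b → x - b - (x - a) ≡ a - b
residue-sound′-identity = solve-∀ ℚ-ring

residue-suc-identity : ∀ x r m → (x - (r + m)) + m ≡ x - r
residue-suc-identity = solve-∀ ℚ-ring

residue₁-identity : ∀ d → 0ℚ + 1ℚ * d ≡ d
residue₁-identity = solve-∀ ℚ-ring

digits₂-identity : ∀ x a b q → x - (a + q * 1ℚ * b) ≡ x - a - q * b
digits₂-identity = solve-∀ ℚ-ring

digits₃-identity : ∀ x a b c q → x - ((a + q * 1ℚ * b) + q * (q * 1ℚ) * c) ≡ x - a - q * b - q * q * c
digits₃-identity = solve-∀ ℚ-ring

-- Divisibility in the local ring at p

module Padic (p : ℕ) (p-prime : Prime p) where

  π : ℚ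
  π = ι p

  p∤1 : ¬ p ∣ 1
  p∤1 p∣1 = ℕ.nonTrivial⇒≢1 {{Pr.prime⇒nonTrivial p-prime}} (Div.∣1⇒≡1 p∣1)

  ∤-* : ∀ {m n} → ¬ p ∣ m → ¬ p ∣ n → ¬ p ∣ m ℕ.* n
  ∤-* {m} {n} p∤m p∤n p∣mn with euclidsLemma m n p-prime p∣mn
  ... | inj₁ p∣m = p∤m p∣m
  ... | inj₂ p∣n = p∤n p∣n

  0<n<p⇒p∤n : ∀ {n} → 0 < n → n < p → ¬ p ∣ n
  0<n<p⇒p∤n {suc n} _ n<p p∣n = ℕP.<⇒≱ n<p (Div.∣⇒≤ p∣n)

  p^k∣m*n⇒p^k∣n : ∀ k {m n} → ¬ p ∣ m → p ^ k ∣ m ℕ.* n → p ^ k ∣ n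
  p^k∣m*n⇒p^k∣n zero    p∤m _ = Div.1∣ _
  p^k∣m*n⇒p^k∣n (suc k) {m} {n} p∤m h with euclidsLemma m n p-prime (Div.∣-trans (Div.m∣m*n (p ^ k)) h)
  ... | inj₁ p∣m            = ⊥-elim (p∤m p∣m)
  ... | inj₂ (divides q refl) = subst (p ℕ.* p ^ k ∣_) (ℕP.*-comm p q)
    (Div.*-monoʳ-∣ p (p^k∣m*n⇒p^k∣n k p∤m (Div.*-cancelˡ-∣ p {{Pr.prime⇒nonZero p-prime}} (subst (p ℕ.* p ^ k ∣_) eq h))))
    where
    eq : m ℕ.* (q ℕ.* p) ≡ p ℕ.* (m ℕ.* q)
    eq = trans (sym (ℕP.*-assoc m q p)) (ℕP.*-comm (m ℕ.* q) p)

  -- The p-adic valuation of x is at least k.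
  record V (k : ℕ) (x : ℚ) : Set where
    constructor mkV
    field
      unit     : ℕ
      quotient : ℤ
      p∤unit   : ¬ p ∣ unit
      equality : ι unit * x ≡ π ^ℚ k * ιℤ quotient

  V-resp : ∀ {k x y} → x ≡ y → V k x → V k y
  V-resp refl v = v

  V-ιℤ : ∀ i → V 0 (ιℤ i)
  V-ιℤ i = mkV 1 i p∤1 refl

  V-ι : ∀ n → V 0 (ι n)
  V-ι n = V-ιℤ (ℤ.+ n)

  V-0 : ∀ k → V k 0ℚ
  V-0 k = mkV 1 (ℤ.+ 0) p∤1 (sym (ℚP.*-zeroʳ (π ^ℚ k)))

  V-π^ : ∀ k → V k (π ^ℚ k)
  V-π^ k = mkV 1 (ℤ.+ 1) p∤1 (ℚP.*-comm 1ℚ (π ^ℚ k))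

  V-π : V 1 π
  V-π = V-resp (ℚP.*-identityʳ π) (V-π^ 1)

  V-neg : ∀ {k x} → V k x → V k (- x)
  V-neg {k} {x} (mkV m n u e) = mkV m (ℤ.- n) u (trans (sym (ℚP.neg-distribʳ-* (ι m) x))
    (trans (cong -_ e) (trans (ℚP.neg-distribʳ-* (π ^ℚ k) (ιℤ n)) (cong (π ^ℚ k *_) (sym (ιℤ-neg n))))))

  V-+ : ∀ {k x y} → V k x → V k y → V k (x + y)
  V-+ {k} {x} {y} (mkV m n u e) (mkV m′ n′ u′ e′) = mkV (m ℕ.* m′) ((ℤ.+ m′) ℤ.* n ℤ.+ (ℤ.+ m) ℤ.* n′) (∤-* u u′) (begin
    ι (m ℕ.* m′) * (x + y)                         ≡⟨ cong (_* (x + y)) (ι-* m m′) ⟩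
    ι m * ι m′ * (x + y)                           ≡⟨ V-+-identity₁ (ι m) (ι m′) x y ⟩
    ι m′ * (ι m * x) + ι m * (ι m′ * y)            ≡⟨ cong₂ (λ a b → ι m′ * a + ι m * b) e e′ ⟩
    ι m′ * (π ^ℚ k * ιℤ n) + ι m * (π ^ℚ k * ιℤ n′) ≡⟨ V-+-identity₂ (ι m) (ι m′) (π ^ℚ k) (ιℤ n) (ιℤ n′) ⟩
    π ^ℚ k * (ι m′ * ιℤ n + ι m * ιℤ n′)           ≡⟨ cong (π ^ℚ k *_) (sym (trans (ιℤ-+ ((ℤ.+ m′) ℤ.* n) ((ℤ.+ m) ℤ.* n′)) (cong₂ _+_ (ιℤ-* (ℤ.+ m′) n) (ιℤ-* (ℤ.+ m) n′)))) ⟩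
    π ^ℚ k * ιℤ ((ℤ.+ m′) ℤ.* n ℤ.+ (ℤ.+ m) ℤ.* n′) ∎)
    where
    open ≡-Reasoning

  V-- : ∀ {k x y} → V k x → V k y → V k (x - y)
  V-- v v′ = V-+ v (V-neg v′)

  V-* : ∀ {j k x y} → V j x → V k y → V (j ℕ.+ k) (x * y)
  V-* {j} {k} {x} {y} (mkV m n u e) (mkV m′ n′ u′ e′) = mkV (m ℕ.* m′) (n ℤ.* n′) (∤-* u u′) (begin
    ι (m ℕ.* m′) * (x * y)                  ≡⟨ cong (_* (x * y)) (ι-* m m′) ⟩
    ι m * ι m′ * (x * y)                    ≡⟨ V-*-identity (ι m) (ι m′) x y ⟩
    (ι m * x) * (ι m′ * y)                  ≡⟨ cong₂ _*_ e e′ ⟩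
    (π ^ℚ j * ιℤ n) * (π ^ℚ k * ιℤ n′)      ≡⟨ V-*-identity (π ^ℚ j) (ιℤ n) (π ^ℚ k) (ιℤ n′) ⟩
    (π ^ℚ j * π ^ℚ k) * (ιℤ n * ιℤ n′)      ≡⟨ cong₂ _*_ (sym (^ℚ-+ π j k)) (sym (ιℤ-* n n′)) ⟩
    π ^ℚ (j ℕ.+ k) * ιℤ (n ℤ.* n′)          ∎)
    where
    open ≡-Reasoning

  V-*ˡ : ∀ {k x y} → V 0 x → V k y → V k (x * y)
  V-*ˡ = V-*

  V-*ʳ : ∀ {k x y} → V k x → V 0 y → V k (x * y)
  V-*ʳ {k} {x} {y} v v′ = V-resp (ℚP.*-comm y x) (V-* v′ v)

  V-≤ : ∀ {j k x} → j ≤ k → V k x → V j x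
  V-≤ {j} {k} {x} j≤k (mkV m n u e) = mkV m ((ℤ.+ (p ^ (k ∸ j))) ℤ.* n) u (begin
    ι m * x                                       ≡⟨ e ⟩
    π ^ℚ k * ιℤ n                                 ≡⟨ cong (λ z → π ^ℚ z * ιℤ n) (sym (ℕP.m+[n∸m]≡n j≤k)) ⟩
    π ^ℚ (j ℕ.+ (k ∸ j)) * ιℤ n                   ≡⟨ cong (_* ιℤ n) (^ℚ-+ π j (k ∸ j)) ⟩
    π ^ℚ j * π ^ℚ (k ∸ j) * ιℤ n                  ≡⟨ ℚP.*-assoc (π ^ℚ j) (π ^ℚ (k ∸ j)) (ιℤ n) ⟩
    π ^ℚ j * (π ^ℚ (k ∸ j) * ιℤ n)                ≡⟨ cong (λ z → π ^ℚ j * (z * ιℤ n)) (sym (ι-^ p (k ∸ j))) ⟩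
    π ^ℚ j * (ι (p ^ (k ∸ j)) * ιℤ n)             ≡⟨ cong (π ^ℚ j *_) (sym (ιℤ-* (ℤ.+ (p ^ (k ∸ j))) n)) ⟩
    π ^ℚ j * ιℤ ((ℤ.+ (p ^ (k ∸ j))) ℤ.* n)       ∎)
    where open ≡-Reasoning

  V-unit-cancel : ∀ {k} m {x} → ¬ p ∣ m → V k (ι m * x) → V k x
  V-unit-cancel m {x} p∤m (mkV m′ n u e) = mkV (m′ ℕ.* m) n (∤-* u p∤m)
    (trans (cong (_* x) (ι-* m′ m)) (trans (ℚP.*-assoc (ι m′) (ι m) x) e))

  V-rec : ∀ n → ¬ p ∣ suc n → V 0 (rec n)
  V-rec n u = V-unit-cancel (suc n) u (V-resp (sym (rec-inv n)) (V-ι 1))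

  V-π-cancel : ∀ {k x} → V (suc k) (π * x) → V k x
  V-π-cancel {k} {x} (mkV m n u e) = mkV m n u (π-cancel (trans (rearrange₆ π (ι m) x) (trans e (V-π-cancel-identity₂ π (π ^ℚ k) (ιℤ n)))))
    where
    π-cancel : ∀ {a b} → π * a ≡ π * b → a ≡ b
    π-cancel {a} {b} = aux (Pr.prime⇒nonZero p-prime)
      where
      aux : ∀ {q} → ℕ.NonZero q → ι q * a ≡ ι q * b → a ≡ b
      aux {suc q} _ = ι-cancel q

  V-π^-cancel : ∀ j {k x} → V (j ℕ.+ k) (π ^ℚ j * x) → V k x
  V-π^-cancel zero    {x = x} v = V-resp (ℚP.*-identityˡ x) v
  V-π^-cancel (suc j) {x = x} v = V-π^-cancel j (V-π-cancel (V-resp (ℚP.*-assoc π (π ^ℚ j) x) v))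

  V-^ : ∀ {x} n → V 0 x → V 0 (x ^ℚ n)
  V-^ zero    v = V-ι 1
  V-^ (suc n) v = V-* v (V-^ n v)

  V-^-scale : ∀ {k x} n → V k x → V (n ℕ.* k) (x ^ℚ n)
  V-^-scale zero    v = V-ι 1
  V-^-scale (suc n) v = V-* v (V-^-scale n v)

  V-∑ : ∀ {k} n {f} → (∀ i → i < n → V k (f i)) → V k (∑ n f)
  V-∑ {k} zero v = V-0 k
  V-∑ (suc n) v = V-+ (V-∑ n (λ i i<n → v i (ℕP.m<n⇒m<1+n i<n))) (v n ℕP.≤-refl)

  V-⋆ : ∀ {j k} n {f g} → (∀ i → i ≤ n → V j (f i)) → (∀ i → i ≤ n → V k (g i)) → V (j ℕ.+ k) ((f ⋆ g) n)
  V-⋆ zero    vf vg = V-* (vf 0 z≤n) (vg 0 z≤n)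
  V-⋆ (suc n) vf vg = V-+ (V-* (vf 0 z≤n) (vg (suc n) ℕP.≤-refl))
    (V-⋆ n (λ i i≤n → vf (suc i) (s≤s i≤n)) (λ i i≤n → vg i (ℕP.m≤n⇒m≤1+n i≤n)))

  V-ifact : ∀ n → n < p → V 0 (ifact n)
  V-ifact zero    _   = V-ι 1
  V-ifact (suc n) n<p = V-* (V-rec n (0<n<p⇒p∤n (s≤s z≤n) n<p)) (V-ifact n (ℕP.<-trans (ℕP.n<1+n n) n<p))

  V-∣ : ∀ {n} → p ∣ n → V 1 (ι n)
  V-∣ (divides q refl) = V-resp (sym (ι-* q p)) (V-* (V-ι q) V-π)

  V-ιℤ⇒p^k∣ : ∀ k {i} → V k (ιℤ i) → p ^ k ∣ ℤ.∣ i ∣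
  V-ιℤ⇒p^k∣ k {i} (mkV m n u e) = p^k∣m*n⇒p^k∣n k u (divides ℤ.∣ n ∣
    (trans (sym (ℤP.abs-* (ℤ.+ m) i)) (trans (cong ℤ.∣_∣ mi≡np^k) (ℤP.abs-* n (ℤ.+ (p ^ k))))))
    where
    mi≡np^k : (ℤ.+ m) ℤ.* i ≡ n ℤ.* (ℤ.+ (p ^ k))
    mi≡np^k = trans (ιℤ-injective (begin
      ιℤ ((ℤ.+ m) ℤ.* i)          ≡⟨ ιℤ-* (ℤ.+ m) i ⟩
      ι m * ιℤ i                  ≡⟨ e ⟩
      π ^ℚ k * ιℤ n               ≡⟨ cong (_* ιℤ n) (sym (ι-^ p k)) ⟩
      ι (p ^ k) * ιℤ n            ≡⟨ sym (ιℤ-* (ℤ.+ (p ^ k)) n) ⟩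
      ιℤ ((ℤ.+ (p ^ k)) ℤ.* n)    ∎)) (ℤP.*-comm (ℤ.+ (p ^ k)) n)
      where open ≡-Reasoning

  p^k∣⇒V-ι : ∀ k {n} → p ^ k ∣ n → V k (ι n)
  p^k∣⇒V-ι k (divides q refl) = V-resp (trans (cong (ι q *_) (sym (ι-^ p k))) (sym (ι-* q (p ^ k)))) (V-*ˡ (V-ι q) (V-π^ k))

  p^k∣⇒V-ιℤ : ∀ k i → p ^ k ∣ ℤ.∣ i ∣ → V k (ιℤ i)
  p^k∣⇒V-ιℤ k (ℤ.+ i)  d = p^k∣⇒V-ι k d
  p^k∣⇒V-ιℤ k -[1+ i ] d = V-resp (sym (ιℤ-neg (ℤ.+ suc i))) (V-neg (p^k∣⇒V-ι k d))

  coprime-↥↧ : ∀ x → Coprime ℤ.∣ ↥ x ∣ (↧ₙ x)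
  coprime-↥↧ (mkℚ n d c) = Cop.recompute c

  V-↥ : ∀ k {x} → V k x → p ^ k ∣ ℤ.∣ ↥ x ∣
  V-↥ k {x} v = V-ιℤ⇒p^k∣ k {↥ x} (V-resp (↧*-↥ x) (V-* (V-ι (↧ₙ x)) v))

  -- If p divided the denominator of a p-integral x, it would also divide the numerator, which is
  -- denominator times x, against lowest terms.
  V0⇒p∤↧ : ∀ {x} → V 0 x → ¬ p ∣ ↧ₙ x
  V0⇒p∤↧ {x} v@(mkV m n u e) p∣↧ = p∤1 (subst (p ∣_) (coprime-↥↧ x (p∣↥ , p∣↧)) Div.∣-refl)
    where
    V1-↥ : V 1 (ιℤ (↥ x))
    V1-↥ = V-resp (↧*-↥ x) (V-*ʳ (V-∣ p∣↧) v)
    p∣↥ : p ∣ ℤ.∣ ↥ x ∣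
    p∣↥ = subst (_∣ ℤ.∣ ↥ x ∣) (ℕP.*-identityʳ p) (V-ιℤ⇒p^k∣ 1 {↥ x} V1-↥)

  V1⇒≡modₚ : ∀ {x y} → V 1 (x - y) → x ≡ y [modₚ p ]
  V1⇒≡modₚ {x} {y} v = subst (_∣ ℤ.∣ ↥ (x - y) ∣) (ℕP.*-identityʳ p) (V-↥ 1 v) , V0⇒p∤↧ (V-≤ z≤n v)

  -- Hensel digits

  instance
    p≢0 : ℕ.NonZero p
    p≢0 = Pr.prime⇒nonZero p-prime

  p^≢0 : ∀ k → ℕ.NonZero (p ^ k)
  p^≢0 k = ℕP.m^n≢0 p k

  0<p^ : ∀ k → 0 < p ^ k
  0<p^ k = ℕP.m^n>0 p k

  coprime-p^ : ∀ k {d} → ¬ p ∣ d → Coprime (p ^ k) d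
  coprime-p^ k {d} p∤d {q} (divides t p^k≡tq , divides s d≡sq)
    with p^k∣m*n⇒p^k∣n k {d} {t} p∤d (divides s (trans (cong (ℕ._* t) d≡sq)
           (trans (ℕP.*-assoc s q t) (cong (s ℕ.*_) (trans (ℕP.*-comm q t) (sym p^k≡tq))))))
  ... | divides u t≡up^k = ℕP.m*n≡1⇒n≡1 u q (ℕP.*-cancelʳ-≡ (u ℕ.* q) 1 (p ^ k) {{p^≢0 k}} (begin
      u ℕ.* q ℕ.* p ^ k     ≡⟨ trans (ℕP.*-assoc u q (p ^ k)) (cong (u ℕ.*_) (ℕP.*-comm q (p ^ k))) ⟩
      u ℕ.* (p ^ k ℕ.* q)   ≡⟨ sym (ℕP.*-assoc u (p ^ k) q) ⟩
      u ℕ.* p ^ k ℕ.* q     ≡⟨ cong (ℕ._* q) (sym t≡up^k) ⟩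
      t ℕ.* q               ≡⟨ sym p^k≡tq ⟩
      p ^ k                 ≡⟨ sym (ℕP.*-identityˡ (p ^ k)) ⟩
      1 ℕ.* p ^ k           ∎))
    where open ≡-Reasoning

  p^k-divisor : ∀ k {n m} → n ≡ m ℕ.* p ^ k → V k (ι n)
  p^k-divisor k {n} {m} e = p^k∣⇒V-ι k (divides m e)

  inverse-mod : ∀ k {d} → ¬ p ∣ d → Σ[ s ∈ ℤ ] V k (ι d * ιℤ s - 1ℚ)
  inverse-mod k {d} p∤d with Cop.coprime-Bézout (coprime-p^ k p∤d)
  ... | Bézout.+- x y e = ℤ.- (ℤ.+ y) , V-resp eq (V-neg (p^k-divisor k {x ℕ.* p ^ k} {x} refl))
    where
    open ≡-Reasoning
    eq : - ι (x ℕ.* p ^ k) ≡ ι d * ιℤ (ℤ.- (ℤ.+ y)) - 1ℚ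
    eq = begin
      - ι (x ℕ.* p ^ k)               ≡⟨ cong (λ z → - ι z) (sym e) ⟩
      - ι (1 ℕ.+ y ℕ.* d)             ≡⟨ cong -_ (trans (ι-+ 1 (y ℕ.* d)) (cong (λ z → 1ℚ + z) (ι-* y d))) ⟩
      - (1ℚ + ι y * ι d)              ≡⟨ inverse-mod-identity (ι d) (ι y) ⟩
      ι d * - ι y - 1ℚ                ≡⟨ cong (λ z → ι d * z - 1ℚ) (sym (ιℤ-neg (ℤ.+ y))) ⟩
      ι d * ιℤ (ℤ.- (ℤ.+ y)) - 1ℚ     ∎
  ... | Bézout.-+ x y e = ℤ.+ y , V-resp eq (p^k-divisor k {x ℕ.* p ^ k} {x} refl)
    where
    open ≡-Reasoning
    eq : ι (x ℕ.* p ^ k) ≡ ι d * ι y - 1ℚ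
    eq = begin
      ι (x ℕ.* p ^ k)                 ≡⟨ rearrange₃ (ι (x ℕ.* p ^ k)) ⟩
      1ℚ + ι (x ℕ.* p ^ k) - 1ℚ       ≡⟨ cong (_- 1ℚ) (trans (sym (ι-+ 1 (x ℕ.* p ^ k))) (cong ι e)) ⟩
      ι (y ℕ.* d) - 1ℚ                ≡⟨ cong (_- 1ℚ) (trans (ι-* y d) (ℚP.*-comm (ι y) (ι d))) ⟩
      ι d * ι y - 1ℚ                  ∎

  integer-residue : ∀ k i → Σ[ r ∈ ℕ ] (r < p ^ k) × V k (ιℤ i - ι r)
  integer-residue k i = r , ℤD.n%d<d i (ℤ.+ (p ^ k)) , V-resp eq (V-*ˡ (V-ιℤ q) (p^k-divisor k {p ^ k} {1} (sym (ℕP.*-identityˡ _))))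
    where
    instance
      _ = p^≢0 k
    r = i ℤD.% (ℤ.+ (p ^ k))
    q = i ℤD./ (ℤ.+ (p ^ k))
    open ≡-Reasoning
    eq : ιℤ q * ι (p ^ k) ≡ ιℤ i - ι r
    eq = begin
      ιℤ q * ι (p ^ k)                  ≡⟨ integer-residue-identity (ι r) (ιℤ q * ι (p ^ k)) ⟩
      ι r + ιℤ q * ι (p ^ k) - ι r      ≡⟨ cong (_- ι r) (trans (cong (λ z → ι r + z) (sym (ιℤ-* q (ℤ.+ (p ^ k))))) (sym (ιℤ-+ (ℤ.+ r) (q ℤ.* (ℤ.+ (p ^ k)))))) ⟩
      ιℤ ((ℤ.+ r) ℤ.+ q ℤ.* (ℤ.+ (p ^ k))) - ι r ≡⟨ cong (λ z → ιℤ z - ι r) (sym (ℤD.a≡a%n+[a/n]*n i (ℤ.+ (p ^ k)))) ⟩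
      ιℤ i - ι r                        ∎

  residue-of-fraction : ∀ k y s r → V 0 y → V k (ι (↧ₙ y) * ιℤ s - 1ℚ) → V k (ιℤ (↥ y ℤ.* s) - ι r) → V k (y - ι r)
  residue-of-fraction k y s r v ds≡1 ys≡r = V-resp eq (V-- ys≡r (V-*ˡ v ds≡1))
    where
    d = ι (↧ₙ y)
    eq : ιℤ (↥ y ℤ.* s) - ι r - y * (d * ιℤ s - 1ℚ) ≡ y - ι r
    eq = trans (cong (λ z → z - ι r - y * (d * ιℤ s - 1ℚ)) (trans (ιℤ-* (↥ y) s) (cong (_* ιℤ s) (sym (↧*-↥ y)))))
      (residue-of-fraction-identity y d (ιℤ s) (ι r))

  residue-exists : ∀ k {y} → V 0 y → Σ[ r ∈ ℕ ] (r < p ^ k) × V k (y - ι r)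
  residue-exists k {y} v = proj₁ r , proj₁ (proj₂ r) , residue-of-fraction k y (proj₁ s) (proj₁ r) v (proj₂ s) (proj₂ (proj₂ r))
    where
    s = inverse-mod k (V0⇒p∤↧ v)
    r = integer-residue k (↥ y ℤ.* proj₁ s)

  residue-test : ∀ y r → ι (↧ₙ y) * (y - ι r) ≡ ιℤ (↥ y ℤ.- (ℤ.+ (↧ₙ y)) ℤ.* (ℤ.+ r))
  residue-test y r = begin
    ι (↧ₙ y) * (y - ι r)                          ≡⟨ residue-test-identity (ι (↧ₙ y)) y (ι r) ⟩
    ι (↧ₙ y) * y - ι (↧ₙ y) * ι r                 ≡⟨ cong₂ _-_ (↧*-↥ y) (sym (ιℤ-* (ℤ.+ (↧ₙ y)) (ℤ.+ r))) ⟩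
    ιℤ (↥ y) - ιℤ dr                              ≡⟨ cong (λ z → ιℤ (↥ y) + z) (sym (ιℤ-neg dr)) ⟩
    ιℤ (↥ y) + ιℤ (ℤ.- dr)                        ≡⟨ sym (ιℤ-+ (↥ y) (ℤ.- dr)) ⟩
    ιℤ (↥ y ℤ.- dr)                               ∎
    where
    open ≡-Reasoning
    dr = (ℤ.+ (↧ₙ y)) ℤ.* (ℤ.+ r)

  -- `search` answers 0 when it finds nothing. The witness of `residue-exists`, the numerator times
  -- an inverse of the denominator modulo p^k, excludes this case.
  residue-sound : ∀ k {y} → V 0 y → V k (y - ι (residue p k y)) × residue p k y < p ^ k
  residue-sound k {y} v = V-unit-cancel (↧ₙ y) (V0⇒p∤↧ v) (V-resp (sym (residue-test y s))
            (p^k∣⇒V-ιℤ k (error s) (⌊⌋-sound ((p ^ k) ∣? ℤ.∣ error s ∣) (proj₁ found)))) , proj₂ found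
    where
    s = residue p k y
    error : ℕ → ℤ
    error r = ↥ y ℤ.- (ℤ.+ (↧ₙ y)) ℤ.* (ℤ.+ r)
    test : ℕ → Bool
    test r = ⌊ (p ^ k) ∣? ℤ.∣ error r ∣ ⌋
    hit : ∀ {r} → V k (y - ι r) → test r ≡ true
    hit {r} v-r = ⌊⌋-true ((p ^ k) ∣? ℤ.∣ error r ∣) (V-ιℤ⇒p^k∣ k {error r} (V-resp (residue-test y r) (V-*ˡ (V-ι (↧ₙ y)) v-r)))
    found : test s ≡ true × s < p ^ k
    found = search-sound (p ^ k) test (proj₁ r) (proj₁ (proj₂ r)) (hit (proj₂ (proj₂ r)))
      where r = residue-exists k v

  multiple-<⇒≡0 : ∀ k {c} → c < p ^ k → V k (ι c) → c ≡ 0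
  multiple-<⇒≡0 k {zero}  _ _ = refl
  multiple-<⇒≡0 k {suc c} c<p^k v = ⊥-elim (ℕP.<⇒≱ c<p^k (Div.∣⇒≤ (V-ιℤ⇒p^k∣ k {ℤ.+ suc c} v)))

  residue-unique-≤ : ∀ k {a b} → a ≤ b → b < p ^ k → V k (ι b - ι a) → a ≡ b
  residue-unique-≤ k {a} {b} a≤b b<p^k v = trans (sym (ℕP.+-identityʳ a))
    (trans (cong (a ℕ.+_) (sym (multiple-<⇒≡0 k (ℕP.≤-<-trans (ℕP.m∸n≤m b a) b<p^k) (V-resp eq v)))) (ℕP.m+[n∸m]≡n a≤b))
    where
    eq : ι b - ι a ≡ ι (b ∸ a)
    eq = trans (cong (_- ι a) (trans (cong ι (sym (ℕP.m+[n∸m]≡n a≤b))) (ι-+ a (b ∸ a)))) (residue-unique-≤-identity (ι a) (ι (b ∸ a)))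

  residue-unique : ∀ k {a b} → a < p ^ k → b < p ^ k → V k (ι a - ι b) → a ≡ b
  residue-unique k {a} {b} a<p^k b<p^k v with ℕP.≤-total a b
  ... | inj₁ a≤b = residue-unique-≤ k a≤b b<p^k (V-resp (residue-unique-identity (ι a) (ι b)) (V-neg v))
  ... | inj₂ b≤a = sym (residue-unique-≤ k b≤a a<p^k v)

  residue-sound′ : ∀ k {x r} → V 0 x → r < p ^ k → V k (x - ι r) → residue p k x ≡ r
  residue-sound′ k {x} {r} v r<p^k v-r = residue-unique k (proj₂ (residue-sound k v)) r<p^k
    (V-resp (residue-sound′-identity x (ι (residue p k x)) (ι r)) (V-- v-r (proj₁ (residue-sound k v))))

  divN-/ : ∀ a b .{{_ : ℕ.NonZero b}} → divN a b ≡ a ℕD./ b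
  divN-/ a (suc b) = refl

  -- The very first candidate m = 0 passes the test, so no rescaling takes place and the digits of a
  -- p-integral number are read from its residues.
  denVal-integral : ∀ {x} → V 0 x → denVal p x ≡ 0
  denVal-integral {x} v = cong (λ b → if b then 0 else search-loop (suc (↧ₙ x)) (λ m → not ⌊ (p ^ suc m) ∣? (↧ₙ x) ⌋) (↧ₙ x) 1)
    (not-⌊⌋-true ((p ^ 1) ∣? (↧ₙ x)) (λ p^1∣↧ → V0⇒p∤↧ v (subst (_∣ ↧ₙ x) (ℕP.*-identityʳ p) p^1∣↧)))

  digit-integral : ∀ i {x} → V 0 x → digit p i x ≡ divN (residue p (suc i) x) (p ^ i)
  digit-integral i {x} v = trans
    (cong (λ m → divN (residue p (suc (i ℕ.+ m)) (ι (p ^ m) * x)) (p ^ (i ℕ.+ m))) (denVal-integral v))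
    (cong₂ (λ j y → divN (residue p (suc j) y) (p ^ j)) (ℕP.+-identityʳ i) (ℚP.*-identityˡ x))

  -- Division with remainder of the residue modulo p^(i+1) by p^i: the remainder is the residue
  -- modulo p^i by uniqueness, and the quotient is the digit by definition.
  residue-suc : ∀ i {x} → V 0 x → ι (residue p (suc i) x) ≡ ι (residue p i x) + π ^ℚ i * D p i x
  residue-suc i {x} v = begin
    ι R                                     ≡⟨ cong ι (ℕD.m≡m%n+[m/n]*n R (p ^ i)) ⟩
    ι (R ℕD.% p ^ i ℕ.+ R ℕD./ p ^ i ℕ.* p ^ i) ≡⟨ ι-+ (R ℕD.% p ^ i) (R ℕD./ p ^ i ℕ.* p ^ i) ⟩
    ι (R ℕD.% p ^ i) + ι (R ℕD./ p ^ i ℕ.* p ^ i) ≡⟨ cong₂ _+_ (cong ι (sym low)) (trans (ι-* (R ℕD./ p ^ i) (p ^ i)) (trans (ℚP.*-comm (ι (R ℕD./ p ^ i)) (ι (p ^ i))) (cong₂ _*_ (ι-^ p i) (cong ι (sym dig))))) ⟩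
    ι (residue p i x) + π ^ℚ i * D p i x    ∎
    where
    open ≡-Reasoning
    instance
      _ = p^≢0 i
    R = residue p (suc i) x
    dig : digit p i x ≡ R ℕD./ p ^ i
    dig = trans (digit-integral i v) (divN-/ R (p ^ i))
    low : residue p i x ≡ R ℕD.% p ^ i
    low = residue-sound′ i v (ℕD.m%n<n R (p ^ i)) (V-resp (residue-suc-identity x (ι (R ℕD.% p ^ i)) (ι (R ℕD./ p ^ i ℕ.* p ^ i)))
      (V-+ (subst (λ z → V i (x - z)) (trans (cong ι (ℕD.m≡m%n+[m/n]*n R (p ^ i))) (ι-+ (R ℕD.% p ^ i) (R ℕD./ p ^ i ℕ.* p ^ i)))
              (V-≤ (ℕP.n≤1+n i) (proj₁ (residue-sound (suc i) v))))
           (p^k-divisor i {R ℕD./ p ^ i ℕ.* p ^ i} {R ℕD./ p ^ i} refl)))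

  residue₀ : ∀ {x} → V 0 x → residue p 0 x ≡ 0
  residue₀ v = ℕP.n<1⇒n≡0 (proj₂ (residue-sound 0 v))

  residue₁ : ∀ {x} → V 0 x → ι (residue p 1 x) ≡ D p 0 x
  residue₁ {x} v = trans (residue-suc 0 v) (trans (cong (λ r → ι r + 1ℚ * D p 0 x) (residue₀ v)) (residue₁-identity (D p 0 x)))

  digits₁ : ∀ {x} → V 0 x → V 1 (x - D p 0 x)
  digits₁ {x} v = V-resp (cong (λ z → x - z) (residue₁ v)) (proj₁ (residue-sound 1 v))

  digits₂ : ∀ {x} → V 0 x → V 2 (x - D p 0 x - π * D p 1 x)
  digits₂ {x} v = V-resp (trans (cong (λ z → x - z) (trans (residue-suc 1 v) (cong (λ z → z + π ^ℚ 1 * D p 1 x) (residue₁ v))))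
    (digits₂-identity x (D p 0 x) (D p 1 x) π)) (proj₁ (residue-sound 2 v))

  digits₃ : ∀ {x} → V 0 x → V 3 (x - D p 0 x - π * D p 1 x - π * π * D p 2 x)
  digits₃ {x} v = V-resp (trans (cong (λ z → x - z) (trans (residue-suc 2 v) (cong (λ z → z + π ^ℚ 2 * D p 2 x)
      (trans (residue-suc 1 v) (cong (λ z → z + π ^ℚ 1 * D p 1 x) (residue₁ v))))))
    (digits₃-identity x (D p 0 x) (D p 1 x) (D p 2 x) π)) (proj₁ (residue-sound 3 v))

  V-D : ∀ i x → V 0 (D p i x)
  V-D i x = V-ι (digit p i x)

  D₀-cong : ∀ {x y} → V 0 x → V 0 y → V 1 (x - y) → D p 0 x ≡ D p 0 y
  D₀-cong {x} {y} vx vy v = trans (sym (residue₁ vx)) (trans (cong ι (residue-sound′ 1 vx (proj₂ (residue-sound 1 vy))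
    (V-resp (rearrange₁ x y (ι (residue p 1 y))) (V-+ v (proj₁ (residue-sound 1 vy)))))) (residue₁ vy))

  D₀-zero : ∀ {x} → V 1 x → D p 0 x ≡ 0ℚ
  D₀-zero {x} v = trans (sym (residue₁ (V-≤ z≤n v))) (cong ι (residue-sound′ 1 (V-≤ z≤n v) (0<p^ 1) (V-resp (sym (ℚP.+-identityʳ x)) v)))

  D₁-cong : ∀ {x y} → V 0 x → V 0 y → V 2 (x - y) → D p 1 x ≡ D p 1 y
  D₁-cong {x} {y} vx vy v = cong ι (trans (digit-integral 1 vx) (trans (cong (λ r → divN r (p ^ 1)) residues) (sym (digit-integral 1 vy))))
    where
    residues : residue p 2 x ≡ residue p 2 y
    residues = residue-sound′ 2 vx (proj₂ (residue-sound 2 vy)) (V-resp (rearrange₁ x y (ι (residue p 2 y))) (V-+ v (proj₁ (residue-sound 2 vy))))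

  -- The whole interface to Hensel digits: approximation up to order p³, and equality of the digits
  -- 0 and 1 of numbers congruent modulo p and p².
  record DigitFunction (d : ℕ → ℚ → ℚ) : Set where
    field
      V-d     : ∀ i x → V 0 (d i x)
      d₁      : ∀ {x} → V 0 x → V 1 (x - d 0 x)
      d₂      : ∀ {x} → V 0 x → V 2 (x - d 0 x - π * d 1 x)
      d₃      : ∀ {x} → V 0 x → V 3 (x - d 0 x - π * d 1 x - π * π * d 2 x)
      d₀-cong : ∀ {x y} → V 0 x → V 0 y → V 1 (x - y) → d 0 x ≡ d 0 y
      d₁-cong : ∀ {x y} → V 0 x → V 0 y → V 2 (x - y) → d 1 x ≡ d 1 y
      d₀-zero : ∀ {x} → V 1 x → d 0 x ≡ 0ℚ

  D-digits : DigitFunction (D p)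
  D-digits = record
    { V-d = V-D ; d₁ = digits₁ ; d₂ = digits₂ ; d₃ = digits₃
    ; d₀-cong = D₀-cong ; d₁-cong = D₁-cong ; d₀-zero = D₀-zero }

  -- Integrality of Bernoulli numbers and Faulhaber's formula modulo powers of p

  module Large (11≤p : 11 ≤ p) where

    -- The recurrence expresses `bern (suc n)` through earlier coefficients and inverse factorials
    -- of numbers up to n + 2, all prime to p in this range.
    V-bern-≤ : ∀ n → suc n < p → ∀ i → i ≤ n → V 0 (bern i)
    V-bern-≤ zero    _   zero z≤n = V-ι 1
    V-bern-≤ (suc n) n<p i i≤n = case ℕP.m≤n⇒m<n∨m≡n i≤n of λ where
        (inj₁ (s≤s i≤n′)) → earlier i i≤n′
        (inj₂ refl)       → V-resp last (V-neg (V-⋆ n earlier (λ j j≤n → V-ifact (2 ℕ.+ j) (ℕP.≤-<-trans (s≤s (s≤s j≤n)) n<p))))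
      where
      earlier : ∀ i → i ≤ n → V 0 (bern i)
      earlier = V-bern-≤ n (ℕP.<-trans (ℕP.n<1+n (suc n)) n<p)
      rest = (bern ⋆ (expm1/X ∘ suc)) n
      last : - rest ≡ bern (suc n)
      last = trans (V-bern-≤-identity rest (bern (suc n))) (trans (cong (λ z → bern (suc n) - z) (trans (sym (⋆-last bern expm1/X n)) (bern-inverse (suc n))))
        (ℚP.+-identityʳ (bern (suc n))))

    V-B-small : ∀ n → suc n < p → V 0 (B n)
    V-B-small n n<p = V-resp (B-ifact n) (V-* (V-ι (n !)) (V-bern-≤ n n<p n ℕP.≤-refl))

    V-𝓑-small : ∀ n → suc n < p → V 0 (𝓑 n)
    V-𝓑-small zero    _   = V-0 0
    V-𝓑-small (suc n) n<p = V-* (V-B-small (suc n) n<p) (V-rec n (0<n<p⇒p∤n (s≤s z≤n) (ℕP.<-trans (ℕP.n<1+n (suc n)) n<p)))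

    faulhaber-C : ∀ N k → powerSum k N ≡ ∑ (suc k) (λ j → ι (k C j) * rec j * ι N ^ℚ suc j * B (k ∸ j))
    faulhaber-C N k = begin
      powerSum k N
        ≡⟨ trans (sym (ℚP.*-identityʳ (powerSum k N))) (cong (powerSum k N *_) (sym (fact-ifact k))) ⟩
      powerSum k N * (ι (k !) * ifact k)
        ≡⟨ rearrange₆ (powerSum k N) (ι (k !)) (ifact k) ⟩
      ι (k !) * (powerSum k N * ifact k)
        ≡⟨ cong (ι (k !) *_) (trans (faulhaber N k) (trans (⋆-comm bern EN k) (⋆-∑ EN bern k))) ⟩
      ι (k !) * ∑ (suc k) (λ j → EN j * bern (k ∸ j))
        ≡⟨ sym (∑-* (suc k) (ι (k !)) (λ j → EN j * bern (k ∸ j))) ⟩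
      ∑ (suc k) (λ j → ι (k !) * (EN j * bern (k ∸ j)))
        ≡⟨ ∑-cong (suc k) (λ j j<k → trans (faulhaber-C-identity₂ (ι (k !)) (ι N ^ℚ suc j) (rec j) (ifact j) (B (k ∸ j)) (ifact (k ∸ j)))
             (cong (λ z → z * rec j * ι N ^ℚ suc j * B (k ∸ j)) (sym (C-ifact (ℕP.≤-pred j<k))))) ⟩
      ∑ (suc k) (λ j → ι (k C j) * rec j * ι N ^ℚ suc j * B (k ∸ j)) ∎
      where
      open ≡-Reasoning
      EN : Series
      EN n = ι N ^ℚ suc n * ifact (suc n)

    5+v≤p^1+v : ∀ v → 6 ℕ.+ v ≤ p ^ suc v
    5+v≤p^1+v zero    = ℕP.≤-trans (ℕP.m≤n+m 6 5) (ℕP.≤-trans 11≤p (ℕP.≤-reflexive (sym (ℕP.*-identityʳ p))))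
    5+v≤p^1+v (suc v) = begin
      7 ℕ.+ v            ≤⟨ s≤s (5+v≤p^1+v v) ⟩
      suc (p ^ suc v)    ≤⟨ ℕP.+-monoˡ-≤ (p ^ suc v) (ℕP.m^n>0 p (suc v)) ⟩
      p ^ suc v ℕ.+ p ^ suc v ≡⟨ cong (p ^ suc v ℕ.+_) (sym (ℕP.+-identityʳ (p ^ suc v))) ⟩
      2 ℕ.* p ^ suc v    ≤⟨ ℕP.*-monoˡ-≤ (p ^ suc v) (ℕP.≤-trans (ℕP.m≤n+m 2 9) 11≤p) ⟩
      p ℕ.* p ^ suc v    ∎
      where open ℕP.≤-Reasoning

    factor-p : ∀ n → 0 < n → Σ[ v ∈ ℕ ] Σ[ m ∈ ℕ ] (n ≡ p ^ v ℕ.* m) × ¬ p ∣ m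
    factor-p = <-rec _ λ n ih 0<n → case p ∣? n of λ where
        (no p∤n)                → 0 , n , sym (ℕP.*-identityˡ n) , p∤n
        (yes (divides zero e))    → ⊥-elim (ℕP.<⇒≢ 0<n (sym e))
        (yes (divides q@(suc _) e)) → step n q e (ih (subst (q <_) (sym e) (ℕP.m<m*n q p (ℕP.≤-trans (ℕP.m≤n+m 2 9) 11≤p))) (s≤s z≤n))
      where
      step : ∀ n q → n ≡ q ℕ.* p → Σ[ v ∈ ℕ ] Σ[ m ∈ ℕ ] (q ≡ p ^ v ℕ.* m) × ¬ p ∣ m → Σ[ v ∈ ℕ ] Σ[ m ∈ ℕ ] (n ≡ p ^ v ℕ.* m) × ¬ p ∣ m
      step n q e (v , m , e′ , p∤m) = suc v , m , trans e (trans (ℕP.*-comm q p) (trans (cong (p ℕ.*_) e′) (sym (ℕP.*-assoc p (p ^ v) m)))) , p∤m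

    -- Let p^v be the exact power of p in j + 1. If v ≥ 1, then j + 1 ≥ p^v ≥ v + 5, so p^j / (j +
    -- 1) still contains four powers of p.
    rec-valuation : ∀ j → Σ[ v ∈ ℕ ] V 0 (π ^ℚ v * rec j) × (v ≡ 0 ⊎ v ℕ.+ 4 ≤ j)
    rec-valuation j = let (v , m , e , p∤m) = factor-p (suc j) (s≤s z≤n) in v , integral v m e p∤m , bound v m e p∤m
      where
      integral : ∀ v m → suc j ≡ p ^ v ℕ.* m → ¬ p ∣ m → V 0 (π ^ℚ v * rec j)
      integral v m e p∤m = V-unit-cancel m p∤m (V-resp eq (V-ι 1))
        where
        eq : ι 1 ≡ ι m * (π ^ℚ v * rec j)
        eq = trans (sym (rec-inv j)) (trans (cong (_* rec j) (trans (cong ι e) (trans (ι-* (p ^ v) m) (cong (_* ι m) (ι-^ p v)))))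
          (integral-identity (π ^ℚ v) (ι m) (rec j)))
      bound : ∀ v m → suc j ≡ p ^ v ℕ.* m → ¬ p ∣ m → v ≡ 0 ⊎ v ℕ.+ 4 ≤ j
      bound zero    m       e p∤m = inj₁ refl
      bound (suc v) zero    e p∤m = ⊥-elim (p∤m (p Div.∣0))
      bound (suc v) (suc m) e p∤m = inj₂ (ℕP.≤-pred (begin
        suc (suc v ℕ.+ 4)        ≡⟨ cong (suc ∘ suc) (ℕP.+-comm v 4) ⟩
        6 ℕ.+ v                  ≤⟨ 5+v≤p^1+v v ⟩
        p ^ suc v                ≤⟨ ℕP.m≤m*n (p ^ suc v) (suc m) ⟩
        p ^ suc v ℕ.* suc m      ≡⟨ sym e ⟩
        suc j                    ∎))
        where open ℕP.≤-Reasoning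

    V-π^-rec : ∀ c j → c ≤ 4 → c ≤ j → V c (π ^ℚ j * rec j)
    V-π^-rec c j c≤4 c≤j = V-resp eq (V-≤ c≤j∸v (V-*ʳ (V-π^ (j ∸ v)) (proj₁ (proj₂ (rec-valuation j)))))
      where
      v = proj₁ (rec-valuation j)
      v+c≤j : v ℕ.+ c ≤ j
      v+c≤j = bound (proj₂ (proj₂ (rec-valuation j)))
        where
        bound : v ≡ 0 ⊎ v ℕ.+ 4 ≤ j → v ℕ.+ c ≤ j
        bound (inj₁ e) = subst (λ z → z ℕ.+ c ≤ j) (sym e) c≤j
        bound (inj₂ h) = ℕP.≤-trans (ℕP.+-monoʳ-≤ v c≤4) h
      c≤j∸v : c ≤ j ∸ v
      c≤j∸v = subst (_≤ j ∸ v) (ℕP.m+n∸m≡n v c) (ℕP.∸-monoˡ-≤ v v+c≤j)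
      eq : π ^ℚ (j ∸ v) * (π ^ℚ v * rec j) ≡ π ^ℚ j * rec j
      eq = trans (sym (ℚP.*-assoc (π ^ℚ (j ∸ v)) (π ^ℚ v) (rec j))) (cong (_* rec j)
        (trans (sym (^ℚ-+ π (j ∸ v) v)) (cong (π ^ℚ_) (ℕP.m∸n+n≡m (ℕP.m+n≤o⇒m≤o v v+c≤j)))))

    -- The integrality half of the von Staudt-Clausen theorem, by strong induction on Faulhaber's
    -- formula for N = p: after the leading term p B_k, each term contains the integral factor p^j /
    -- (j + 1) and an earlier p B_(k-j).
    V-πB : ∀ k → V 0 (π * B k)
    V-πB = <-rec _ λ k ih → V-resp (eq k) (V-- (V-∑ p (λ a _ → V-^ k (V-ι a))) (V-∑ k (λ j j<k → V-resp (rearrange₇ (ι (k C suc j)) (rec (suc j)) π (π ^ℚ suc j) (B (k ∸ suc j)))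
        (V-* (V-ι (k C suc j)) (V-* (V-≤ z≤n (V-π^-rec 0 (suc j) z≤n z≤n)) (ih (lower k j j<k)))))))
      where
      lower : ∀ k j → j < k → k ∸ suc j < k
      lower (suc k) j _ = s≤s (ℕP.m∸n≤m k j)
      eq : ∀ k → powerSum k p - ∑ k (λ j → ι (k C suc j) * rec (suc j) * (π * π ^ℚ suc j) * B (k ∸ suc j)) ≡ π * B k
      eq k = trans (cong (_- s) (trans (faulhaber-C p k) (trans (∑-head k (λ j → ι (k C j) * rec j * π ^ℚ suc j * B (k ∸ j)))
        (cong (λ c → ι c * 1ℚ * (π * 1ℚ) * B k + s) (nC0≡1 k))))) (V-πB-identity′ π (B k) s)
        where
        s = ∑ k (λ j → ι (k C suc j) * rec (suc j) * (π * π ^ℚ suc j) * B (k ∸ suc j))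

    -- From j = 4 on, the factor p^j / (j + 1) supplies p⁴ and the remaining p makes the Bernoulli
    -- number integral.
    powerSum-mod-p⁴ : ∀ m → let k = 3 ℕ.+ m in
      V 4 (powerSum k p - ∑ 4 (λ j → ι (k C j) * rec j * π ^ℚ suc j * B (k ∸ j)))
    powerSum-mod-p⁴ m = V-resp eq (V-∑ m (λ i _ → V-resp (rearrange₇ (ι (k C (4 ℕ.+ i))) (rec (4 ℕ.+ i)) π (π ^ℚ (4 ℕ.+ i)) (B (k ∸ (4 ℕ.+ i))))
        (V-*ˡ (V-ι (k C (4 ℕ.+ i))) (V-*ʳ (V-π^-rec 4 (4 ℕ.+ i) ℕP.≤-refl (ℕP.m≤m+n 4 i)) (V-πB (k ∸ (4 ℕ.+ i)))))))
      where
      k = 3 ℕ.+ m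
      f : ℕ → ℚ
      f j = ι (k C j) * rec j * π ^ℚ suc j * B (k ∸ j)
      eq : ∑ m (λ i → f (4 ℕ.+ i)) ≡ powerSum k p - ∑ 4 f
      eq = trans (powerSum-mod-p⁴-identity′ (∑ m (λ i → f (4 ℕ.+ i))) (∑ 4 f)) (cong (_- ∑ 4 f) (trans (sym (∑-split 4 m f)) (sym (faulhaber-C p k))))

    -- With N = p³ the power N^(j+1) splits into p · p^j · p^(2j+2): the first factor absorbs the
    -- denominator of the Bernoulli number, the second that of 1 / (j + 1), and the third is at
    -- least p⁶ for j ≥ 2. The hypothesis removes the term j = 1.
    powerSum-p³ : ∀ m → B (suc m) ≡ 0ℚ → V 6 (powerSum (2 ℕ.+ m) (p ^ 3) - π ^ℚ 3 * B (2 ℕ.+ m))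
    powerSum-p³ m B≡0 = V-resp eq (V-∑ (suc m) (λ i _ → V-resp (term i) (V-≤ (ℕP.m≤m+n 6 (i ℕ.+ i))
        (V-*ˡ (V-ι (k C (2 ℕ.+ i))) (V-*ˡ (V-π^-rec 0 (2 ℕ.+ i) z≤n z≤n) (V-*ˡ (V-πB (k ∸ (2 ℕ.+ i))) (V-π^ (6 ℕ.+ (i ℕ.+ i)))))))))
      where
      open ≡-Reasoning
      k = 2 ℕ.+ m
      f : ℕ → ℚ
      f j = ι (k C j) * rec j * ι (p ^ 3) ^ℚ suc j * B (k ∸ j)
      exponent : ∀ i → 1 ℕ.+ (2 ℕ.+ i) ℕ.+ (6 ℕ.+ (i ℕ.+ i)) ≡ (3 ℕ.+ i) ℕ.* 3
      exponent = let open ℕSolver.+-*-Solver in solve 1 (λ i → con 1 :+ (con 2 :+ i) :+ (con 6 :+ (i :+ i)) := (con 3 :+ i) :* con 3) refl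
      term : ∀ i → ι (k C (2 ℕ.+ i)) * ((π ^ℚ (2 ℕ.+ i) * rec (2 ℕ.+ i)) * ((π * B (k ∸ (2 ℕ.+ i))) * π ^ℚ (6 ℕ.+ (i ℕ.+ i)))) ≡ f (2 ℕ.+ i)
      term i = trans (powerSum-p³-identity (ι (k C (2 ℕ.+ i))) (rec (2 ℕ.+ i)) π (π ^ℚ (2 ℕ.+ i)) (π ^ℚ (6 ℕ.+ (i ℕ.+ i))) (B (k ∸ (2 ℕ.+ i))))
        (cong (λ z → ι (k C (2 ℕ.+ i)) * rec (2 ℕ.+ i) * z * B (k ∸ (2 ℕ.+ i)))
          (trans (sym (^ℚ-+ π (1 ℕ.+ (2 ℕ.+ i)) (6 ℕ.+ (i ℕ.+ i)))) (trans (cong (π ^ℚ_) (exponent i))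
            (trans (^ℚ-* π (3 ℕ.+ i) 3) (cong (_^ℚ (3 ℕ.+ i)) (sym (ι-^ p 3)))))))
      rest = ∑ (suc m) (λ i → f (2 ℕ.+ i))
      f₀ : f 0 ≡ 1ℚ * 1ℚ * (π ^ℚ 3 * 1ℚ) * B k
      f₀ = cong₂ (λ c n → ι c * 1ℚ * (n * 1ℚ) * B k) (nC0≡1 k) (ι-^ p 3)
      f₁ : f 1 ≡ 0ℚ
      f₁ = trans (cong ((ι (k C 1) * rec 1 * ι (p ^ 3) ^ℚ 2) *_) B≡0) (ℚP.*-zeroʳ (ι (k C 1) * rec 1 * ι (p ^ 3) ^ℚ 2))
      eq : rest ≡ powerSum k (p ^ 3) - π ^ℚ 3 * B k
      eq = sym (begin
        powerSum k (p ^ 3) - π ^ℚ 3 * B k                    ≡⟨ cong (_- π ^ℚ 3 * B k) (trans (faulhaber-C (p ^ 3) k) (∑-split 2 (suc m) f)) ⟩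
        (0ℚ + f 0 + f 1) + rest - π ^ℚ 3 * B k               ≡⟨ cong₂ (λ a b → (0ℚ + a + b) + rest - π ^ℚ 3 * B k) f₀ f₁ ⟩
        (0ℚ + 1ℚ * 1ℚ * (π ^ℚ 3 * 1ℚ) * B k + 0ℚ) + rest - π ^ℚ 3 * B k ≡⟨ powerSum-p³-identity′ rest (π ^ℚ 3) (B k) ⟩
        rest                                                 ∎)

    binomial : ∀ c d n → (c + d) ^ℚ n ≡ ∑ (suc n) (λ k → ι (n C k) * (c ^ℚ k * d ^ℚ (n ∸ k)))
    binomial c d n = begin
      (c + d) ^ℚ n
        ≡⟨ trans (sym (ℚP.*-identityʳ ((c + d) ^ℚ n))) (cong ((c + d) ^ℚ n *_) (sym (fact-ifact n))) ⟩
      (c + d) ^ℚ n * (ι (n !) * ifact n)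
        ≡⟨ rearrange₆ ((c + d) ^ℚ n) (ι (n !)) (ifact n) ⟩
      ι (n !) * exp (c + d) n
        ≡⟨ cong (ι (n !) *_) (trans (sym (exp-⋆ c d n)) (⋆-∑ (exp c) (exp d) n)) ⟩
      ι (n !) * ∑ (suc n) (λ k → exp c k * exp d (n ∸ k))
        ≡⟨ sym (∑-* (suc n) (ι (n !)) (λ k → exp c k * exp d (n ∸ k))) ⟩
      ∑ (suc n) (λ k → ι (n !) * (exp c k * exp d (n ∸ k)))
        ≡⟨ ∑-cong (suc n) (λ k k<n → trans (binomial-identity₂ (ι (n !)) (c ^ℚ k) (ifact k) (d ^ℚ (n ∸ k)) (ifact (n ∸ k)))
             (cong (_* (c ^ℚ k * d ^ℚ (n ∸ k))) (sym (C-ifact (ℕP.≤-pred k<n))))) ⟩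
      ∑ (suc n) (λ k → ι (n C k) * (c ^ℚ k * d ^ℚ (n ∸ k))) ∎
      where
      open ≡-Reasoning

    -- Fermat's little theorem

    module _ (q : ℕ) (p≡1+q : p ≡ suc q) where

      p∣pCk : ∀ k → k < q → V 1 (ι (p C suc k))
      p∣pCk k k<q = V-resp (sym (C-ifact (ℕP.<⇒≤ k<p))) (V-*ʳ (V-∣ p∣p!) (V-* (V-ifact (suc k) k<p) (V-ifact (p ∸ suc k) p∸<p)))
        where
        k<p : suc k < p
        k<p = subst (suc k <_) (sym p≡1+q) (s≤s k<q)
        p∣p! : p ∣ p !
        p∣p! = subst (λ z → z ∣ z !) (sym p≡1+q) (Div.m∣m*n (q !))
        p∸<p : p ∸ suc k < p
        p∸<p = subst (λ z → z ∸ suc k < z) (sym p≡1+q) (s≤s (ℕP.m∸n≤m q k))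

      fermat : ∀ a → V 1 (ι a ^ℚ p - ι a)
      fermat zero    = V-resp (sym (trans (cong (λ z → 0ℚ ^ℚ z - 0ℚ) p≡1+q) (cong (_- 0ℚ) (0^ℚ q)))) (V-0 1)
      fermat (suc a) = V-resp eq (V-+ (fermat a) (V-∑ q (λ k k<q → V-*ʳ (p∣pCk k k<q) (V-* (V-^ (suc k) (V-ι a)) (V-^ (p ∸ suc k) (V-ι 1))))))
        where
        open ≡-Reasoning
        f : ℕ → ℚ
        f k = ι (p C k) * (ι a ^ℚ k * 1ℚ ^ℚ (p ∸ k))
        mid = ∑ q (f ∘ suc)
        f₀ : f 0 ≡ 1ℚ
        f₀ = cong₂ (λ c d → ι c * (1ℚ * d)) (nC0≡1 p) (1^ℚ p)
        fp : f p ≡ ι a ^ℚ p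
        fp = trans (cong₂ (λ c d → ι c * (ι a ^ℚ p * 1ℚ ^ℚ d)) (ℕC.nCn≡1 p) (ℕP.n∸n≡0 p)) (fp-identity₀ (ι a ^ℚ p))
        eq : ι a ^ℚ p - ι a + mid ≡ ι (suc a) ^ℚ p - ι (suc a)
        eq = begin
          ι a ^ℚ p - ι a + mid                        ≡⟨ fermat-identity (ι a ^ℚ p) (ι a) mid ⟩
          (1ℚ + (mid + ι a ^ℚ p)) - (1ℚ + ι a)        ≡⟨ cong₂ (λ x y → (x + (mid + y)) - (1ℚ + ι a)) (sym f₀) (sym fp) ⟩
          (f 0 + (mid + f p)) - (1ℚ + ι a)            ≡⟨ cong₂ _-_ (cong (λ z → f 0 + (mid + f z)) p≡1+q) (sym (ι-suc a)) ⟩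
          (f 0 + ∑ (suc q) (f ∘ suc)) - ι (suc a)     ≡⟨ cong (_- ι (suc a)) (sym (∑-head (suc q) f)) ⟩
          ∑ (suc (suc q)) f - ι (suc a)               ≡⟨ cong (λ z → ∑ (suc z) f - ι (suc a)) (sym p≡1+q) ⟩
          ∑ (suc p) f - ι (suc a)                     ≡⟨ cong (_- ι (suc a)) (sym (binomial (ι a) 1ℚ p)) ⟩
          (ι a + 1ℚ) ^ℚ p - ι (suc a)                 ≡⟨ cong (λ z → z ^ℚ p - ι (suc a)) (trans (ℚP.+-comm (ι a) 1ℚ) (sym (ι-suc a))) ⟩
          ι (suc a) ^ℚ p - ι (suc a)                  ∎

      fermat′ : ∀ a → ¬ p ∣ a → V 1 (ι a ^ℚ q - 1ℚ)
      fermat′ a p∤a = V-unit-cancel a p∤a (V-resp (trans (cong (λ z → ι a ^ℚ z - ι a) p≡1+q) (fermat′-identity (ι a) (ι a ^ℚ q))) (fermat a))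

    -- Kummer congruences

    p-odd : Σ[ q ∈ ℕ ] p ≡ suc (2 ℕ.* q)
    p-odd with parity p
    ... | inj₂ odd     = odd
    ... | inj₁ (h , e) with Pr.prime⇒irreducible p-prime {2} (divides h (trans e (ℕP.*-comm 2 h)))
    ...   | inj₁ ()
    ...   | inj₂ 2≡p = ⊥-elim (ℕP.<⇒≱ 11≤p (subst (_≤ 10) 2≡p (ℕP.m≤m+n 2 8)))

    V-shift-^ : ∀ {c N} k → V 0 c → V 3 N → V 6 ((c + N) ^ℚ suc k - c ^ℚ suc k - ι (suc k) * N * c ^ℚ k)
    V-shift-^ {c} {N} zero    vc vN = V-resp (V-shift-^-identity c N) (V-0 6)
    V-shift-^ {c} {N} (suc k) vc vN = V-resp (trans (V-shift-^-identity′ c N (c ^ℚ k) ((c + N) ^ℚ suc k) (ι (suc k)))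
        (cong (λ z → (c + N) ^ℚ suc (suc k) - c ^ℚ suc (suc k) - z * N * c ^ℚ suc k) (sym (ι-suc (suc k)))))
      (V-+ (V-*ˡ (V-+ vc (V-≤ z≤n vN)) (V-shift-^ k vc vN)) (V-*ʳ (V-* vN vN) (V-* (V-ι (suc k)) (V-^ k vc))))

    module _ (h : ℕ) (p³≡ : p ^ 3 ≡ suc (2 ℕ.* h)) where

      oddPowerSum : ℕ → ℚ
      oddPowerSum e = ∑ h (λ a → ι (suc (2 ℕ.* a)) ^ℚ e)

      -- The power sum is approximated by N B_k and (c + N)^k by its linear part in N, both with
      -- errors of order p⁶ for N = p³. Cancelling N and the unit k leaves order p³, the accuracy
      -- that third differences require.
      voronoi : ∀ m → let k = 2 ℕ.+ m in B (suc m) ≡ 0ℚ → ¬ p ∣ k → V 3 ((ι 2 ^ℚ k - 1ℚ) * 𝓑 k - oddPowerSum (suc m))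
      voronoi m B≡0 p∤k = V-unit-cancel k p∤k (V-π^-cancel 3 (V-resp eq
        (V-+ (V-*ˡ (V-- (V-^ k (V-ι 2)) (V-ι 1)) (V-neg (powerSum-p³ m B≡0))) V-error)))
        where
        k = 2 ℕ.+ m
        N = ι (p ^ 3)
        S = powerSum k (p ^ 3)
        Γ = oddPowerSum (suc m)
        vN : V 3 N
        vN = V-resp (sym (ι-^ p 3)) (V-π^ 3)
        Err : ℚ
        Err = ∑ h (λ a → (ι (suc (2 ℕ.* a)) + N) ^ℚ k) - ∑ h (λ a → ι (suc (2 ℕ.* a)) ^ℚ k) - ι k * N * Γ
        ∑-combine : ∀ n (f g e : ℕ → ℚ) c → ∑ n (λ a → f a - g a - c * e a) ≡ ∑ n f - ∑ n g - c * ∑ n e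
        ∑-combine zero    f g e c = sym (trans (cong (λ z → 0ℚ - 0ℚ - z) (ℚP.*-zeroʳ c)) refl)
        ∑-combine (suc n) f g e c = trans (cong (_+ (f n - g n - c * e n)) (∑-combine n f g e c)) (∑-combine-identity (∑ n f) (∑ n g) (∑ n e) (f n) (g n) (e n) c)
        V-Err : V 6 Err
        V-Err = V-resp (∑-combine h (λ a → (ι (suc (2 ℕ.* a)) + N) ^ℚ k) (λ a → ι (suc (2 ℕ.* a)) ^ℚ k) (λ a → ι (suc (2 ℕ.* a)) ^ℚ suc m) (ι k * N))
          (V-∑ h (λ a _ → V-shift-^ (suc m) (V-ι (suc (2 ℕ.* a))) vN))
        doubling : S - ι 2 ^ℚ k * S ≡ ∑ h (λ a → ι (suc (2 ℕ.* a)) ^ℚ k) - ∑ h (λ a → (ι (suc (2 ℕ.* a)) + N) ^ℚ k)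
        doubling = subst (λ M → powerSum k M - ι 2 ^ℚ k * powerSum k M ≡ ∑ h (λ a → ι (suc (2 ℕ.* a)) ^ℚ k) - ∑ h (λ a → (ι (suc (2 ℕ.* a)) + ι M) ^ℚ k))
          (sym p³≡) (powerSum-doubling h k)
        V-error : V 6 ((ι 2 ^ℚ k - 1ℚ) * S - ι k * N * Γ)
        V-error = V-resp (trans (V-error-identity-a (∑ h (λ a → (ι (suc (2 ℕ.* a)) + N) ^ℚ k)) (∑ h (λ a → ι (suc (2 ℕ.* a)) ^ℚ k)) (ι k * N * Γ))
            (trans (cong (λ z → - z - ι k * N * Γ) (sym doubling)) (V-error-identity-b S (ι 2 ^ℚ k) (ι k * N * Γ)))) V-Err
        eq : (ι 2 ^ℚ k - 1ℚ) * - (S - π ^ℚ 3 * B k) + ((ι 2 ^ℚ k - 1ℚ) * S - ι k * N * Γ) ≡ π ^ℚ 3 * (ι k * ((ι 2 ^ℚ k - 1ℚ) * 𝓑 k - Γ))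
        eq = trans (cong₂ (λ b n → (ι 2 ^ℚ k - 1ℚ) * - (S - π ^ℚ 3 * b) + ((ι 2 ^ℚ k - 1ℚ) * S - ι k * n * Γ)) (𝓑-B (suc m)) (ι-^ p 3))
          (voronoi-identity (ι 2 ^ℚ k) S (π ^ℚ 3) (𝓑 k) (ι k) Γ)

    -- The first three finite differences are as divisible by p as those of an analytic function of i.
    record Smooth (f : ℕ → ℚ) : Set where
      field
        V-Δ⁰ : ∀ i → V 0 (f i)
        V-Δ¹ : ∀ i → V 1 (f (1 ℕ.+ i) - f i)
        V-Δ² : ∀ i → V 2 (f (2 ℕ.+ i) - ι 2 * f (1 ℕ.+ i) + f i)
        V-Δ³ : ∀ i → V 3 (f (3 ℕ.+ i) - ι 3 * f (2 ℕ.+ i) + ι 3 * f (1 ℕ.+ i) - f i)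

    open Smooth

    -- The s-th difference of c t^i is c (t - 1)^s t^i. The hypothesis concerns the product because
    -- for bases divisible by p the powers of p come from c and not from t - 1.
    Smooth-geometric : ∀ {c t} → V 0 t → (∀ s → s ≤ 3 → V s (c * (t - 1ℚ) ^ℚ s)) → Smooth (λ i → c * t ^ℚ i)
    Smooth-geometric {c} {t} vt v = record
      { V-Δ⁰ = λ i → V-resp (Smooth-geometric-identity₀ c (t ^ℚ i)) (V-*ʳ (v 0 z≤n) (V-^ i vt))
      ; V-Δ¹ = λ i → V-resp (Smooth-geometric-identity₁ c t (t ^ℚ i)) (V-*ʳ (v 1 (s≤s z≤n)) (V-^ i vt))
      ; V-Δ² = λ i → V-resp (Smooth-geometric-identity₂ c t (t ^ℚ i)) (V-*ʳ (v 2 (s≤s (s≤s z≤n))) (V-^ i vt))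
      ; V-Δ³ = λ i → V-resp (Smooth-geometric-identity₃ c t (t ^ℚ i)) (V-*ʳ (v 3 ℕP.≤-refl) (V-^ i vt))
      }

    Smooth-∑ : ∀ n {f : ℕ → ℕ → ℚ} → (∀ a → a < n → Smooth (f a)) → Smooth (λ i → ∑ n (λ a → f a i))
    Smooth-∑ zero    v = record { V-Δ⁰ = λ i → V-0 0 ; V-Δ¹ = λ i → V-0 1 ; V-Δ² = λ i → V-0 2 ; V-Δ³ = λ i → V-0 3 }
    Smooth-∑ (suc n) {f} v = record
      { V-Δ⁰ = λ i → V-+ (V-Δ⁰ s i) (V-Δ⁰ t i)
      ; V-Δ¹ = λ i → V-resp (Smooth-∑-identity₁ (F (1 ℕ.+ i)) (F i) (f n (1 ℕ.+ i)) (f n i)) (V-+ (V-Δ¹ s i) (V-Δ¹ t i))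
      ; V-Δ² = λ i → V-resp (Smooth-∑-identity₂ (F (2 ℕ.+ i)) (F (1 ℕ.+ i)) (F i) (f n (2 ℕ.+ i)) (f n (1 ℕ.+ i)) (f n i)) (V-+ (V-Δ² s i) (V-Δ² t i))
      ; V-Δ³ = λ i → V-resp (Smooth-∑-identity₃ (F (3 ℕ.+ i)) (F (2 ℕ.+ i)) (F (1 ℕ.+ i)) (F i) (f n (3 ℕ.+ i)) (f n (2 ℕ.+ i)) (f n (1 ℕ.+ i)) (f n i)) (V-+ (V-Δ³ s i) (V-Δ³ t i))
      }
      where
      F : ℕ → ℚ
      F i = ∑ n (λ a → f a i)
      s = Smooth-∑ n {f} (λ a a<n → v a (ℕP.m<n⇒m<1+n a<n))
      t = v n ℕP.≤-refl

    Smooth-pred : ∀ {f} → Smooth f → Smooth (λ i → f i - 1ℚ)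
    Smooth-pred {f} s = record
      { V-Δ⁰ = λ i → V-- (V-Δ⁰ s i) (V-ι 1)
      ; V-Δ¹ = λ i → V-resp (Smooth-pred-identity₁ (f (1 ℕ.+ i)) (f i)) (V-Δ¹ s i)
      ; V-Δ² = λ i → V-resp (Smooth-pred-identity₂ (f (2 ℕ.+ i)) (f (1 ℕ.+ i)) (f i)) (V-Δ² s i)
      ; V-Δ³ = λ i → V-resp (Smooth-pred-identity₃ (f (3 ℕ.+ i)) (f (2 ℕ.+ i)) (f (1 ℕ.+ i)) (f i)) (V-Δ³ s i)
      }

    Smooth-≗ : ∀ {f g : ℕ → ℚ} → f ≗ g → Smooth f → Smooth g
    Smooth-≗ e s = record
      { V-Δ⁰ = λ i → V-resp (e i) (V-Δ⁰ s i)
      ; V-Δ¹ = λ i → V-resp (cong₂ _-_ (e (1 ℕ.+ i)) (e i)) (V-Δ¹ s i)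
      ; V-Δ² = λ i → V-resp (cong₂ _+_ (cong₂ (λ a b → a - ι 2 * b) (e (2 ℕ.+ i)) (e (1 ℕ.+ i))) (e i)) (V-Δ² s i)
      ; V-Δ³ = λ i → V-resp (cong₂ _-_ (cong₂ _+_ (cong₂ (λ a b → a - ι 3 * b) (e (3 ℕ.+ i)) (e (2 ℕ.+ i))) (cong (ι 3 *_) (e (1 ℕ.+ i)))) (e i)) (V-Δ³ s i)
      }

    -- The range stops at 3 because `voronoi` divides by the index, and the index `K e i` is prime
    -- to p when r + i + 1 is.
    record SmoothUpTo3 (β : ℕ → ℚ) : Set where
      field
        integral : ∀ i → i ≤ 3 → V 0 (β i)
        β₁-β₀ : V 1 (β 1 - β 0)
        β₂-β₁ : V 1 (β 2 - β 1)
        β₃-β₂ : V 1 (β 3 - β 2)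
        Δ²β₀  : V 2 (β 2 - ι 2 * β 1 + β 0)
        Δ²β₁  : V 2 (β 3 - ι 2 * β 2 + β 1)
        Δ³β₀  : V 3 (β 3 - ι 3 * β 2 + ι 3 * β 1 - β 0)

    -- The Leibniz rule for finite differences: Δ³(u β) is u Δ³β plus products of Δ^a u with Δ^b of
    -- a shifted β, where a + b = 3 and a ≥ 1. Those are of order p³ by the lower differences of β,
    -- and u can be cancelled.
    smooth-quotient : ∀ {u g β : ℕ → ℚ} → Smooth u → Smooth g → (∀ i {k x} → V k (u i * x) → V k x) →
                      (∀ i → i ≤ 3 → V 3 (u i * β i - g i)) → SmoothUpTo3 β
    smooth-quotient {u} {g} {β} su sg cancel e = record
      { integral = int ; β₁-β₀ = d¹ 0 z<3 ; β₂-β₁ = d¹ 1 1<3 ; β₃-β₂ = d¹ 2 ℕP.≤-refl ; Δ²β₀ = d² 0 (s≤s (s≤s z≤n)) ; Δ²β₁ = d² 1 ℕP.≤-refl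
      ; Δ³β₀ = cancel 0 (V-resp (smooth-quotient-identity₃ (β 0) (β 1) (β 2) (β 3) (u 0) (u 1) (u 2) (u 3) (g 0) (g 1) (g 2) (g 3))
          (V-- (V-- (V-- (V-+ (V-- (V-+ (V-- (e 3 ℕP.≤-refl) (V-*ˡ (V-ι 3) (e 2 (ℕP.m≤m+n 2 1)))) (V-*ˡ (V-ι 3) (e 1 (ℕP.m≤m+n 1 2)))) (e 0 z≤n))
            (V-Δ³ sg 0))
            (V-*ˡ (V-ι 3) (V-* (V-Δ¹ su 0) (d² 1 ℕP.≤-refl))))
            (V-*ˡ (V-ι 3) (V-* (V-Δ² su 0) (d¹ 2 ℕP.≤-refl))))
            (V-*ʳ (V-Δ³ su 0) (int 3 ℕP.≤-refl))))
      }
      where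
      z<3 : 1 ≤ 3
      z<3 = s≤s z≤n
      1<3 : 2 ≤ 3
      1<3 = s≤s (s≤s z≤n)
      int : ∀ i → i ≤ 3 → V 0 (β i)
      int i i≤3 = cancel i (V-resp (int-identity (u i * β i) (g i)) (V-+ (V-≤ z≤n (e i i≤3)) (V-Δ⁰ sg i)))
      d¹ : ∀ i → suc i ≤ 3 → V 1 (β (suc i) - β i)
      d¹ i i<3 = cancel i (V-resp (d¹-identity (β i) (β (suc i)) (u i) (u (suc i)) (g i) (g (suc i)))
        (V-- (V-+ (V-≤ (s≤s z≤n) (V-- (e (suc i) i<3) (e i (ℕP.<⇒≤ i<3)))) (V-Δ¹ sg i)) (V-*ʳ (V-Δ¹ su i) (int (suc i) i<3))))
      d² : ∀ i → 2 ℕ.+ i ≤ 3 → V 2 (β (2 ℕ.+ i) - ι 2 * β (1 ℕ.+ i) + β i)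
      d² i i<3 = cancel i (V-resp (d²-identity (β i) (β (1 ℕ.+ i)) (β (2 ℕ.+ i)) (u i) (u (1 ℕ.+ i)) (u (2 ℕ.+ i)) (g i) (g (1 ℕ.+ i)) (g (2 ℕ.+ i)))
        (V-- (V-- (V-+ (V-≤ (s≤s (s≤s z≤n)) (V-+ (V-- (e (2 ℕ.+ i) i<3) (V-*ˡ (V-ι 2) (e (1 ℕ.+ i) (ℕP.<⇒≤ i<3)))) (e i (ℕP.<⇒≤ (ℕP.<⇒≤ i<3))))) (V-Δ² sg i))
          (V-*ˡ (V-ι 2) (V-* (V-Δ¹ su i) (d¹ (suc i) i<3)))) (V-*ʳ (V-Δ² su i) (int (2 ℕ.+ i) i<3))))

    -- Digits of linear combinations

    private
      p∤ : ∀ n {n>0 : 0 < n} → n ≤ 10 → ¬ p ∣ n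
      p∤ n {n>0} n≤10 = 0<n<p⇒p∤n n>0 (ℕP.≤-trans (s≤s n≤10) 11≤p)

      p∤12 : ¬ p ∣ 12
      p∤12 = ∤-* {2} {6} (p∤ 2 {s≤s z≤n} (ℕP.m≤m+n 2 8)) (p∤ 6 {s≤s z≤n} (ℕP.m≤m+n 6 4))

      p∤4 : ¬ p ∣ 4
      p∤4 = p∤ 4 {s≤s z≤n} (ℕP.m≤m+n 4 6)

    -- Each hypothesis replaces a quantity by its digits. At order p there remains δ₁ + δ₂ + k₀,
    -- whose units digit is 0, so that only its carry L₁ passes to order p², the order of T.
    combine₁ : ∀ {T γ c₀ c₁ b x y z s e δ₁ δ₁′ δ₂ m₁ k₀ k₁ a₀ a₁ w w₀ w₁ L₁} →
      V 0 x → V 0 y → V 0 w₀ → V 0 w₁ →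
      V 3 (ι 4 * (π * π) * T - ι 12 * π * γ + ι 11 * (π * π) * b - ι 24 * (z - ι 3 * y + ι 2 * x) - ι 24 * π * w * (y - ι 2 * x)) →
      V 2 (γ - c₀ - π * c₁) → V 3 (z - ι 3 * y + ι 2 * x - 0ℚ - π * e - π * π * s) → V 2 (w - w₀ - π * w₁) →
      V 2 (ι 6 * (y - ι 2 * x) - a₀ - π * a₁) → V 1 (ι 6 * (y - ι 2 * x) - a₀) → V 2 (ι 6 * e - δ₁ - π * δ₁′) →
      V 2 (w₀ * a₀ - δ₂ - π * m₁) → V 2 (ι 3 * c₀ - k₀ - π * k₁) → V 2 (δ₁ + δ₂ + k₀ - 0ℚ - π * L₁) →
      V 1 (T - (ι 3 * c₁ - ((ℤ.+ 11) / 4) * b + ι 6 * s + δ₁′ + k₁ + w₁ * a₀ + w₀ * a₁ + m₁ + L₁))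
    combine₁ {T} {γ} {c₀} {c₁} {b} {x} {y} {z} {s} {e} {δ₁} {δ₁′} {δ₂} {m₁} {k₀} {k₁} {a₀} {a₁} {w} {w₀} {w₁} {L₁} vx vy vw₀ vw₁ vM vγ vZ vw va v₁a vδ₁ vδ₂ vk vL =
      V-unit-cancel 4 p∤4 (V-π^-cancel 2 (V-resp (combine₁-identity π T γ c₀ c₁ b x y z s e δ₁ δ₁′ δ₂ m₁ k₀ k₁ a₀ a₁ w w₀ w₁ L₁)
          (V-+ (V-+ (V-+ (V-+ (V-+ (V-+ (V-+ (V-+ (V-+ vM
            (V-*ˡ (V-ι 12) (V-* V-π vγ))) (V-*ˡ (V-ι 24) vZ)) (V-*ˡ (V-ι 24) (V-*ʳ (V-* V-π vw) (V-- vy (V-* (V-ι 2) vx)))))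
            (V-*ˡ (V-ι 4) (V-*ʳ (V-* V-π va) vw₀))) (V-*ˡ (V-ι 4) (V-*ʳ (V-* (V-* V-π V-π) v₁a) vw₁)))
            (V-*ˡ (V-ι 4) (V-* V-π vδ₁))) (V-*ˡ (V-ι 4) (V-* V-π vδ₂))) (V-*ˡ (V-ι 4) (V-* V-π vk))) (V-*ˡ (V-ι 4) (V-* V-π vL)))))

    -- The digits of - 6 x stand where `combine₁` has those of 6 (y - 2 x). The difference y - x = π
    -- ε costs 6 w₀ ε at order p²; together with - 3 w₀ u² this is o₁ + o₂, because c₀ ≡ 2 w₀ x + 2
    -- ε - u². The computation is cut at `U`, which the first half leaves over and the second half
    -- cancels.
    combine₂ : ∀ {T γ c₀ c₁ b x y z s e ε η₀ η₁ u v g j δ₁ δ₁′ δ₂ m₁ o₁ o₂ k₀ k₁ a₀ a₁ w w₀ w₁ L₁} →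
      V 0 x → V 0 u → V 0 ε → V 0 w → V 0 w₀ → V 0 w₁ →
      V 3 (ι 4 * (π * π) * T - ι 12 * π * γ + ι 15 * (π * π) * b - ι 24 * (z - ι 3 * y + ι 2 * x) - ι 24 * π * w * (y - ι 2 * x)
        - ι 12 * π * (ι 3 * (u * u) - ι 2 * (u * v)) + ι 12 * (π * π) * w * (u * u)) →
      V 2 (γ - c₀ - π * c₁) → V 3 (z - ι 3 * y + ι 2 * x - 0ℚ - π * e - π * π * s) → V 2 (ι 3 * (g * g) - η₀ - π * η₁) →
      V 2 (ι 2 * u - v - g - π * j) → V 1 (u - g) → V 2 (ι 6 * e - δ₁ - π * δ₁′) →
      V 2 (- ι 6 * x - a₀ - π * a₁) → V 1 (- ι 6 * x - a₀) → V 2 (w - w₀ - π * w₁) → V 1 (w - w₀) → V 2 (w₀ * a₀ - δ₂ - π * m₁) →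
      V 1 (- ι 6 * (w₀ * w₀) * x - o₁) → V 1 (ι 3 * w₀ * c₀ - o₂) → V 1 (ι 2 * w₀ * x + ι 2 * ε - u * u - c₀) →
      V 2 (ι 3 * c₀ - k₀ - π * k₁) → V 2 (η₀ + δ₁ + δ₂ + k₀ - 0ℚ - π * L₁) → V 2 (y - x - 0ℚ - π * ε) →
      V 1 (T - (ι 3 * c₁ - ((ℤ.+ 15) / 4) * b + η₁ + ι 6 * u * j + ι 6 * s + δ₁′ + w₀ * a₁ + w₁ * a₀ + m₁ + o₁ + o₂ + k₁ + L₁))
    combine₂ {T} {γ} {c₀} {c₁} {b} {x} {y} {z} {s} {e} {ε} {η₀} {η₁} {u} {v} {g} {j} {δ₁} {δ₁′} {δ₂} {m₁} {o₁} {o₂} {k₀} {k₁} {a₀} {a₁} {w} {w₀} {w₁} {L₁}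
      vx vu vε vw vw₀ vw₁ vM vγ vZ vη vj vg vδ₁ va v₁a v₂w v₁w vδ₂ vo₁ vo₂ vc₀ vk vL v₂ε =
      V-unit-cancel 4 p∤4 (V-π^-cancel 2 (V-resp (combine₂-assemble U π T R₁ (w₀ * a₁) (w₁ * a₀) m₁ o₁ o₂ k₁ L₁)
          (V-+ (V-resp (combine₂-reduce₁ π T γ b x y z w c₀ c₁ s e η₀ η₁ u v g j δ₁ δ₁′)
            (V-+ (V-- (V-+ (V-+ (V-+ (V-+ vM
              (V-*ˡ (V-ι 12) (V-* V-π vγ)))
              (V-*ˡ (V-ι 24) vZ))
              (V-*ˡ (V-ι 4) (V-* V-π vη)))
              (V-*ˡ (V-* (V-ι 24) vu) (V-* V-π vj)))
              (V-*ˡ (V-ι 12) (V-* V-π (V-* vg vg))))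
              (V-*ˡ (V-ι 4) (V-* V-π vδ₁))))
          (V-resp (combine₂-reduce₂ π x y w w₀ w₁ c₀ ε a₀ a₁ η₀ u δ₁ δ₂ m₁ o₁ o₂ k₀ k₁ L₁)
            (V-+ (V-+ (V-+ (V-+ (V-- (V-+ (V-+ (V-+ (V--
              (V-*ˡ (V-ι 4) (V-*ˡ vw₀ (V-* V-π va)))
              (V-*ˡ (V-ι 24) (V-*ʳ (V-* V-π v₂w) vx)))
              (V-*ˡ (V-ι 4) (V-*ˡ vw₁ (V-* (V-* V-π V-π) v₁a))))
              (V-*ˡ (V-ι 4) (V-* V-π vδ₂)))
              (V-*ˡ (V-ι 4) (V-* (V-* V-π V-π) (V-+ vo₁ vo₂))))
              (V-*ˡ (V-ι 12) (V-* (V-* V-π V-π) (V-+ (V-*ˡ (V-neg vw₀) vc₀) (V-*ˡ (V-* vu vu) v₁w)))))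
              (V-*ˡ (V-ι 4) (V-* V-π vk)))
              (V-*ˡ (V-ι 4) (V-* V-π vL)))
              (V-*ˡ (V-* (V-ι 24) vw) (V-* V-π v₂ε)))
              (V-*ˡ (V-ι 24) (V-* (V-* V-π V-π) (V-*ʳ v₁w vε))))))))
        where
        R₁ U : ℚ
        R₁ = ι 3 * c₁ - ((ℤ.+ 15) / 4) * b + η₁ + ι 6 * u * j + ι 6 * s + δ₁′
        U = ι 12 * π * c₀ + ι 4 * π * η₀ + ι 4 * π * δ₁ + ι 24 * π * w * (y - ι 2 * x) - ι 12 * (π * π) * w * (u * u)

    -- Modulo p² the terms with T and b disappear and the rest is divisible by 12 p. The quotient
    -- identifies 𝓒 modulo p with E₁, so that the units digit of 𝓒 can be eliminated.
    constant₁ : ∀ {T γ b x y z w w₀ ε} → V 0 T → V 0 b → V 0 w → V 0 x → V 1 (y - x) → V 2 (z - ι 2 * y + x) → V 2 (y - x - 0ℚ - π * ε) → V 1 (w - w₀) →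
      V 3 (ι 4 * (π * π) * T - ι 12 * π * γ + ι 11 * (π * π) * b - ι 24 * (z - ι 3 * y + ι 2 * x) - ι 24 * π * w * (y - ι 2 * x)) →
      V 1 (γ - (ι 2 * ε + ι 2 * w₀ * x))
    constant₁ {T} {γ} {b} {x} {y} {z} {w} {w₀} {ε} vT vb vw vx y≡x Δ² v-ε v₁-w vM = V-unit-cancel 12 p∤12 (V-π-cancel (V-resp (constant₁-identity₀ π T γ b x y z w w₀ ε)
          (V-+ (V-- (V-- (V-+ (V-- (V-*ʳ (V-* V-π V-π) (V-+ (V-* (V-ι 4) vT) (V-* (V-ι 11) vb))) (V-≤ (ℕP.n≤1+n 2) vM)) (V-*ˡ (V-ι 24) v-ε)) (V-*ˡ (V-ι 24) Δ²))
            (V-*ˡ (V-* (V-ι 24) vw) (V-* V-π y≡x))) (V-*ˡ (V-* (V-ι 24) vx) (V-* V-π v₁-w)))))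

    constant₂ : ∀ {T γ b x y z w w₀ ε u v} → V 0 T → V 0 b → V 0 w → V 0 x → V 0 u → V 1 (v - u) → V 1 (y - x) → V 2 (z - ι 2 * y + x) → V 2 (y - x - 0ℚ - π * ε) → V 1 (w - w₀) →
      V 3 (ι 4 * (π * π) * T - ι 12 * π * γ + ι 15 * (π * π) * b - ι 24 * (z - ι 3 * y + ι 2 * x) - ι 24 * π * w * (y - ι 2 * x)
        - ι 12 * π * (ι 3 * (u * u) - ι 2 * (u * v)) + ι 12 * (π * π) * w * (u * u)) →
      V 1 (γ - (ι 2 * w₀ * x + ι 2 * ε - u * u))
    constant₂ {T} {γ} {b} {x} {y} {z} {w} {w₀} {ε} {u} {v} vT vb vw vx vu v≡u y≡x Δ² v-ε v₁-w vM = V-unit-cancel 12 p∤12 (V-π-cancel (V-resp (constant₂-identity₀ π T γ b x y z w w₀ ε u v)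
          (V-+ (V-+ (V-- (V-- (V-+ (V-- (V-*ʳ (V-* V-π V-π) (V-+ (V-+ (V-* (V-ι 4) vT) (V-* (V-ι 15) vb)) (V-* (V-* (V-ι 12) vw) (V-* vu vu)))) (V-≤ (ℕP.n≤1+n 2) vM)) (V-*ˡ (V-ι 24) v-ε)) (V-*ˡ (V-ι 24) Δ²))
            (V-*ˡ (V-* (V-ι 24) vw) (V-* V-π y≡x))) (V-*ˡ (V-* (V-ι 24) vx) (V-* V-π v₁-w))) (V-*ˡ (V-* (V-ι 24) vu) (V-* V-π v≡u)))))

    -- Modulo p the three digits are 6 e, - 6 w x and 3 c ≡ 6 ε + 6 w x. Their sum is 6 (e + ε), and
    -- e + ε ≡ 0 as these are the first digits of opposite multiples of p.
    carry₁ : ∀ {e ε w x c δ₁ δ₂ k} → V 1 (e + ε) → V 1 (ι 6 * e - δ₁) → V 1 (- ι 6 * (w * x) - δ₂) → V 1 (ι 3 * c - k) → V 1 (ι 2 * ε + ι 2 * w * x - c) → V 1 (δ₁ + δ₂ + k)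
    carry₁ {e} {ε} {w} {x} {c} {δ₁} {δ₂} {k} v-e+ε v-δ₁ v-δ₂ v-k v-c = V-resp (carry₁-identity e ε w x c δ₁ δ₂ k)
      (V-- (V-- (V-- (V-- (V-*ˡ (V-ι 6) v-e+ε) v-δ₁) v-δ₂) v-k) (V-*ˡ (V-ι 3) v-c))

    -- As in `carry₁`; the additional - u² inside c is compensated by η ≡ 3 g² ≡ 3 u².
    carry₂ : ∀ {e ε w x c δ₁ δ₂ k η u g} → V 1 (e + ε) → V 1 (ι 6 * e - δ₁) → V 1 (- ι 6 * (w * x) - δ₂) → V 1 (ι 3 * c - k) → V 1 (ι 2 * w * x + ι 2 * ε - u * u - c) →
      V 1 (ι 3 * (g * g) - η) → V 1 (u - g) → V 0 u → V 0 g → V 1 (η + δ₁ + δ₂ + k)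
    carry₂ {e} {ε} {w} {x} {c} {δ₁} {δ₂} {k} {η} {u} {g} v-e+ε v-δ₁ v-δ₂ v-k v-c v-η v-g vu vg = V-resp (carry₂-identity e ε w x c δ₁ δ₂ k η u g)
      (V-- (V-- (V-- (V-- (V-- (V-- (V-*ˡ (V-ι 6) v-e+ε) v-δ₁) v-δ₂) v-k) (V-*ˡ (V-ι 3) v-c)) v-η) (V-*ˡ (V-ι 3) (V-*ʳ v-g (V-+ vu vg))))

    -- The digit function is a parameter here only to keep the type checker from unfolding it.

    module DigitCombination (d : ℕ → ℚ → ℚ) (digit-function : DigitFunction d) where

      open DigitFunction digit-function

      digits₂-from : ∀ {x a} → V 0 x → d 0 x ≡ a → V 2 (x - a - π * d 1 x)
      digits₂-from v refl = d₂ v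

      digits₃-from : ∀ {x a b} → V 0 x → d 0 x ≡ a → d 1 x ≡ b → V 3 (x - a - π * b - π * π * d 2 x)
      digits₃-from v refl refl = d₃ v

      module Common {x y z γ b w T : ℚ} (vx : V 0 x) (vy : V 0 y) (vz : V 0 z) (vC : V 0 γ) (vb : V 0 b) (vw : V 0 w) (vT : V 0 T)
                    (y≡x : V 1 (y - x)) (Δ² : V 2 (z - ι 2 * y + x)) where

        w₀ w₁ e ε a₀ Zc : ℚ
        w₀ = d 0 w
        w₁ = d 1 w
        e = d 1 (x - y)
        ε = d 1 (y - x)
        a₀ = d 0 (- ι 6 * x)
        Zc = z - ι 3 * y + ι 2 * x

        private
          x≡y : V 1 (x - y)
          x≡y = V-resp (x≡y-identity x y) (V-neg y≡x)

        v-e : V 2 (x - y - 0ℚ - π * e)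
        v-e = digits₂-from (V-- vx vy) (d₀-zero x≡y)

        v-ε : V 2 (y - x - 0ℚ - π * ε)
        v-ε = digits₂-from (V-- vy vx) (d₀-zero y≡x)

        v-e+ε : V 1 (e + ε)
        v-e+ε = V-π-cancel (V-resp (v-e+ε-identity x y π e ε) (V-neg (V-+ v-e v-ε)))

        -- z - 3 y + 2 x differs from x - y by the second difference z - 2 y + x, which is divisible
        -- by p². The digits 0 and 1 are therefore those of x - y, namely 0 and `e`; only digit 2 is
        -- new.
        v-Zc : V 3 (Zc - 0ℚ - π * e - π * π * d 2 Zc)
        v-Zc = digits₃-from V-Zc (d₀-zero (V-resp (v-Zc-identity x y z) (V-+ (V-≤ (s≤s z≤n) Δ²) x≡y))) (d₁-cong V-Zc (V-- vx vy) (V-resp (v-Zc-identity′ x y z) Δ²))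
          where
          V-Zc : V 0 Zc
          V-Zc = V-+ (V-- vz (V-* (V-ι 3) vy)) (V-* (V-ι 2) vx)

        v-w : V 2 (w - w₀ - π * w₁)
        v-w = d₂ vw

        V-w₀ : V 0 w₀
        V-w₀ = V-d 0 w

        V-w₁ : V 0 w₁
        V-w₁ = V-d 1 w

        V-6x : V 0 (- ι 6 * x)
        V-6x = V-* (V-neg (V-ι 6)) vx

        v-a₀ : V 1 (- ι 6 * x - a₀)
        v-a₀ = d₁ V-6x

        δ₁ δ₂ : ℚ
        δ₁ = d 0 (ι 6 * e)
        δ₂ = d 0 (w₀ * a₀)

        v-δ₁ : V 2 (ι 6 * e - δ₁ - π * d 1 (ι 6 * e))
        v-δ₁ = d₂ (V-* (V-ι 6) (V-d 1 (x - y)))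

        v-δ₂ : V 2 (w₀ * a₀ - δ₂ - π * d 1 (w₀ * a₀))
        v-δ₂ = d₂ (V-* V-w₀ (V-d 0 (- ι 6 * x)))

        v₁-δ₁ : V 1 (ι 6 * e - δ₁)
        v₁-δ₁ = d₁ (V-* (V-ι 6) (V-d 1 (x - y)))

        v₁-δ₂ : V 1 (- ι 6 * (w₀ * x) - δ₂)
        v₁-δ₂ = V-resp (v₁-δ₂-identity w₀ x a₀ δ₂) (V-+ (V-*ˡ V-w₀ v-a₀) (d₁ (V-* V-w₀ (V-d 0 (- ι 6 * x)))))

        M : ℚ → ℚ
        M β = ι 4 * (π * π) * T - ι 12 * π * γ + β * (π * π) * b - ι 24 * (z - ι 3 * y + ι 2 * x) - ι 24 * π * w * (y - ι 2 * x)

        first-digits : V 3 (M (ι 11)) →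
          let E₁ = ι 2 * ε + ι 2 * w₀ * x in
          V 1 (T - (ι 3 * d 1 γ - ((ℤ.+ 11) / 4) * b + ι 6 * d 2 Zc + d 1 (ι 6 * e) + d 1 (ι 3 * d 0 E₁)
            + w₁ * a₀ + w₀ * d 1 (ι 6 * (y - ι 2 * x)) + d 1 (w₀ * a₀)
            + d 1 (d 0 (ι 6 * e) + d 0 (- ι 6 * w₀ * x) + d 0 (ι 3 * d 0 E₁))))
        first-digits vM = combine₁ {T} {γ} {c₀} {c₁} {b} {x} {y} {z} {s} {e} {δ₁} {δ₁′} {δ₂} {m₁} {k₀} {k₁} {a₀} {a₁} {w} {w₀} {w₁} {L₁} vx vy V-w₀ V-w₁ vM v-C v-Zc v-w v-a₁ v₁-a₁ v-δ₁ v-δ₂ v-k (V-resp (cong (λ δ → δ₁ + δ + k₀ - 0ℚ - π * L₁) δ₂≡) v-L)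
          where
          E₁ = ι 2 * ε + ι 2 * w₀ * x
          Y = y - ι 2 * x
          c₀ = d 0 E₁
          c₁ = d 1 γ
          s = d 2 Zc
          δ₁′ = d 1 (ι 6 * e)
          m₁ = d 1 (w₀ * a₀)
          k₀ = d 0 (ι 3 * c₀)
          k₁ = d 1 (ι 3 * c₀)
          a₁ = d 1 (ι 6 * Y)
          L = δ₁ + d 0 (- ι 6 * w₀ * x) + k₀
          L₁ = d 1 L
          V-E₁ : V 0 E₁
          V-E₁ = V-+ (V-* (V-ι 2) (V-d 1 (y - x))) (V-* (V-* (V-ι 2) V-w₀) vx)
          V-Y : V 0 Y
          V-Y = V-- vy (V-* (V-ι 2) vx)
          C≡E₁ : V 1 (γ - E₁)
          C≡E₁ = constant₁ {T} {γ} {b} {x} {y} {z} {w} {w₀} {ε} vT vb vw vx y≡x Δ² v-ε (d₁ vw) vM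
          v-C : V 2 (γ - c₀ - π * c₁)
          v-C = digits₂-from vC (d₀-cong vC V-E₁ C≡E₁)
          V-c₀ : V 0 c₀
          V-c₀ = V-d 0 E₁
          v-k : V 2 (ι 3 * c₀ - k₀ - π * k₁)
          v-k = d₂ (V-* (V-ι 3) V-c₀)
          6Y≡-6x : V 1 (ι 6 * Y - - ι 6 * x)
          6Y≡-6x = V-resp (6Y≡-6x-identity₀ x y) (V-*ˡ (V-ι 6) y≡x)
          -- Since y ≡ x modulo p, the numbers 6 (y - 2 x) and - 6 x share their units digit; their
          -- higher digits may differ.
          6Y₀ : d 0 (ι 6 * Y) ≡ a₀
          6Y₀ = d₀-cong (V-* (V-ι 6) V-Y) V-6x 6Y≡-6x
          v-a₁ : V 2 (ι 6 * Y - a₀ - π * a₁)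
          v-a₁ = digits₂-from (V-* (V-ι 6) V-Y) 6Y₀
          v₁-a₁ : V 1 (ι 6 * Y - a₀)
          v₁-a₁ = V-resp (cong (λ z → ι 6 * Y - z) 6Y₀) (d₁ (V-* (V-ι 6) V-Y))
          V-6w₀x : V 0 (- ι 6 * w₀ * x)
          V-6w₀x = V-* (V-* (V-neg (V-ι 6)) V-w₀) vx
          -- The carry term of the statement is written with - 6 w₀ x, while the product of digits
          -- contributes w₀ a₀; both have the same units digit because a₀ ≡ - 6 x.
          δ₂≡ : d 0 (- ι 6 * w₀ * x) ≡ δ₂
          δ₂≡ = d₀-cong V-6w₀x (V-* V-w₀ (V-d 0 (- ι 6 * x))) (V-resp (δ₂≡-identity₀ w₀ x a₀) (V-*ˡ V-w₀ v-a₀))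
          v-L : V 2 (L - 0ℚ - π * L₁)
          v-L = digits₂-from (V-+ (V-+ (V-d 0 (ι 6 * e)) (V-d 0 (- ι 6 * w₀ * x))) (V-d 0 (ι 3 * c₀)))
            (d₀-zero (V-resp (cong (λ z → δ₁ + z + k₀) (sym δ₂≡)) (carry₁ {e} {ε} {w₀} {x} {c₀} {δ₁} {δ₂} {k₀} v-e+ε v₁-δ₁ v₁-δ₂ (d₁ (V-* (V-ι 3) V-c₀)) (d₁ V-E₁))))

        second-digits : ∀ {u v} → V 0 u → V 0 v → V 1 (v - u) →
          V 3 (M (ι 15) - ι 12 * π * (ι 3 * (u * u) - ι 2 * (u * v)) + ι 12 * (π * π) * w * (u * u)) →
          let E₂ = ι 2 * w₀ * x + ι 2 * ε - u * u in
          V 1 (T - (ι 3 * d 1 γ - ((ℤ.+ 15) / 4) * b + d 1 (ι 3 * (d 0 u * d 0 u)) + ι 6 * u * d 1 (ι 2 * u - v) + ι 6 * d 2 Zc + d 1 (ι 6 * e)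
            + w₀ * d 1 (- ι 6 * x) + w₁ * a₀ + d 1 (w₀ * a₀) + d 0 (- ι 6 * (w₀ * w₀) * x) + d 0 (ι 3 * w₀ * d 0 E₂) + d 1 (ι 3 * d 0 E₂)
            + d 1 (d 0 (ι 3 * (d 0 u * d 0 u)) + d 0 (ι 6 * e) + d 0 (- ι 6 * w₀ * d 0 x) + d 0 (ι 3 * d 0 E₂))))
        second-digits {u} {v} vu vv v≡u vM = combine₂ {T} {γ} {c₀} {c₁} {b} {x} {y} {z} {s} {e} {ε} {η₀} {η₁} {u} {v} {g} {j} {δ₁} {δ₁′} {δ₂} {m₁} {o₁} {o₂} {k₀} {k₁} {a₀} {a₁} {w} {w₀} {w₁} {L₁} vx vu (V-d 1 (y - x)) vw V-w₀ V-w₁ vM v-γ v-Zc v-η v-j v-g v-δ₁ (d₂ V-6x) v-a₀ v-w (d₁ vw) v-δ₂ v-o₁ v-o₂ v-c₀ v-k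
            (V-resp (cong (λ δ → η₀ + δ₁ + δ + k₀ - 0ℚ - π * L₁) δ₂≡) v-L) v-ε
          where
          E₂ = ι 2 * w₀ * x + ι 2 * ε - u * u
          g = d 0 u
          j = d 1 (ι 2 * u - v)
          c₀ = d 0 E₂
          c₁ = d 1 γ
          s = d 2 Zc
          η₀ = d 0 (ι 3 * (g * g))
          η₁ = d 1 (ι 3 * (g * g))
          δ₁′ = d 1 (ι 6 * e)
          a₁ = d 1 (- ι 6 * x)
          m₁ = d 1 (w₀ * a₀)
          o₁ = d 0 (- ι 6 * (w₀ * w₀) * x)
          o₂ = d 0 (ι 3 * w₀ * c₀)
          k₀ = d 0 (ι 3 * c₀)
          k₁ = d 1 (ι 3 * c₀)
          δ₂′ = d 0 (- ι 6 * w₀ * d 0 x)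
          L = η₀ + δ₁ + δ₂′ + k₀
          L₁ = d 1 L
          V-E₂ : V 0 E₂
          V-E₂ = V-- (V-+ (V-* (V-* (V-ι 2) V-w₀) vx) (V-* (V-ι 2) (V-d 1 (y - x)))) (V-* vu vu)
          γ≡E₂ : V 1 (γ - E₂)
          γ≡E₂ = constant₂ {T} {γ} {b} {x} {y} {z} {w} {w₀} {ε} {u} {v} vT vb vw vx vu v≡u y≡x Δ² v-ε (d₁ vw) vM
          v-γ : V 2 (γ - c₀ - π * c₁)
          v-γ = digits₂-from vC (d₀-cong vC V-E₂ γ≡E₂)
          v-c₀ : V 1 (E₂ - c₀)
          v-c₀ = d₁ V-E₂
          V-c₀ : V 0 c₀
          V-c₀ = V-d 0 E₂
          v-k : V 2 (ι 3 * c₀ - k₀ - π * k₁)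
          v-k = d₂ (V-* (V-ι 3) V-c₀)
          v-g : V 1 (u - g)
          v-g = d₁ vu
          V-3g² : V 0 (ι 3 * (g * g))
          V-3g² = V-* (V-ι 3) (V-* (V-d 0 u) (V-d 0 u))
          v-η : V 2 (ι 3 * (g * g) - η₀ - π * η₁)
          v-η = d₂ V-3g²
          V-2u-v : V 0 (ι 2 * u - v)
          V-2u-v = V-- (V-* (V-ι 2) vu) vv
          v-j : V 2 (ι 2 * u - v - g - π * j)
          v-j = digits₂-from V-2u-v (d₀-cong V-2u-v vu (V-resp (v-j-identity₀ u v) (V-neg v≡u)))
          v-o₁ : V 1 (- ι 6 * (w₀ * w₀) * x - o₁)
          v-o₁ = d₁ (V-* (V-* (V-neg (V-ι 6)) (V-* V-w₀ V-w₀)) vx)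
          v-o₂ : V 1 (ι 3 * w₀ * c₀ - o₂)
          v-o₂ = d₁ (V-* (V-* (V-ι 3) V-w₀) V-c₀)
          δ₂≡ : δ₂′ ≡ δ₂
          δ₂≡ = d₀-cong (V-* (V-* (V-neg (V-ι 6)) V-w₀) (V-d 0 x)) (V-* V-w₀ (V-d 0 (- ι 6 * x)))
            (V-resp (δ₂≡-identity₀′ w₀ x (d 0 x) a₀) (V-+ (V-*ˡ V-w₀ v-a₀) (V-*ˡ (V-* (V-ι 6) V-w₀) (d₁ vx))))
          v-L : V 2 (L - 0ℚ - π * L₁)
          v-L = digits₂-from (V-+ (V-+ (V-+ (V-d 0 (ι 3 * (g * g))) (V-d 0 (ι 6 * e))) (V-d 0 (- ι 6 * w₀ * d 0 x))) (V-d 0 (ι 3 * c₀)))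
            (d₀-zero (V-resp (cong (λ z → η₀ + δ₁ + z + k₀) (sym δ₂≡)) (carry₂ {e} {ε} {w₀} {x} {c₀} {δ₁} {δ₂} {k₀} {η₀} {u} {g} v-e+ε v₁-δ₁ v₁-δ₂ (d₁ (V-* (V-ι 3) V-c₀)) v-c₀ (d₁ V-3g²) v-g vu (V-d 0 u))))

    -- Interpolation of harmonic sums by power sums, and Kummer's congruences at their exponents

    module Regular (q : ℕ) (p≡1+q : p ≡ suc q) (t : ℕ) (q≡2t : q ≡ 2 ℕ.* t) where

      p∤1+a : ∀ {a} → a < q → ¬ p ∣ suc a
      p∤1+a a<q = 0<n<p⇒p∤n (s≤s z≤n) (subst (_ <_) (sym p≡1+q) (s≤s a<q))

      V-rec-<q : ∀ {a} → a < q → V 0 (rec a)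
      V-rec-<q {a} a<q = V-rec a (p∤1+a a<q)

      powerSum-p : ∀ k → powerSum (suc k) p ≡ ∑ q (λ a → ι (suc a) ^ℚ suc k)
      powerSum-p k = trans (cong (powerSum (suc k)) p≡1+q) (trans (∑-head q (λ a → ι a ^ℚ suc k))
        (trans (cong (_+ ∑ q (λ a → ι (suc a) ^ℚ suc k)) (0^ℚ k)) (ℚP.+-identityˡ _)))

      -- With e = p - 2 - r these are the exponents (i + 1)(p - 1) - r.
      K : ℕ → ℕ → ℕ
      K e i = suc (e ℕ.+ i ℕ.* q)

      Sₖ : ℕ → ℕ → ℚ
      Sₖ e i = powerSum (K e i) p

      module Interpolation (r e : ℕ) (q≡1+e+r : q ≡ suc e ℕ.+ r) where

        K+r : ∀ i → K e i ℕ.+ r ≡ suc i ℕ.* q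
        K+r i = trans (solve 3 (λ e r x → con 1 :+ (e :+ x) :+ r := con 1 :+ e :+ r :+ x) refl e r (i ℕ.* q)) (cong (ℕ._+ i ℕ.* q) (sym q≡1+e+r))
          where open ℕSolver.+-*-Solver

        K+r+i : ∀ i → K e i ℕ.+ (r ℕ.+ suc i) ≡ suc i ℕ.* p
        K+r+i i = trans (sym (ℕP.+-assoc (K e i) r (suc i))) (trans (cong (ℕ._+ suc i) (K+r i))
          (trans (solve 2 (λ i q → i :* q :+ i := i :* (con 1 :+ q)) refl (suc i) q) (cong (suc i ℕ.*_) (sym p≡1+q))))
          where open ℕSolver.+-*-Solver

        ι-K : ∀ i → ι (K e i) ≡ ι (suc i) * π - (ι r + ι (suc i))
        ι-K i = trans (rearrange₄ (ι (K e i)) (ι r + ι (suc i))) (cong (_- (ι r + ι (suc i)))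
          (trans (cong (λ z → ι (K e i) + z) (sym (ι-+ r (suc i)))) (trans (sym (ι-+ (K e i) (r ℕ.+ suc i))) (trans (cong ι (K+r+i i)) (ι-* (suc i) p)))))

        p∤K : ∀ i → r ℕ.+ suc i < p → ¬ p ∣ K e i
        p∤K i small p∣K = 0<n<p⇒p∤n (subst (0 <_) (sym (ℕP.+-suc r i)) (s≤s z≤n)) small
          (Div.∣m+n∣m⇒∣n (subst (p ∣_) (sym (K+r+i i)) (Div.n∣m*n (suc i))) p∣K)

        power-K : ∀ a i → ι (suc a) ^ℚ K e i ≡ rec a ^ℚ r * (ι (suc a) ^ℚ q) ^ℚ suc i
        power-K a i = begin
          x ^ℚ K e i                                  ≡⟨ sym (ℚP.*-identityˡ (x ^ℚ K e i)) ⟩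
          1ℚ * x ^ℚ K e i                             ≡⟨ cong (_* x ^ℚ K e i) (sym (trans (cong (_^ℚ r) (rec-inv a)) (1^ℚ r))) ⟩
          (x * rec a) ^ℚ r * x ^ℚ K e i               ≡⟨ cong (_* x ^ℚ K e i) (^ℚ-*-distrib x (rec a) r) ⟩
          x ^ℚ r * rec a ^ℚ r * x ^ℚ K e i            ≡⟨ power-K-identity (x ^ℚ r) (rec a ^ℚ r) (x ^ℚ K e i) ⟩
          rec a ^ℚ r * (x ^ℚ K e i * x ^ℚ r)          ≡⟨ cong (rec a ^ℚ r *_) (trans (sym (^ℚ-+ x (K e i) r)) (trans (cong (x ^ℚ_) (K+r i)) (^ℚ-* x (suc i) q))) ⟩
          rec a ^ℚ r * (x ^ℚ q) ^ℚ suc i            ∎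
          where
          open ≡-Reasoning
          x = ι (suc a)

        -- Both interpolations expand powers of a^(p-1) - 1, which p divides.
        interpolation₄ : V 4 (inversePowerSum q r - ι 4 * Sₖ e 0 + ι 6 * Sₖ e 1 - ι 4 * Sₖ e 2 + Sₖ e 3)
        interpolation₄ = V-resp (trans (∑-lin q (λ a → rec a ^ℚ r) (f 0) (f 1) (f 2) (f 3) 1ℚ (- ι 4) (ι 6) (- ι 4) 1ℚ)
            (trans (interpolation₄-identity′ (inversePowerSum q r) (∑ q (f 0)) (∑ q (f 1)) (∑ q (f 2)) (∑ q (f 3)))
              (cong₂ _+_ (cong₂ _-_ (cong₂ _+_ (cong (λ z → inversePowerSum q r - ι 4 * z) (F 0)) (cong (ι 6 *_) (F 1))) (cong (ι 4 *_) (F 2))) (F 3))))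
          (V-∑ q (λ a a<q → V-resp (trans (interpolation₄-identity (rec a ^ℚ r) (ι (suc a) ^ℚ q))
              (cong₂ _+_ (cong₂ _+_ (cong₂ _+_ (cong (λ z → 1ℚ * rec a ^ℚ r + - ι 4 * z) (sym (power-K a 0))) (cong (ι 6 *_) (sym (power-K a 1)))) (cong ((- ι 4) *_) (sym (power-K a 2)))) (cong (1ℚ *_) (sym (power-K a 3)))))
            (V-*ˡ (V-^ r (V-rec-<q a<q)) (V-^-scale 4 (fermat′ q p≡1+q (suc a) (p∤1+a a<q))))))
          where
          f : ℕ → ℕ → ℚ
          f i a = ι (suc a) ^ℚ K e i
          F : ∀ i → ∑ q (f i) ≡ Sₖ e i
          F i = sym (powerSum-p (e ℕ.+ i ℕ.* q))

        interpolation₂ : V 2 (inversePowerSum q r - ι 2 * Sₖ e 0 + Sₖ e 1)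
        interpolation₂ = V-resp (trans (∑-lin q (λ a → rec a ^ℚ r) (f 0) (f 1) (f 0) (f 1) 1ℚ (- ι 2) 1ℚ 0ℚ 0ℚ)
            (trans (interpolation₂-identity′ (inversePowerSum q r) (∑ q (f 0)) (∑ q (f 1)))
              (cong₂ _+_ (cong (λ z → inversePowerSum q r - ι 2 * z) (F 0)) (F 1))))
          (V-∑ q (λ a a<q → V-resp (trans (interpolation₂-identity (rec a ^ℚ r) (ι (suc a) ^ℚ q) (f 0 a) (f 1 a))
              (cong (λ z → z + 0ℚ * f 0 a + 0ℚ * f 1 a) (cong₂ _+_ (cong (λ z → 1ℚ * rec a ^ℚ r + - ι 2 * z) (sym (power-K a 0))) (cong (1ℚ *_) (sym (power-K a 1))))))
            (V-*ˡ (V-^ r (V-rec-<q a<q)) (V-^-scale 2 (fermat′ q p≡1+q (suc a) (p∤1+a a<q))))))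
          where
          f : ℕ → ℕ → ℚ
          f i a = ι (suc a) ^ℚ K e i
          F : ∀ i → ∑ q (f i) ≡ Sₖ e i
          F i = sym (powerSum-p (e ℕ.+ i ℕ.* q))

      module KummerAt (r e s c : ℕ) (q≡1+e+r : q ≡ suc e ℕ.+ r) (e≡ : e ≡ suc (2 ℕ.* suc s))
                      (r+4<p : r ℕ.+ 4 < p) (2^r≡ : 2 ^ r ≡ suc c) (p∤c : ¬ p ∣ c) where

        open Smooth

        private
          h = proj₁ (odd^ (proj₁ p-odd) 3)
          p³≡ : p ^ 3 ≡ suc (2 ℕ.* h)
          p³≡ = trans (cong (_^ 3) (proj₂ p-odd)) (proj₂ (odd^ (proj₁ p-odd) 3))

          T : ℚ
          T = ι 2 ^ℚ q

          T≡1 : V 1 (T - 1ℚ)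
          T≡1 = fermat′ q p≡1+q 2 (0<n<p⇒p∤n (s≤s z≤n) (ℕP.≤-trans (ℕP.m≤n+m 3 8) 11≤p))

          K-pred-odd : ∀ i → e ℕ.+ i ℕ.* q ≡ suc (2 ℕ.* suc (s ℕ.+ i ℕ.* t))
          K-pred-odd i = trans (cong₂ (λ a b → a ℕ.+ i ℕ.* b) e≡ q≡2t)
            (solve 3 (λ s i t → con 1 :+ con 2 :* (con 1 :+ s) :+ i :* (con 2 :* t) := con 1 :+ con 2 :* (con 1 :+ (s :+ i :* t))) refl s i t)
            where open ℕSolver.+-*-Solver

          u g : ℕ → ℚ
          u i = ι 2 ^ℚ K e i - 1ℚ
          g i = oddPowerSum h p³≡ (e ℕ.+ i ℕ.* q)

          geometric : ∀ x n i → x ^ℚ (n ℕ.+ i ℕ.* q) ≡ x ^ℚ n * (x ^ℚ q) ^ℚ i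
          geometric x n i = trans (^ℚ-+ x n (i ℕ.* q)) (cong (x ^ℚ n *_) (^ℚ-* x i q))

          Smooth-u : Smooth u
          Smooth-u = Smooth-≗ {λ i → ι 2 ^ℚ suc e * T ^ℚ i - 1ℚ} (λ i → cong (_- 1ℚ) (sym (geometric (ι 2) (suc e) i)))
            (Smooth-pred (Smooth-geometric {ι 2 ^ℚ suc e} {T} (V-^ q (V-ι 2)) (λ n _ → V-*ˡ (V-^ (suc e) (V-ι 2)) (subst (λ k → V k ((T - 1ℚ) ^ℚ n)) (ℕP.*-identityʳ n) (V-^-scale n T≡1)))))

          e≥3 : 3 ≤ e
          e≥3 = subst (3 ≤_) (sym (trans e≡ (cong suc (ℕP.*-suc 2 s)))) (s≤s (s≤s (s≤s z≤n)))

          Smooth-g : Smooth g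
          Smooth-g = Smooth-≗ {λ i → ∑ h (λ a → ι (suc (2 ℕ.* a)) ^ℚ e * (ι (suc (2 ℕ.* a)) ^ℚ q) ^ℚ i)}
            (λ i → ∑-cong h (λ a _ → sym (geometric (ι (suc (2 ℕ.* a))) e i)))
            (Smooth-∑ h (λ a _ → Smooth-geometric {ι (suc (2 ℕ.* a)) ^ℚ e} {ι (suc (2 ℕ.* a)) ^ℚ q} (V-^ q (V-ι (suc (2 ℕ.* a)))) (term (suc (2 ℕ.* a)))))
            where
            term : ∀ n k → k ≤ 3 → V k (ι n ^ℚ e * (ι n ^ℚ q - 1ℚ) ^ℚ k)
            term n k k≤3 = case p ∣? n of λ where
              (yes p∣n) → V-*ʳ (V-≤ (ℕP.≤-trans k≤3 e≥3) (subst (λ j → V j (ι n ^ℚ e)) (ℕP.*-identityʳ e) (V-^-scale e (V-∣ p∣n)))) (V-^ k (V-- (V-^ q (V-ι n)) (V-ι 1)))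
              (no p∤n)  → V-*ˡ (V-^ e (V-ι n)) (subst (λ j → V j ((ι n ^ℚ q - 1ℚ) ^ℚ k)) (ℕP.*-identityʳ k) (V-^-scale k (fermat′ q p≡1+q n p∤n)))

          T^≡1 : ∀ i → V 1 (T ^ℚ i - 1ℚ)
          T^≡1 zero    = V-0 1
          T^≡1 (suc i) = V-resp (T^≡1-identity T (T ^ℚ i)) (V-+ (V-*ˡ (V-^ q (V-ι 2)) (T^≡1 i)) T≡1)

          -- The exponent is (i + 1)(p - 1) - r, so Fermat's theorem gives 2^r (2^K - 1) ≡ 1 - 2^r =
          -- - c modulo p.
          ¬V-u : ∀ i → ¬ V 1 (u i)
          ¬V-u i v = p∤c (subst (_∣ c) (ℕP.*-identityʳ p) (V-ιℤ⇒p^k∣ 1 {ℤ.+ c} (V-resp (ring (ι 2 ^ℚ r) (T ^ℚ i) (ι 2 ^ℚ suc e) (ι c) 2^r)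
              (V-- (V-+ (V-*ˡ (V-neg (V-^ r (V-ι 2))) v′) (V-*ˡ (V-* (V-^ r (V-ι 2)) (V-^ (suc e) (V-ι 2))) (T^≡1 i))) (V-resp T-split (V-neg T≡1))))))
            where
            v′ : V 1 (ι 2 ^ℚ suc e * T ^ℚ i - 1ℚ)
            v′ = V-resp (cong (_- 1ℚ) (geometric (ι 2) (suc e) i)) v
            2^r : ι 2 ^ℚ r ≡ 1ℚ + ι c
            2^r = trans (sym (ι-^ 2 r)) (trans (cong ι 2^r≡) (ι-suc c))
            T-split : - (T - 1ℚ) ≡ - (ι 2 ^ℚ suc e * ι 2 ^ℚ r - 1ℚ)
            T-split = cong (λ z → - (z - 1ℚ)) (trans (cong (ι 2 ^ℚ_) q≡1+e+r) (^ℚ-+ (ι 2) (suc e) r))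
            ring : ∀ x T a c → x ≡ 1ℚ + c → (- x * (a * T - 1ℚ)) + (x * a) * (T - 1ℚ) - (- (a * x - 1ℚ)) ≡ c
            ring x T a c refl = ¬V-u-identity T a c

          u-ι : ∀ i → u i ≡ ι (2 ^ K e i ∸ 1)
          u-ι i = trans (cong (_- 1ℚ) (trans (sym (ι-^ 2 (K e i))) (trans (cong ι (sym (ℕP.m+[n∸m]≡n {1} (ℕP.m^n>0 2 (K e i))))) (ι-suc (2 ^ K e i ∸ 1)))))
            (rearrange₂ (ι (2 ^ K e i ∸ 1)))

          cancel-u : ∀ i {k x} → V k (u i * x) → V k x
          cancel-u i {k} {x} v = V-unit-cancel (2 ^ K e i ∸ 1) (λ p∣ → ¬V-u i (V-resp (sym (u-ι i)) (V-∣ p∣)))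
            (V-resp (cong (_* x) (u-ι i)) v)

          u*β : ∀ i → i ≤ 3 → V 3 (u i * 𝓑 (K e i) - g i)
          u*β i i≤3 = subst (λ m → ¬ p ∣ suc m → V 3 ((ι 2 ^ℚ suc m - 1ℚ) * 𝓑 (suc m) - oddPowerSum h p³≡ m)) (sym (K-pred-odd i))
            (voronoi h p³≡ (2 ℕ.* suc (s ℕ.+ i ℕ.* t)) (B-odd (s ℕ.+ i ℕ.* t)))
            (Interpolation.p∤K r e q≡1+e+r i (ℕP.≤-<-trans (ℕP.+-monoʳ-≤ r (s≤s i≤3)) r+4<p))

        kummer : SmoothUpTo3 (λ i → 𝓑 (K e i))
        kummer = smooth-quotient Smooth-u Smooth-g cancel-u u*β

        V-B-K : ∀ i → i ≤ 3 → V 0 (B (K e i))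
        V-B-K i i≤3 = V-resp (sym (𝓑-B (e ℕ.+ i ℕ.* q))) (V-* (V-ι (K e i)) (SmoothUpTo3.integral kummer i i≤3))

      -- The coefficients of ∏ (1 - a X), a < p

      <q⇒1+<p : ∀ {k} → k < q → suc k < p
      <q⇒1+<p k<q = subst (_ <_) (sym p≡1+q) (s≤s k<q)

      V-powerSum : ∀ k → suc k < p → V 1 (powerSum k p)
      V-powerSum k k<p = V-resp eq (V-*ˡ (V-ι (k !)) (V-resp (sym (faulhaber p k))
          (V-⋆ k (V-bern-≤ k k<p) (λ i i≤k → V-*ʳ (V-*ʳ V-π (V-^ i (V-≤ z≤n V-π))) (V-ifact (suc i) (ℕP.≤-<-trans (s≤s i≤k) k<p))))))
        where
        eq : ι (k !) * (powerSum k p * ifact k) ≡ powerSum k p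
        eq = trans (rearrange₆ (ι (k !)) (powerSum k p) (ifact k)) (trans (cong (powerSum k p *_) (fact-ifact k)) (ℚP.*-identityʳ (powerSum k p)))

      F Q P : Series
      F = factorProduct (ι ∘ suc) q
      Q k = powerSum (suc k) p
      P zero    = 0ℚ
      P (suc k) = - (powerSum (suc k) p * rec k)

      ∂F : ∂ F ≗ ⊖ (Q ⋆ F)
      ∂F k = trans (newton (ι ∘ suc) q k) (cong -_ (⋆-cong {g = F} (λ i → sym (powerSum-p i)) (λ _ → refl) k))

      ∂P : ∂ P ≗ ⊖ Q
      ∂P k = trans (∂P-identity (ι (suc k)) (Q k) (rec k)) (cong -_ (trans (cong (Q k *_) (rec-inv k)) (ℚP.*-identityʳ (Q k))))

      V-factorProduct : ∀ x n → (∀ a → a < n → V 0 (x a)) → ∀ k → V 0 (factorProduct x n k)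
      V-factorProduct x zero    vx zero    = V-ι 1
      V-factorProduct x zero    vx (suc k) = V-0 0
      V-factorProduct x (suc n) vx zero    = V-factorProduct x n (λ a a<n → vx a (ℕP.m<n⇒m<1+n a<n)) 0
      V-factorProduct x (suc n) vx (suc k) = V-- (V-factorProduct x n (λ a a<n → vx a (ℕP.m<n⇒m<1+n a<n)) (suc k))
        (V-* (vx n ℕP.≤-refl) (V-factorProduct x n (λ a a<n → vx a (ℕP.m<n⇒m<1+n a<n)) k))

      V-F : ∀ k → V 0 (F k)
      V-F = V-factorProduct (ι ∘ suc) q (λ a _ → V-ι (suc a))

      signedProduct-q : signedProduct (ι ∘ suc) q ≡ ι (q !)
      signedProduct-q = trans (signedProduct-! q) (trans (cong (_* ι (q !)) (trans (cong ((- 1ℚ) ^ℚ_) q≡2t) ([-1]^-even t))) (ℚP.*-identityˡ (ι (q !))))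

      -- Newton's identity in degree p - 1, where all power sums but the last vanish modulo p.
      wilson-theorem : V 1 (ι (q !) + 1ℚ)
      wilson-theorem = aux q refl (p∤1+a {0} (ℕP.≤-trans (s≤s z≤n) 10≤q))
        where
        10≤q : 10 ≤ q
        10≤q = ℕP.≤-pred (subst (11 ≤_) p≡1+q 11≤p)
        F-q : F q ≡ ι (q !)
        F-q = trans (factorProduct-reverse (ι ∘ suc) rec rec-inv q q 0 (ℕP.+-identityʳ q))
          (trans (cong₂ _*_ signedProduct-q (factorProduct-0 rec q)) (ℚP.*-identityʳ (ι (q !))))
        V-S_q : V 1 (powerSum q p - ι q)
        V-S_q = aux q refl
          where
          ∑-1 : ∀ n → ∑ n (λ _ → 1ℚ) ≡ ι n
          ∑-1 zero    = refl
          ∑-1 (suc n) = trans (cong (_+ 1ℚ) (∑-1 n)) (trans (ℚP.+-comm (ι n) 1ℚ) (sym (ι-suc n)))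
          ∑-- : ∀ n f → ∑ n (λ a → f a - 1ℚ) ≡ ∑ n f - ι n
          ∑-- n f = trans (∑-+ n f (λ _ → - 1ℚ)) (cong (λ z → ∑ n f + z) (trans (∑-* n (- 1ℚ) (λ _ → 1ℚ)) (trans (cong ((- 1ℚ) *_) (∑-1 n)) (∑---identity (ι n)))))
          aux : ∀ m → q ≡ m → V 1 (powerSum q p - ι q)
          aux zero    e = ⊥-elim (ℕP.<⇒≱ (ℕP.≤-trans (s≤s z≤n) 10≤q) (ℕP.≤-reflexive e))
          aux (suc m) e = V-resp (trans (∑-- q (λ a → ι (suc a) ^ℚ q)) (cong (_- ι q) (trans (cong (λ k → ∑ q (λ a → ι (suc a) ^ℚ k)) e) (trans (sym (powerSum-p m)) (cong (λ k → powerSum k p) (sym e))))))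
            (V-∑ q (λ a a<q → fermat′ q p≡1+q (suc a) (p∤1+a a<q)))
        aux : ∀ m → q ≡ m → ¬ p ∣ 1 → V 1 (ι (q !) + 1ℚ)
        aux zero          e _ = ⊥-elim (ℕP.<⇒≱ (ℕP.≤-trans (s≤s z≤n) 10≤q) (ℕP.≤-reflexive e))
        aux (suc zero)    e _ = ⊥-elim (ℕP.<⇒≱ (ℕP.≤-trans (s≤s (s≤s z≤n)) 10≤q) (ℕP.≤-reflexive e))
        aux (suc (suc m)) e _ = V-unit-cancel q p∤q (V-resp eq (V-- (V-neg low) V-S_q))
          where
          p∤q : ¬ p ∣ q
          p∤q = 0<n<p⇒p∤n (ℕP.≤-trans (s≤s z≤n) 10≤q) (ℕP.≤-reflexive (sym p≡1+q))
          rest = (Q ⋆ (F ∘ suc)) m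
          low : V 1 rest
          low = V-⋆ m (λ i i≤m → V-powerSum (suc i) (<q⇒1+<p (subst (suc i <_) (sym e) (s≤s (s≤s i≤m))))) (λ i _ → V-F (suc i))
          q*F : ι q * F q ≡ - (rest + powerSum q p * 1ℚ)
          q*F = trans (cong (λ k → ι k * F k) e) (trans (∂F (suc m)) (cong -_ (trans (⋆-last Q F m)
            (cong₂ (λ k f → rest + powerSum k p * f) (sym e) (factorProduct-0 (ι ∘ suc) q)))))
          eq : - rest - (powerSum q p - ι q) ≡ ι q * (ι (q !) + 1ℚ)
          eq = trans (aux-identity rest (powerSum q p) (ι q) 1ℚ) (trans (cong (λ z → ι q * 1ℚ + z) (trans (sym q*F) (cong (ι q *_) F-q))) (aux-identity′ (ι q) (ι (q !))))

      wilson-quotient : ι (q !) ≡ π * ι (wilson p) - 1ℚ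
      wilson-quotient = sym (begin
        π * ι (wilson p) - 1ℚ               ≡⟨ cong (_- 1ℚ) (trans (ℚP.*-comm π (ι (wilson p))) (sym (ι-* (wilson p) p))) ⟩
        ι (wilson p ℕ.* p) - 1ℚ             ≡⟨ cong (λ z → ι z - 1ℚ) exact ⟩
        ι (q ! ℕ.+ 1) - 1ℚ                  ≡⟨ cong (_- 1ℚ) (ι-+ (q !) 1) ⟩
        ι (q !) + 1ℚ - 1ℚ                   ≡⟨ wilson-quotient-identity (ι (q !)) ⟩
        ι (q !)                             ∎)
        where
        open ≡-Reasoning
        divisible : suc q ∣ q ! ℕ.+ 1
        divisible = subst (_∣ q ! ℕ.+ 1) (trans (ℕP.*-identityʳ p) p≡1+q) (V-ιℤ⇒p^k∣ 1 {ℤ.+ (q ! ℕ.+ 1)} (V-resp (sym (ι-+ (q !) 1)) wilson-theorem))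
        exact : wilson p ℕ.* p ≡ q ! ℕ.+ 1
        exact = trans (cong (λ z → wilson z ℕ.* z) p≡1+q) (ℕD.m/n*n≡m divisible)

      V-P : ∀ k → k < q → V 1 (P k)
      V-P zero    _   = V-0 1
      V-P (suc k) k<q = V-neg (V-*ʳ (V-powerSum (suc k) (<q⇒1+<p k<q)) (V-rec-<q (ℕP.<-trans (ℕP.n<1+n k) k<q)))

      V-Q : ∀ k → suc k < q → V 1 (Q k)
      V-Q k k<q = V-powerSum (suc k) (<q⇒1+<p k<q)

      V-P³ : ∀ k → k < q → V 3 ((P ⋆ (P ⋆ P)) k)
      V-P³ k k<q = V-⋆ k (λ i i≤k → V-P i (ℕP.≤-<-trans i≤k k<q)) (λ i i≤k → V-⋆ i (λ j j≤i → below j (ℕP.≤-trans j≤i i≤k)) (λ j j≤i → below j (ℕP.≤-trans j≤i i≤k)))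
        where
        below : ∀ j → j ≤ k → V 1 (P j)
        below j j≤k = V-P j (ℕP.≤-<-trans j≤k k<q)

      -- F = exp P, and P is divisible by p in degrees below p - 1.
      F-exp₃ : ∀ k → k < q → ∀ i → i ≤ k → V 4 (ι 6 * F i - exp₃ P i)
      F-exp₃ zero    _   zero z≤n = V-resp (cong (λ z → ι 6 * z - exp₃ P 0) (sym (factorProduct-0 (ι ∘ suc) q))) (V-0 4)
      F-exp₃ (suc k) k<q i i≤k+1 = case ℕP.m≤n⇒m<n∨m≡n i≤k+1 of λ where
          (inj₁ (s≤s i≤k)) → earlier i i≤k
          -- The derivative of 6 F - exp₃ P is - Q times the earlier errors plus the cube: Q
          -- supplies p and the bracket p³.
          (inj₂ refl)      → V-unit-cancel (suc k) (p∤1+a (ℕP.<-trans (ℕP.n<1+n k) k<q)) (V-resp (sym ∂H)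
            (V-⋆ k (λ i i≤k → V-neg (V-Q i (ℕP.≤-<-trans (s≤s i≤k) k<q)))
                   (λ i i≤k → V-+ (V-≤ (ℕP.n≤1+n 3) (earlier i i≤k)) (V-P³ i (ℕP.≤-<-trans i≤k (ℕP.<-trans (ℕP.n<1+n k) k<q))))))
        where
        open ≡-Reasoning
        earlier : ∀ i → i ≤ k → V 4 (ι 6 * F i - exp₃ P i)
        earlier = F-exp₃ k (ℕP.<-trans (ℕP.n<1+n k) k<q)
        H : Series
        H i = ι 6 * F i - exp₃ P i
        cube = P ⋆ (P ⋆ P)
        ring₂ : ∀ q f e c → const (ι 6) ⋆ ⊖ (q ⋆ f) ⊕ ⊖ (⊖ q ⋆ (e ⊕ ⊖ c)) ≗ ⊖ q ⋆ (const (ι 6) ⋆ f ⊕ ⊖ e ⊕ c)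
        ring₂ = let open SeriesSolver in solve 4 (λ q f e c → con (ι 6) :* (:- (q :* f)) :+ :- ((:- q) :* (e :+ :- c)) := (:- q) :* (con (ι 6) :* f :+ :- e :+ c)) (λ _ → refl)
        ∂H : ι (suc k) * H (suc k) ≡ (⊖ Q ⋆ (H ⊕ cube)) k
        ∂H = begin
          ι (suc k) * H (suc k)
            ≡⟨ F-exp₃-identity₁ (ι (suc k)) (F (suc k)) (exp₃ P (suc k)) ⟩
          ι 6 * ∂ F k - ∂ (exp₃ P) k
            ≡⟨ cong₂ (λ a b → ι 6 * a - b) (∂F k) (trans (∂-exp₃ P k) (⋆-cong {g = exp₃ P ⊕ ⊖ cube} ∂P (λ _ → refl) k)) ⟩
          ι 6 * (⊖ (Q ⋆ F)) k - (⊖ Q ⋆ (exp₃ P ⊕ ⊖ cube)) k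
            ≡⟨ cong (λ z → z - (⊖ Q ⋆ (exp₃ P ⊕ ⊖ cube)) k) (sym (const-⋆ (ι 6) (⊖ (Q ⋆ F)) k)) ⟩
          (const (ι 6) ⋆ ⊖ (Q ⋆ F) ⊕ ⊖ (⊖ Q ⋆ (exp₃ P ⊕ ⊖ cube))) k
            ≡⟨ ring₂ Q F (exp₃ P) cube k ⟩
          (⊖ Q ⋆ (const (ι 6) ⋆ F ⊕ ⊖ exp₃ P ⊕ cube)) k
            ≡⟨ ⋆-cong {f = ⊖ Q} (λ _ → refl) (λ i → cong (λ z → z - exp₃ P i + cube i) (const-⋆ (ι 6) F i)) k ⟩
          (⊖ Q ⋆ (H ⊕ cube)) k ∎

      -- P up to order p². The error p³ is small enough for the square and the cube of P, where the
      -- other factors supply at least one more p.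
      W : Series
      W k = π * 𝒜 k + π * π * 𝒢 k

      V-𝒜 : ∀ k → k < q → V 0 (𝒜 k)
      V-𝒜 k k<q = V-neg (V-𝓑-small k (<q⇒1+<p k<q))

      V-½ : V 0 ½
      V-½ = V-rec 1 (0<n<p⇒p∤n (s≤s z≤n) (ℕP.≤-trans (ℕP.m≤n+m 3 8) 11≤p))

      V-𝒢 : ∀ k → k < q → V 0 (𝒢 k)
      V-𝒢 zero    _   = V-0 0
      V-𝒢 (suc k) k<q = V-neg (V-* V-½ (V-B-small k (<q⇒1+<p (ℕP.<-trans (ℕP.n<1+n k) k<q))))

      V-W : ∀ k → k < q → V 1 (W k)
      V-W k k<q = V-+ (V-*ʳ V-π (V-𝒜 k k<q)) (V-≤ (s≤s z≤n) (V-*ʳ (V-* V-π V-π) (V-𝒢 k k<q)))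

      V-P-W : ∀ k → k < q → V 3 (P k - W k)
      V-P-W zero    _   = V-resp (sym (V-P-W-identity π)) (V-0 3)
      V-P-W (suc k) k<q = V-resp eq (V-neg (V-*ˡ (V-rec-<q k<q′) (V-∑ k (λ i i<k → V-resp (V-P-W-identity₀ (ι (suc k C (2 ℕ.+ i))) (rec (2 ℕ.+ i)) π (π ^ℚ i) (B (suc k ∸ (2 ℕ.+ i))))
          (V-*ˡ (V-* (V-ι (suc k C (2 ℕ.+ i))) (V-rec-<q (ℕP.≤-<-trans (s≤s i<k) k<q)))
            (V-*ʳ (V-* V-π (V-* V-π V-π)) (V-* (V-^ i (V-ι p)) (V-B-small (k ∸ suc i) (<q⇒1+<p (ℕP.≤-<-trans (ℕP.m∸n≤m k (suc i)) k<q′))))))))))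
        where
        open ≡-Reasoning
        k<q′ : k < q
        k<q′ = ℕP.<-trans (ℕP.n<1+n k) k<q
        f : ℕ → ℚ
        f j = ι (suc k C j) * rec j * π ^ℚ suc j * B (suc k ∸ j)
        rest = ∑ k (λ i → f (2 ℕ.+ i))
        expand : powerSum (suc k) p ≡ 0ℚ + 1ℚ * 1ℚ * (π * 1ℚ) * B (suc k) + ι (suc k) * ½ * (π * (π * 1ℚ)) * B k + rest
        expand = trans (faulhaber-C p (suc k)) (trans (∑-split 2 k f) (cong₂ (λ a b → 0ℚ + ι a * 1ℚ * (π * 1ℚ) * B (suc k) + ι b * ½ * (π * (π * 1ℚ)) * B k + rest) (nC0≡1 (suc k)) (ℕC.nC1≡n (suc k))))
        eq : - (rec k * rest) ≡ P (suc k) - W (suc k)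
        eq = trans (V-P-W-identity₁ (rec k) rest π (B (suc k)) (B k) (ι (suc k)))
          (cong₂ (λ s c → - (s * rec k) - (π * - (B (suc k) * rec k) + π * π * - (½ * c))) (sym expand)
            (trans (cong (_* B k) (rec-inv k)) (ℚP.*-identityˡ (B k))))

      -- The linear term of the exponential needs P in degree n to order p⁴, one step beyond `W`.
      -- The factor 6 clears the denominators of C(n, 2) / 3.
      PowerSumExpansion : ℕ → Set
      PowerSumExpansion v = V 4 (ι 6 * powerSum n p - ι 6 * π * ι n * 𝓑 n - π * π * π * (ι n * (ι n - 1ℚ) * (ι n - ι 2)) * b)
        where open Coefficients v

      module Coefficient (v : ℕ) (n<q : Coefficients.n v < q) (V-S : PowerSumExpansion v) where

        open Coefficients v

        private
          ≤n⇒<q : ∀ {k} → k ≤ n → k < q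
          ≤n⇒<q k≤n = ℕP.≤-<-trans k≤n n<q

          below : ∀ {k} {f : Series} → (∀ i → i < q → V k (f i)) → ∀ i → i ≤ n → V k (f i)
          below vf i i≤n = vf i (≤n⇒<q i≤n)

          vP = below V-P
          vW = below V-W
          vPW = below V-P-W
          vA = below V-𝒜
          vG = below V-𝒢

          V-⋆-≤ : ∀ {j k f g} → (∀ i → i ≤ n → V j (f i)) → (∀ i → i ≤ n → V k (g i)) → ∀ i → i ≤ n → V (j ℕ.+ k) ((f ⋆ g) i)
          V-⋆-≤ vf vg i i≤n = V-⋆ i (λ a a≤i → vf a (ℕP.≤-trans a≤i i≤n)) (λ a a≤i → vg a (ℕP.≤-trans a≤i i≤n))

          V-P² : V 4 ((P ⋆ P) n - (W ⋆ W) n)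
          V-P² = V-resp (ring P W n) (V-⋆-≤ {f = P ⊕ ⊖ W} {P ⊕ W} vPW (λ i i≤n → V-+ (vP i i≤n) (vW i i≤n)) n ℕP.≤-refl)
            where
            ring : ∀ P W → (P ⊕ ⊖ W) ⋆ (P ⊕ W) ≗ P ⋆ P ⊕ ⊖ (W ⋆ W)
            ring = let open SeriesSolver in solve 2 (λ P W → (P :+ :- W) :* (P :+ W) := P :* P :+ :- (W :* W)) (λ _ → refl)

          πA : Series
          πA k = π * 𝒜 k

          -- f³ - g³ = (f - g)(f² + f g + g²), and the second factor carries p². Applied to P and W,
          -- then to W and `πA`, it reduces the cube modulo p⁴ to its part p³ 𝒜³.
          V-cube : ∀ f g {j} → (∀ i → i ≤ n → V (2 ℕ.+ j) (f i - g i)) → (∀ i → i ≤ n → V 1 (f i)) → (∀ i → i ≤ n → V 1 (g i)) →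
                   V (2 ℕ.+ j ℕ.+ 2) ((f ⋆ (f ⋆ f)) n - (g ⋆ (g ⋆ g)) n)
          V-cube f g d vf vg = V-resp (ring f g n)
            (V-⋆-≤ {f = f ⊕ ⊖ g} {f ⋆ f ⊕ f ⋆ g ⊕ g ⋆ g} d (λ i i≤n → V-+ (V-+ (V-⋆-≤ vf vf i i≤n) (V-⋆-≤ vf vg i i≤n)) (V-⋆-≤ vg vg i i≤n)) n ℕP.≤-refl)
            where
            ring : ∀ f g → (f ⊕ ⊖ g) ⋆ (f ⋆ f ⊕ f ⋆ g ⊕ g ⋆ g) ≗ f ⋆ (f ⋆ f) ⊕ ⊖ (g ⋆ (g ⋆ g))
            ring = let open SeriesSolver in solve 2 (λ f g → (f :+ :- g) :* (f :* f :+ f :* g :+ g :* g) := f :* (f :* f) :+ :- (g :* (g :* g))) (λ _ → refl)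

          V-P³-A³ : V 4 ((P ⋆ (P ⋆ P)) n - π * π * π * (𝒜 ⋆ (𝒜 ⋆ 𝒜)) n)
          V-P³-A³ = V-resp (ring ((P ⋆ (P ⋆ P)) n) ((W ⋆ (W ⋆ W)) n) ((πA ⋆ (πA ⋆ πA)) n) cubes) (V-+ (V-≤ (ℕP.n≤1+n 4) (V-cube P W vPW vP vW))
            (V-cube W πA (λ i i≤n → V-resp (V-P³-A³-identity′ (π * 𝒜 i) (π * π * 𝒢 i)) (V-*ʳ (V-* V-π V-π) (vG i i≤n))) vW (λ i i≤n → V-*ʳ V-π (vA i i≤n))))
            where
            ring : ∀ a b c {d} → c ≡ d → (a - b) + (b - c) ≡ a - d
            ring a b c refl = rearrange₁ a b c
            cubes : (πA ⋆ (πA ⋆ πA)) n ≡ π * π * π * (𝒜 ⋆ (𝒜 ⋆ 𝒜)) n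
            cubes = trans (⋆-scaleˡ π 𝒜 (πA ⋆ πA) n) (trans (cong (π *_) (trans (⋆-cong {f = 𝒜} (λ _ → refl) (λ i → trans (⋆-scaleˡ π 𝒜 πA i) (cong (π *_) (⋆-scaleʳ π 𝒜 𝒜 i))) n)
              (trans (⋆-scaleʳ π 𝒜 (λ i → π * (𝒜 ⋆ 𝒜) i) n) (cong (π *_) (⋆-scaleʳ π 𝒜 (𝒜 ⋆ 𝒜) n))))) (V-P³-A³-identity″ π ((𝒜 ⋆ (𝒜 ⋆ 𝒜)) n)))

          V-W² : V 4 ((W ⋆ W) n - π * π * (𝒜 ⋆ 𝒜) n - ι 2 * (π * π * π) * (𝒜 ⋆ 𝒢) n)
          V-W² = V-resp eq (V-*ʳ (V-* V-π (V-* V-π (V-* V-π V-π))) (V-⋆-≤ vG vG n ℕP.≤-refl))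
            where
            open ≡-Reasoning
            c = const π
            W-const : W ≗ c ⋆ 𝒜 ⊕ c ⋆ (c ⋆ 𝒢)
            W-const k = cong₂ _+_ (sym (const-⋆ π 𝒜 k)) (trans (ℚP.*-assoc π π (𝒢 k)) (sym (trans (const-⋆ π (c ⋆ 𝒢) k) (cong (π *_) (const-⋆ π 𝒢 k)))))
            ring : ∀ c A G → (c ⋆ A ⊕ c ⋆ (c ⋆ G)) ⋆ (c ⋆ A ⊕ c ⋆ (c ⋆ G))
                 ≗ c ⋆ (c ⋆ (A ⋆ A)) ⊕ const (ι 2) ⋆ (c ⋆ (c ⋆ (c ⋆ (A ⋆ G)))) ⊕ c ⋆ (c ⋆ (c ⋆ (c ⋆ (G ⋆ G))))
            ring = let open SeriesSolver in solve 3 (λ c A G → (c :* A :+ c :* (c :* G)) :* (c :* A :+ c :* (c :* G))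
              := c :* (c :* (A :* A)) :+ con (ι 2) :* (c :* (c :* (c :* (A :* G)))) :+ c :* (c :* (c :* (c :* (G :* G))))) (λ _ → refl)
            two : ∀ f → (c ⋆ (c ⋆ f)) n ≡ π * (π * f n)
            two f = trans (const-⋆ π (c ⋆ f) n) (cong (π *_) (const-⋆ π f n))
            four : ∀ f → (c ⋆ (c ⋆ (c ⋆ (c ⋆ f)))) n ≡ π * (π * (π * (π * f n)))
            four f = trans (two (c ⋆ (c ⋆ f))) (cong (λ z → π * (π * z)) (two f))
            three : (const (ι 2) ⋆ (c ⋆ (c ⋆ (c ⋆ (𝒜 ⋆ 𝒢))))) n ≡ ι 2 * (π * (π * (π * (𝒜 ⋆ 𝒢) n)))
            three = trans (const-⋆ (ι 2) (c ⋆ (c ⋆ (c ⋆ (𝒜 ⋆ 𝒢)))) n) (cong (ι 2 *_) (trans (two (c ⋆ (𝒜 ⋆ 𝒢))) (cong (λ z → π * (π * z)) (const-⋆ π (𝒜 ⋆ 𝒢) n))))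
            eq : (π * (π * (π * π))) * (𝒢 ⋆ 𝒢) n ≡ (W ⋆ W) n - π * π * (𝒜 ⋆ 𝒜) n - ι 2 * (π * π * π) * (𝒜 ⋆ 𝒢) n
            eq = trans (V-W²-identity′ π ((𝒜 ⋆ 𝒜) n) ((𝒜 ⋆ 𝒢) n) ((𝒢 ⋆ 𝒢) n)) (cong (λ z → z - π * π * (𝒜 ⋆ 𝒜) n - ι 2 * (π * π * π) * (𝒜 ⋆ 𝒢) n)
              (sym (trans (⋆-cong W-const W-const n) (trans (ring c 𝒜 𝒢 n) (cong₂ _+_ (cong₂ _+_ (two (𝒜 ⋆ 𝒜)) three) (four (𝒢 ⋆ 𝒢)))))))

          V-Pn : V 4 (ι 6 * P n + ι 6 * π * 𝓑 n + π * π * π * ((ι n - 1ℚ) * (ι n - ι 2)) * b)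
          V-Pn = V-unit-cancel n (p∤1+a (≤n⇒<q (ℕP.n≤1+n (4 ℕ.+ l)))) (V-resp eq (V-neg V-S))
            where
            S = powerSum n p
            eq : - (ι 6 * S - ι 6 * π * ι n * 𝓑 n - π * π * π * (ι n * (ι n - 1ℚ) * (ι n - ι 2)) * b) ≡ ι n * (ι 6 * P n + ι 6 * π * 𝓑 n + π * π * π * ((ι n - 1ℚ) * (ι n - ι 2)) * b)
            eq = trans (V-Pn-identity₁ S π (ι n) (𝓑 n) b) (trans (cong (λ z → ι 6 * - (S * z) + ι 6 * π * ι n * 𝓑 n + π * π * π * (ι n * (ι n - 1ℚ) * (ι n - ι 2)) * b) (sym (rec-inv (4 ℕ.+ l))))
              (V-Pn-identity₂ S (rec (4 ℕ.+ l)) π (ι n) (𝓑 n) b))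

        -- The linear part of exp₃ P is replaced by the expansion of the power sum, the square by
        -- that of W, the cube by p³ 𝒜³. The factor 4, beside the 6 within exp₃, clears ¼ and ¾.
        F-expansion : V 4 (ι 24 * F n + ι 24 * π * 𝓑 n + ι 4 * (π * π * π) * ((ι n - 1ℚ) * (ι n - ι 2)) * b - ι 12 * (π * π) * 𝓒 n
                           + ι 6 * (π * π * π) * (ι n - 1ℚ) * b + ι 4 * (π * π * π) * 𝓣 n + ι 3 * (π * π * π) * b)
        F-expansion = V-resp eq (V-*ˡ (V-ι 4) (V-+ (V-+ (V-+ (V-+ (F-exp₃ n n<q n ℕP.≤-refl) V-Pn) (V-*ˡ (V-ι 3) V-P²)) (V-*ˡ (V-ι 3) V-W²)) V-P³-A³))
          where
          P² = (P ⋆ P) n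
          P³ = (P ⋆ (P ⋆ P)) n
          W² = (W ⋆ W) n
          exp₃-n : exp₃ P n ≡ 0ℚ + ι 6 * P n + ι 3 * P² + P³
          exp₃-n = cong₂ _+_ (cong₂ _+_ (cong (λ z → 0ℚ + z) (const-⋆ (ι 6) P n)) (const-⋆ (ι 3) (P ⋆ P) n)) refl
          n-1 : ι (4 ℕ.+ l) ≡ ι n - 1ℚ
          n-1 = trans (rearrange₃ (ι (4 ℕ.+ l))) (cong (_- 1ℚ) (sym (ι-suc (4 ℕ.+ l))))
          eq : ι 4 * ((ι 6 * F n - exp₃ P n) + (ι 6 * P n + ι 6 * π * 𝓑 n + π * π * π * ((ι n - 1ℚ) * (ι n - ι 2)) * b) + ι 3 * (P² - W²)
              + ι 3 * (W² - π * π * (𝒜 ⋆ 𝒜) n - ι 2 * (π * π * π) * (𝒜 ⋆ 𝒢) n) + (P³ - π * π * π * (𝒜 ⋆ (𝒜 ⋆ 𝒜)) n))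
            ≡ ι 24 * F n + ι 24 * π * 𝓑 n + ι 4 * (π * π * π) * ((ι n - 1ℚ) * (ι n - ι 2)) * b - ι 12 * (π * π) * 𝓒 n
                           + ι 6 * (π * π * π) * (ι n - 1ℚ) * b + ι 4 * (π * π * π) * 𝓣 n + ι 3 * (π * π * π) * b
          eq = trans (cong₂ (λ e a → T e a ((𝒜 ⋆ 𝒢) n) ((𝒜 ⋆ (𝒜 ⋆ 𝒜)) n)) exp₃-n 𝒜²)
            (trans (cong₂ (T (0ℚ + ι 6 * P n + ι 3 * P² + P³) (𝓒 n)) (trans 𝒜𝒢 (cong (λ z → - (¼ * (z * b))) n-1)) 𝒜³)
              (F-expansion-identity π (F n) (P n) P² P³ W² (𝓑 n) (𝓒 n) (𝓣 n) b (ι n)))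
            where
            T : ℚ → ℚ → ℚ → ℚ → ℚ
            T e a g t = ι 4 * ((ι 6 * F n - e) + (ι 6 * P n + ι 6 * π * 𝓑 n + π * π * π * ((ι n - 1ℚ) * (ι n - ι 2)) * b) + ι 3 * (P² - W²)
              + ι 3 * (W² - π * π * a - ι 2 * (π * π * π) * g) + (P³ - π * π * π * t))

      -- Harmonic sums

      p∤small : ∀ n {n≢0 : 0 < n} → n ≤ 10 → ¬ p ∣ n
      p∤small n {n≢0} n≤10 = 0<n<p⇒p∤n n≢0 (ℕP.≤-trans (s≤s n≤10) 11≤p)

      -- The terms j = 1 and j = 3 of Faulhaber's formula vanish by hypothesis. The term j = 2 is p³
      -- C(k, 2) / 3 times B_(k-2) = (k - 2) 𝓑_(k-2).
      powerSum-even : ∀ m → B m ≡ 0ℚ → B (2 ℕ.+ m) ≡ 0ℚ → let k = 3 ℕ.+ m in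
        V 4 (ι 6 * powerSum k p - ι 6 * π * ι k * 𝓑 k - π * π * π * (ι k * (ι k - 1ℚ) * (ι k - ι 2)) * 𝓑 (1 ℕ.+ m))
      powerSum-even m B-m B-2+m = V-resp eq (V-*ˡ (V-ι 6) (powerSum-mod-p⁴ m))
        where
        k = 3 ℕ.+ m
        S = powerSum k p
        T : ℚ → ℚ → ℚ → ℚ → ℚ → ℚ
        T c₀ b₀ b₁ b₂ b₃ = ι 6 * (S - (0ℚ + c₀ * 1ℚ * (π * 1ℚ) * b₀ + ι (k C 1) * rec 1 * (π * (π * 1ℚ)) * b₁
          + ι (k C 2) * rec 2 * (π * (π * (π * 1ℚ))) * b₂ + ι (k C 3) * rec 3 * (π * (π * (π * (π * 1ℚ)))) * b₃))
        k-1 : ι (2 ℕ.+ m) ≡ ι k - 1ℚ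
        k-1 = sym (trans (cong (_- 1ℚ) (ι-suc (2 ℕ.+ m))) (rearrange₂ (ι (2 ℕ.+ m))))
        k-2 : ι (1 ℕ.+ m) ≡ ι k - ι 2
        k-2 = sym (trans (cong (_- ι 2) (trans (ι-suc (2 ℕ.+ m)) (cong (λ z → 1ℚ + z) (ι-suc (1 ℕ.+ m))))) (powerSum-even-identity₃ (ι (1 ℕ.+ m))))
        eq : ι 6 * (S - ∑ 4 (λ j → ι (k C j) * rec j * π ^ℚ suc j * B (k ∸ j))) ≡ ι 6 * S - ι 6 * π * ι k * 𝓑 k - π * π * π * (ι k * (ι k - 1ℚ) * (ι k - ι 2)) * 𝓑 (1 ℕ.+ m)
        eq = trans (cong₂ (λ c b → T c b (B (2 ℕ.+ m)) (B (1 ℕ.+ m)) (B m)) (cong ι (nC0≡1 k)) (𝓑-B (2 ℕ.+ m)))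
          (trans (cong₂ (T 1ℚ (ι k * 𝓑 k) (B (2 ℕ.+ m))) (𝓑-B m) B-m)
          (trans (cong (λ b → T 1ℚ (ι k * 𝓑 k) b (ι (1 ℕ.+ m) * 𝓑 (1 ℕ.+ m)) 0ℚ) B-2+m)
          (trans (powerSum-even-identity₁ S π (ι k) (𝓑 k) (ι (k C 1)) (ι (k C 2)) (ι (k C 3)) (𝓑 (1 ℕ.+ m)) (ι (1 ℕ.+ m)))
            (cong (λ z → ι 6 * S - ι 6 * π * ι k * 𝓑 k - π * π * π * z * 𝓑 (1 ℕ.+ m))
              (cong₂ _*_ (trans (C-2 (1 ℕ.+ m)) (cong (ι k *_) k-1)) k-2)))))

      -- Now the terms j = 0 and j = 2 vanish. The term j = 1 has p² before an integral Bernoulli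
      -- number; the term j = 3 has p⁴, one factor of which makes its Bernoulli number integral.
      powerSum-odd : ∀ m → B (3 ℕ.+ m) ≡ 0ℚ → V 0 (B (2 ℕ.+ m)) → B (1 ℕ.+ m) ≡ 0ℚ → V 2 (powerSum (3 ℕ.+ m) p)
      powerSum-odd m B-3+m vB B-1+m = V-resp eq (V-+ (V-+ (V-≤ (s≤s (s≤s z≤n)) (powerSum-mod-p⁴ m))
          (V-*ˡ (V-* (V-ι (k C 1)) (V-rec 1 (p∤small 2 {s≤s z≤n} (ℕP.m≤m+n 2 8)))) (V-*ʳ (V-* V-π V-π) vB)))
          (V-*ˡ (V-* (V-ι (k C 3)) (V-rec 3 (p∤small 4 {s≤s z≤n} (ℕP.m≤m+n 4 6)))) (V-≤ (ℕP.n≤1+n 2) (V-*ʳ (V-* V-π (V-* V-π V-π)) (V-πB m)))))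
        where
        k = 3 ℕ.+ m
        S = powerSum k p
        T : ℚ → ℚ → ℚ
        T b₀ b₂ = S - (0ℚ + ι (k C 0) * 1ℚ * (π * 1ℚ) * b₀ + ι (k C 1) * rec 1 * (π * (π * 1ℚ)) * B (2 ℕ.+ m)
          + ι (k C 2) * rec 2 * (π * (π * (π * 1ℚ))) * b₂ + ι (k C 3) * rec 3 * (π * (π * (π * (π * 1ℚ)))) * B m)
          + ι (k C 1) * rec 1 * (π * π * B (2 ℕ.+ m)) + ι (k C 3) * rec 3 * (π * (π * π) * (π * B m))
        eq : T (B (3 ℕ.+ m)) (B (1 ℕ.+ m)) ≡ S
        eq = trans (cong₂ T B-3+m B-1+m) (powerSum-odd-identity S π (ι (k C 0)) (ι (k C 1)) (ι (k C 2)) (ι (k C 3)) (B (2 ℕ.+ m)) (B m))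

      oddIndex : ∀ s i → Σ[ m ∈ ℕ ] suc (2 ℕ.* suc s) ℕ.+ i ℕ.* q ≡ suc (2 ℕ.* suc m)
      oddIndex s i = s ℕ.+ i ℕ.* t , trans (cong (λ z → suc (2 ℕ.* suc s) ℕ.+ i ℕ.* z) q≡2t)
        (solve 3 (λ s i t → con 1 :+ con 2 :* (con 1 :+ s) :+ i :* (con 2 :* t) := con 1 :+ con 2 :* (con 1 :+ (s :+ i :* t))) refl s i t)
        where open ℕSolver.+-*-Solver

      B-vanish : ∀ {e s} → e ≡ suc (2 ℕ.* suc s) → ∀ i → B (e ℕ.+ i ℕ.* q) ≡ 0ℚ
      B-vanish {s = s} refl i = B-odd′ (proj₁ (oddIndex s i)) (proj₂ (oddIndex s i))

      B-vanish₂ : ∀ {e s} → e ≡ suc (2 ℕ.* suc s) → ∀ i → B (2 ℕ.+ (e ℕ.+ i ℕ.* q)) ≡ 0ℚ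
      B-vanish₂ {e} {s} e≡ i = B-vanish {2 ℕ.+ e} {suc s} (trans (cong (2 ℕ.+_) e≡) (cong suc (sym (ℕP.*-suc 2 (suc s))))) i

      cubic : ℚ → ℚ
      cubic x = x * (x - 1ℚ) * (x - ι 2)

      V-cubic : ∀ {x} → V 0 x → V 0 (cubic x)
      V-cubic vx = V-* (V-* vx (V-- vx (V-ι 1))) (V-- vx (V-ι 2))

      -- The weights 4, -6, 4, -1 extrapolate to i = 0: exactly on a cubic polynomial in k, modulo p³ on k y.
      combine-harmonic : ∀ R H s₀ s₁ s₂ s₃ y₀ y₁ y₂ y₃ z₀ z₁ z₂ z₃ → V 0 R →
        let κ = λ j → ι j * π - (R + ι j)
            expansion = λ s k y z → ι 6 * s - ι 6 * π * k * y - π * π * π * cubic k * z in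
        V 4 (H - ι 4 * s₀ + ι 6 * s₁ - ι 4 * s₂ + s₃) →
        V 4 (expansion s₀ (κ 1) y₀ z₀) → V 4 (expansion s₁ (κ 2) y₁ z₁) → V 4 (expansion s₂ (κ 3) y₂ z₂) → V 4 (expansion s₃ (κ 4) y₃ z₃) →
        V 3 (y₃ - ι 3 * y₂ + ι 3 * y₁ - y₀) → V 1 (z₁ - z₀) → V 1 (z₂ - z₁) → V 1 (z₃ - z₂) →
        V 4 (ι 6 * H + ι 6 * R * π * (ι 3 * y₀ - ι 3 * y₁ + y₂) + R * (R + 1ℚ) * (R + ι 2) * (π * π * π) * z₀)
      combine-harmonic R H s₀ s₁ s₂ s₃ y₀ y₁ y₂ y₃ z₀ z₁ z₂ z₃ vR vH v₀ v₁ v₂ v₃ Δ³y z₁-z₀ z₂-z₁ z₃-z₂ = V-resp eq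
        (V-+ (V-+ (V-- (V-+ (V-- (V-*ˡ (V-ι 6) vH) (V-*ˡ (V-ι 6) v₁)) (V-*ˡ (V-ι 4) v₀)) (V-- v₃ (V-*ˡ (V-ι 4) v₂)))
          -- The differences of the z are divisible by p, so behind π³ every z may be replaced by
          -- z₀; the next summand eliminates y₃ through the third difference.
          (V-* V-π³ (V-- (V-- (V-*ˡ (V-ι 4) (V-*ˡ (V-cubic (V-κ 3)) z₂-z₀)) (V-*ˡ (V-ι 6) (V-*ˡ (V-cubic (V-κ 2)) z₁-z₀))) (V-*ˡ (V-cubic (V-κ 4)) z₃-z₀))))
          (V-*ˡ (V-neg (V-* (V-ι 6) (V-κ 4))) (V-* V-π Δ³y)))
        where
        κ : ℕ → ℚ
        κ j = ι j * π - (R + ι j)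
        V-κ : ∀ j → V 0 (κ j)
        V-κ j = V-- (V-* (V-ι j) (V-ι p)) (V-+ vR (V-ι j))
        V-π³ : V 3 (π * π * π)
        V-π³ = V-* (V-* V-π V-π) V-π
        z₂-z₀ : V 1 (z₂ - z₀)
        z₂-z₀ = V-resp (combine-harmonic-identity₀ z₀ z₁ z₂) (V-+ z₂-z₁ z₁-z₀)
        z₃-z₀ : V 1 (z₃ - z₀)
        z₃-z₀ = V-resp (combine-harmonic-identity₀ z₀ z₂ z₃) (V-+ z₃-z₂ z₂-z₀)
        eq = trans (combine-harmonic-identity₁ π H s₀ s₁ s₂ s₃ y₀ y₁ y₂ y₃ (κ 1) (κ 2) (κ 3) (κ 4) (cubic (κ 1)) (cubic (κ 2)) (cubic (κ 3)) (cubic (κ 4)) z₀ z₁ z₂ z₃)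
          (trans (cong (λ z → ι 6 * H - ι 6 * π * ((ι 4 * κ 1 - κ 4) * y₀ - (ι 6 * κ 2 - ι 3 * κ 4) * y₁ + (ι 4 * κ 3 - ι 3 * κ 4) * y₂) - z * (π * π * π) * z₀) (cubic-difference π R))
            (combine-harmonic-identity₂ π R H y₀ y₁ y₂ z₀ (R * (R + 1ℚ) * (R + ι 2))))

      module Harmonic (r e s c c′ : ℕ) (q≡1+e+2+r : q ≡ suc e ℕ.+ (2 ℕ.+ r)) (e≡ : e ≡ suc (2 ℕ.* suc s)) (r+6<p : r ℕ.+ 6 < p)
                      (2^r≡ : 2 ^ r ≡ suc c) (p∤c : ¬ p ∣ c) (2^2+r≡ : 2 ^ (2 ℕ.+ r) ≡ suc c′) (p∤c′ : ¬ p ∣ c′) where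

        private
          q≡1+2+e+r : q ≡ suc (2 ℕ.+ e) ℕ.+ r
          q≡1+2+e+r = trans q≡1+e+2+r (solve 2 (λ e r → con 1 :+ e :+ (con 2 :+ r) := con 1 :+ (con 2 :+ e) :+ r) refl e r)
            where open ℕSolver.+-*-Solver
          2+e≡ : 2 ℕ.+ e ≡ suc (2 ℕ.* suc (suc s))
          2+e≡ = trans (cong (2 ℕ.+_) e≡) (cong suc (sym (ℕP.*-suc 2 (suc s))))

        private
          kummer-r : SmoothUpTo3 (λ i → 𝓑 (K (2 ℕ.+ e) i))
          kummer-r = KummerAt.kummer r (2 ℕ.+ e) (suc s) c q≡1+2+e+r 2+e≡ (ℕP.≤-<-trans (ℕP.+-monoʳ-≤ r (ℕP.m≤m+n 4 2)) r+6<p) 2^r≡ p∤c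

          kummer-2+r : SmoothUpTo3 (λ i → 𝓑 (K e i))
          kummer-2+r = KummerAt.kummer (2 ℕ.+ r) e s c′ q≡1+e+2+r e≡ (subst (_< p) (trans (sym (ℕP.+-assoc r 2 4)) (cong (ℕ._+ 4) (ℕP.+-comm r 2))) r+6<p) 2^2+r≡ p∤c′

        private
          module Y = SmoothUpTo3 kummer-r
          module Y′ = SmoothUpTo3 kummer-2+r

          V-S : ∀ i → V 4 (ι 6 * Sₖ (2 ℕ.+ e) i - ι 6 * π * (ι (suc i) * π - (ι r + ι (suc i))) * 𝓑 (K (2 ℕ.+ e) i) - π * π * π * cubic (ι (suc i) * π - (ι r + ι (suc i))) * 𝓑 (K e i))
          V-S i = subst (λ k → V 4 (ι 6 * Sₖ (2 ℕ.+ e) i - ι 6 * π * k * 𝓑 (K (2 ℕ.+ e) i) - π * π * π * cubic k * 𝓑 (K e i))) (Interpolation.ι-K r (2 ℕ.+ e) q≡1+2+e+r i)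
            (powerSum-even (e ℕ.+ i ℕ.* q) (B-vanish {s = s} e≡ i) (B-vanish₂ {s = s} e≡ i))

        -- The Bernoulli number in the p³ term has index lowered by 2, so it belongs to the exponent
        -- r + 2. Kummer's congruence modulo p for r + 2 identifies the four numbers there, while
        -- the exponent r needs the third difference modulo p³.
        harmonic : V 4 (ι 6 * inversePowerSum q r + ι 6 * ι r * π * (ι 3 * 𝓑 (K (2 ℕ.+ e) 0) - ι 3 * 𝓑 (K (2 ℕ.+ e) 1) + 𝓑 (K (2 ℕ.+ e) 2))
          + ι r * (ι r + 1ℚ) * (ι r + ι 2) * (π * π * π) * 𝓑 (K e 0))
        harmonic = combine-harmonic (ι r) (inversePowerSum q r) (Sₖ (2 ℕ.+ e) 0) (Sₖ (2 ℕ.+ e) 1) (Sₖ (2 ℕ.+ e) 2) (Sₖ (2 ℕ.+ e) 3)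
          (𝓑 (K (2 ℕ.+ e) 0)) (𝓑 (K (2 ℕ.+ e) 1)) (𝓑 (K (2 ℕ.+ e) 2)) (𝓑 (K (2 ℕ.+ e) 3)) (𝓑 (K e 0)) (𝓑 (K e 1)) (𝓑 (K e 2)) (𝓑 (K e 3))
          (V-ι r) (Interpolation.interpolation₄ r (2 ℕ.+ e) q≡1+2+e+r) (V-S 0) (V-S 1) (V-S 2) (V-S 3) Y.Δ³β₀ Y′.β₁-β₀ Y′.β₂-β₁ Y′.β₃-β₂

      module OddHarmonic (r e s c : ℕ) (q≡1+e+r : q ≡ suc e ℕ.+ suc r) (e≡ : e ≡ suc (2 ℕ.* suc s)) (r+5<p : suc r ℕ.+ 4 < p)
                         (2^r≡ : 2 ^ suc r ≡ suc c) (p∤c : ¬ p ∣ c) where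

        private
          V-S : ∀ i → i ≤ 3 → V 2 (powerSum (2 ℕ.+ (e ℕ.+ i ℕ.* q)) p)
          V-S i i≤3 = aux (e ℕ.+ i ℕ.* q) refl (B-vanish₂ {s = s} e≡ i) (KummerAt.V-B-K (suc r) e s c q≡1+e+r e≡ r+5<p 2^r≡ p∤c i i≤3) (B-vanish {s = s} e≡ i)
            where
            aux : ∀ m → e ℕ.+ i ℕ.* q ≡ m → B (2 ℕ.+ m) ≡ 0ℚ → V 0 (B (suc m)) → B m ≡ 0ℚ → V 2 (powerSum (2 ℕ.+ m) p)
            aux (suc m) _ b₃ v b₁ = powerSum-odd m b₃ v b₁
            aux zero    _ b₃ v ()

        -- Interpolation of order two expresses the sum through two power sums of odd exponent, each
        -- divisible by p²; Kummer's congruences at r + 1 supply the integral Bernoulli numbers for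
        -- this.
        oddHarmonic : V 2 (inversePowerSum q r)
        oddHarmonic = V-resp (oddHarmonic-identity (inversePowerSum q r) (Sₖ (suc e) 0) (Sₖ (suc e) 1)) (V-- (V-+ (Interpolation.interpolation₂ r (suc e) (trans q≡1+e+r (ℕP.+-suc (suc e) r))) (V-*ˡ (V-ι 2) (V-S 0 z≤n))) (V-S 1 (s≤s z≤n)))

      -- Comparison of the two expressions for the coefficients

      module Convolutions (s : ℕ) (q≡10+2s : q ≡ 10 ℕ.+ 2 ℕ.* s) where

        private
          p∤3 : ¬ p ∣ 3
          p∤3 = p∤small 3 {s≤s z≤n} (ℕP.m≤m+n 3 7)
          p∤15 : ¬ p ∣ 15
          p∤15 = ∤-* {3} {5} p∤3 (p∤small 5 {s≤s z≤n} (ℕP.m≤m+n 5 5))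
          p∤63 : ¬ p ∣ 63
          p∤63 = ∤-* {7} {9} (p∤small 7 {s≤s z≤n} (ℕP.m≤m+n 7 3)) (p∤small 9 {s≤s z≤n} (ℕP.m≤m+n 9 1))
          <p : ∀ {n} → n ≤ 10 → n < p
          <p n≤10 = ℕP.≤-trans (s≤s n≤10) 11≤p
          e≡₀ : 3 ℕ.+ 2 ℕ.* s ≡ suc (2 ℕ.* suc s)
          e≡₀ = cong suc (sym (ℕP.*-suc 2 s))
          e≡₁ : 5 ℕ.+ 2 ℕ.* s ≡ suc (2 ℕ.* suc (suc s))
          e≡₁ = cong suc (trans (cong (2 ℕ.+_) (sym (ℕP.*-suc 2 s))) (sym (ℕP.*-suc 2 (suc s))))
          e≡₂ : 7 ℕ.+ 2 ℕ.* s ≡ suc (2 ℕ.* suc (suc (suc s)))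
          e≡₂ = cong suc (trans (cong (2 ℕ.+_) (trans (cong (2 ℕ.+_) (sym (ℕP.*-suc 2 s))) (sym (ℕP.*-suc 2 (suc s))))) (sym (ℕP.*-suc 2 (suc (suc s)))))
          q-split : ∀ a b → a ℕ.+ b ≡ 10 → q ≡ (a ℕ.+ 2 ℕ.* s) ℕ.+ b
          q-split a b e = trans q≡10+2s (trans (cong (ℕ._+ 2 ℕ.* s) (sym e)) (trans (ℕP.+-assoc a b (2 ℕ.* s)) (trans (cong (a ℕ.+_) (ℕP.+-comm b (2 ℕ.* s))) (sym (ℕP.+-assoc a (2 ℕ.* s) b)))))

        -- The subscript is r: the value at i has index (i + 1)(p - 1) - r.
        y₂ y₄ y₆ : ℕ → ℚ
        y₂ i = 𝓑 (K (7 ℕ.+ 2 ℕ.* s) i)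
        y₄ i = 𝓑 (K (5 ℕ.+ 2 ℕ.* s) i)
        y₆ i = 𝓑 (K (3 ℕ.+ 2 ℕ.* s) i)

        kummer₂ : SmoothUpTo3 y₂
        kummer₂ = KummerAt.kummer 2 (7 ℕ.+ 2 ℕ.* s) (suc (suc s)) 3 (q-split 8 2 refl) e≡₂ (<p (ℕP.m≤m+n 6 4)) refl p∤3

        kummer₄ : SmoothUpTo3 y₄
        kummer₄ = KummerAt.kummer 4 (5 ℕ.+ 2 ℕ.* s) (suc s) 15 (q-split 6 4 refl) e≡₁ (<p (ℕP.m≤m+n 8 2)) refl p∤15

        kummer₆ : SmoothUpTo3 y₆
        kummer₆ = KummerAt.kummer 6 (3 ℕ.+ 2 ℕ.* s) s 63 (q-split 4 6 refl) e≡₀ (<p ℕP.≤-refl) refl p∤63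

        F* : Series
        F* = factorProduct rec q

        h : ℕ → ℚ
        h = inversePowerSum q

        w : ℚ
        w = ι (wilson p)

        harmonic₂ : V 4 (ι 6 * h 2 + ι 6 * ι 2 * π * (ι 3 * y₂ 0 - ι 3 * y₂ 1 + y₂ 2) + ι 2 * (ι 2 + 1ℚ) * (ι 2 + ι 2) * (π * π * π) * y₄ 0)
        harmonic₂ = Harmonic.harmonic 2 (5 ℕ.+ 2 ℕ.* s) (suc s) 3 15 (q-split 6 4 refl) e≡₁ (<p (ℕP.m≤m+n 8 2)) refl p∤3 refl p∤15

        harmonic₄ : V 4 (ι 6 * h 4 + ι 6 * ι 4 * π * (ι 3 * y₄ 0 - ι 3 * y₄ 1 + y₄ 2) + ι 4 * (ι 4 + 1ℚ) * (ι 4 + ι 2) * (π * π * π) * y₆ 0)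
        harmonic₄ = Harmonic.harmonic 4 (3 ℕ.+ 2 ℕ.* s) s 15 63 (q-split 4 6 refl) e≡₀ (<p ℕP.≤-refl) refl p∤15 refl p∤63

        F-reverse : ∀ n j → n ℕ.+ j ≡ q → F n ≡ (π * w - 1ℚ) * F* j
        F-reverse n j e = trans (factorProduct-reverse (ι ∘ suc) rec rec-inv q n j e)
          (cong (_* F* j) (trans signedProduct-q wilson-quotient))

        private
          F*₁ : F* 1 ≡ - h 1
          F*₁ = trans (F*₁-identity (F* 1)) (trans (newton rec q 0) (trans (cong (λ z → - (h 1 * z)) (factorProduct-0 rec q)) (F*₁-identity′ (h 1))))

          F*₂ : ι 2 * F* 2 ≡ - (h 1 * F* 1 + h 2 * F* 0)
          F*₂ = newton rec q 1

          F*₃ : ι 3 * F* 3 ≡ - (h 1 * F* 2 + (h 2 * F* 1 + h 3 * F* 0))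
          F*₃ = newton rec q 2

          F*₄ : ι 4 * F* 4 ≡ - (h 1 * F* 3 + (h 2 * F* 2 + (h 3 * F* 1 + h 4 * F* 0)))
          F*₄ = newton rec q 3

          V-F* : ∀ k → V 0 (F* k)
          V-F* = V-factorProduct rec q (λ a a<q → V-rec-<q a<q)

          V-h : ∀ r → V 0 (h r)
          V-h r = V-∑ q (λ a a<q → V-^ r (V-rec-<q a<q))

          V-h₁ : V 2 (h 1)
          V-h₁ = OddHarmonic.oddHarmonic 1 (7 ℕ.+ 2 ℕ.* s) (suc (suc s)) 3 (q-split 8 2 refl) e≡₂ (<p (ℕP.m≤m+n 6 4)) refl p∤3

          V-h₃ : V 2 (h 3)
          V-h₃ = OddHarmonic.oddHarmonic 3 (5 ℕ.+ 2 ℕ.* s) (suc s) 15 (q-split 6 4 refl) e≡₁ (<p (ℕP.m≤m+n 8 2)) refl p∤15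

          V-F*₁ : V 2 (F* 1)
          V-F*₁ = V-resp (sym F*₁) (V-neg V-h₁)

          V-F*₂ : V 4 (ι 2 * F* 2 + h 2)
          V-F*₂ = V-resp (sym (trans (cong (_+ h 2) (trans F*₂ (cong (λ z → - (h 1 * F* 1 + h 2 * z)) (factorProduct-0 rec q)))) (V-F*₂-identity (h 1) (F* 1) (h 2)))) (V-neg (V-* V-h₁ V-F*₁))

          V-F*₃ : V 2 (F* 3)
          V-F*₃ = V-unit-cancel 3 p∤3 (V-resp (sym F*₃) (V-neg (V-+ (V-*ʳ V-h₁ (V-F* 2)) (V-+ (V-*ˡ (V-h 2) V-F*₁) (V-*ʳ V-h₃ (V-F* 0))))))

          -- In Newton's identity 4 F₄ = - (h₁ F₃ + h₂ F₂ + h₃ F₁ + h₄) the products h₁ F₃ and h₃ F₁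
          -- carry p² twice, and 2 F₂ ≡ - h₂ modulo p⁴ settles the remaining product.
          V-F*₄ : V 4 (ι 8 * F* 4 - h 2 * h 2 + ι 2 * h 4)
          V-F*₄ = V-resp eq (V-- (V-- (V-*ˡ (V-neg (V-ι 2)) (V-* V-h₁ V-F*₃)) (V-*ˡ (V-h 2) V-F*₂)) (V-*ˡ (V-ι 2) (V-* V-h₃ V-F*₁)))
            where
            eq : - ι 2 * (h 1 * F* 3) - h 2 * (ι 2 * F* 2 + h 2) - ι 2 * (h 3 * F* 1) ≡ ι 8 * F* 4 - h 2 * h 2 + ι 2 * h 4
            eq = trans (V-F*₄-identity (h 1) (F* 3) (h 2) (F* 2) (h 3) (F* 1) (h 4)) (trans (cong (λ z → ι 2 * z - h 2 * h 2 + ι 2 * h 4)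
              (trans (cong (λ z → - (h 1 * F* 3 + (h 2 * F* 2 + (h 3 * F* 1 + h 4 * z)))) (sym (factorProduct-0 rec q))) (sym F*₄))) (V-F*₄-identity′ (F* 4) (h 2) (h 4)))

          V-powerSum-n : ∀ v → PowerSumExpansion v
          V-powerSum-n v = powerSum-even (2 ℕ.+ l) (B-odd′ v (cong suc (sym (ℕP.*-suc 2 v))))
            (B-odd′ (suc v) (cong suc (trans (cong (2 ℕ.+_) (sym (ℕP.*-suc 2 v))) (sym (ℕP.*-suc 2 (suc v))))))
            where open Coefficients v

          tail : ℚ → ℚ → ℚ → ℚ → ℚ → ℚ
          tail n x b c t = ι 24 * π * x + ι 4 * (π * π * π) * ((n - 1ℚ) * (n - ι 2)) * b - ι 12 * (π * π) * c
                             + ι 6 * (π * π * π) * (n - 1ℚ) * b + ι 4 * (π * π * π) * t + ι 3 * (π * π * π) * b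

          -- Reversal turns the coefficient of degree n = p - 2 - j into that of degree j + 1 of F*,
          -- times (p - 1)! in the form π w - 1; n itself is rewritten so that it can be reduced
          -- modulo p later.
          F-tail : ∀ v j → let open Coefficients v in n ℕ.+ suc j ≡ q → V 4 (ι 24 * ((π * w - 1ℚ) * F* (suc j)) + tail (π - ι (2 ℕ.+ j)) (𝓑 n) b (𝓒 n) (𝓣 n))
          F-tail v j e = V-resp (trans (F-tail-identity π (ι n) (F n) (𝓑 n) b (𝓒 n) (𝓣 n)) (cong₂ (λ f k → ι 24 * f + tail k (𝓑 n) b (𝓒 n) (𝓣 n)) (F-reverse n (suc j) e) ι-n))
            (Coefficient.F-expansion v (subst (n <_) e (ℕP.m<m+n n (s≤s z≤n))) (V-powerSum-n v))
            where
            open Coefficients v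
            ι-n : ι n ≡ π - ι (2 ℕ.+ j)
            ι-n = trans (rearrange₄ (ι n) (ι (2 ℕ.+ j))) (cong (_- ι (2 ℕ.+ j)) (trans (sym (ι-+ n (2 ℕ.+ j))) (cong ι (trans (ℕP.+-suc n (suc j)) (trans (cong suc e) (sym p≡1+q))))))

        first-combination second-combination : (T C b x y z : ℚ) → ℚ
        first-combination T C b x y z = ι 4 * (π * π) * T - ι 12 * π * C + ι 11 * (π * π) * b - ι 24 * (z - ι 3 * y + ι 2 * x) - ι 24 * π * w * (y - ι 2 * x)
        second-combination T C b x y z = ι 4 * (π * π) * T - ι 12 * π * C + ι 15 * (π * π) * b - ι 24 * (z - ι 3 * y + ι 2 * x) - ι 24 * π * w * (y - ι 2 * x)

        private
          module Y₂ = SmoothUpTo3 kummer₂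
          module Y₄ = SmoothUpTo3 kummer₄
          module Y₆ = SmoothUpTo3 kummer₆
          V-w : V 0 w
          V-w = V-ι (wilson p)
          V-π³ : V 3 (π * π * π)
          V-π³ = V-* (V-* V-π V-π) V-π

        module _ where
          open Coefficients (suc s)

          private
            x = y₂ 0
            y = y₂ 1
            z = y₂ 2
            b′ = y₄ 0
            c = 𝓒 n
            t′ = 𝓣 n

            n≡K : n ≡ K (7 ℕ.+ 2 ℕ.* s) 0
            n≡K = solve 1 (λ s → con 6 :+ con 2 :* (con 1 :+ s) := con 8 :+ (con 2 :* s :+ con 0)) refl s
              where open ℕSolver.+-*-Solver

            n-2≡K′ : 3 ℕ.+ l ≡ K (5 ℕ.+ 2 ℕ.* s) 0
            n-2≡K′ = solve 1 (λ s → con 4 :+ con 2 :* (con 1 :+ s) := con 6 :+ (con 2 :* s :+ con 0)) refl s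
              where open ℕSolver.+-*-Solver

            n+2≡q : n ℕ.+ 2 ≡ q
            n+2≡q = trans (solve 1 (λ s → con 6 :+ con 2 :* (con 1 :+ s) :+ con 2 := con 10 :+ con 2 :* s) refl s) (sym q≡10+2s)
              where open ℕSolver.+-*-Solver

            u = π * w - 1ℚ

            V-tail : V 4 (ι 24 * (u * F* 2) + tail (π - ι 3) x b′ c t′)
            V-tail = V-resp (cong₂ (λ i j → ι 24 * (u * F* 2) + tail (π - ι 3) (𝓑 i) (𝓑 j) c t′) n≡K n-2≡K′) (F-tail (suc s) 1 n+2≡q)

            V-u : V 0 u
            V-u = V-- (V-* (V-ι p) V-w) (V-ι 1)



            error : ℚ
            error = ι 24 * w * (π * (z - ι 2 * y + x)) + (ι 48 * w + ι 4 * π - ι 30) * b′ * (π * π * π)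

            V-error : V 3 error
            V-error = V-+ (V-*ˡ (V-* (V-ι 24) V-w) (V-* V-π Y₂.Δ²β₀))
              (V-*ˡ (V-* (V-- (V-+ (V-* (V-ι 48) V-w) (V-* (V-ι 4) (V-ι p))) (V-ι 30)) (Y₄.integral 0 z≤n)) V-π³)

          first-congruence : V 3 (first-combination (𝓣 n) (𝓒 n) (y₄ 0) (y₂ 0) (y₂ 1) (y₂ 2))
          first-congruence = V-resp (rearrange₅ (first-combination t′ c b′ x y z) error) (V-- (V-π-cancel (V-resp (first-congruence-identity₁ π w (F* 2) (h 2) x y z b′ c t′)
            (V-+ (V-- V-tail (V-*ˡ (V-ι 12) (V-*ˡ V-u V-F*₂))) (V-*ˡ (V-ι 2) (V-*ˡ V-u harmonic₂))))) V-error)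

        module _ where
          open Coefficients s

          private
            x = y₄ 0
            y = y₄ 1
            z = y₄ 2
            b′ = y₆ 0
            u₁ = y₂ 0
            v₁ = y₂ 1
            m = ι 2 * u₁ - v₁
            c = 𝓒 n
            t′ = 𝓣 n

            n≡K : n ≡ K (5 ℕ.+ 2 ℕ.* s) 0
            n≡K = solve 1 (λ s → con 6 :+ con 2 :* s := con 6 :+ (con 2 :* s :+ con 0)) refl s
              where open ℕSolver.+-*-Solver

            n-2≡K′ : 3 ℕ.+ l ≡ K (3 ℕ.+ 2 ℕ.* s) 0
            n-2≡K′ = solve 1 (λ s → con 4 :+ con 2 :* s := con 4 :+ (con 2 :* s :+ con 0)) refl s
              where open ℕSolver.+-*-Solver

            n+4≡q : n ℕ.+ 4 ≡ q
            n+4≡q = trans (solve 1 (λ s → con 6 :+ con 2 :* s :+ con 4 := con 10 :+ con 2 :* s) refl s) (sym q≡10+2s)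
              where open ℕSolver.+-*-Solver

            u = π * w - 1ℚ

            V-tail : V 4 (ι 24 * (u * F* 4) + tail (π - ι 5) x b′ c t′)
            V-tail = V-resp (cong₂ (λ i j → ι 24 * (u * F* 4) + tail (π - ι 5) (𝓑 i) (𝓑 j) c t′) n≡K n-2≡K′) (F-tail s 3 n+4≡q)

            V-u : V 0 u
            V-u = V-- (V-* (V-ι p) V-w) (V-ι 1)

            V-m : V 0 m
            V-m = V-- (V-* (V-ι 2) (Y₂.integral 0 z≤n)) (Y₂.integral 1 (s≤s z≤n))

            V-h₂ : V 3 (h 2 + ι 2 * π * m)
            V-h₂ = V-unit-cancel 6 (p∤small 6 {s≤s z≤n} (ℕP.m≤m+n 6 4)) (V-resp (V-h₂-identity π (h 2) u₁ v₁ (y₂ 2) (y₄ 0))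
              (V-- (V-- (V-≤ (ℕP.n≤1+n 3) harmonic₂) (V-*ˡ (V-ι 12) (V-* V-π Y₂.Δ²β₀))) (V-*ˡ (V-ι 24) (V-*ʳ V-π³ (Y₄.integral 0 z≤n)))))

            -- One factor is known to order p³ and the other supplies a further p, so h₂² may be
            -- replaced by 4 π² m² modulo p⁴ although h₂ itself is used only modulo p³.
            V-h₂² : V 4 ((h 2 - ι 2 * π * m) * (h 2 + ι 2 * π * m))
            V-h₂² = V-* (V-resp (V-h₂²-identity π (h 2) m) (V-- (V-≤ (s≤s z≤n) V-h₂) (V-*ˡ (V-ι 4) (V-*ʳ V-π V-m)))) V-h₂



            error target : ℚ
            error = ι 24 * w * (π * (z - ι 2 * y + x)) + (ι 120 * w + ι 4 * π - ι 46) * b′ * (π * π * π)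
                  + ι 12 * w * (π * π * ((v₁ - u₁) * (v₁ - ι 3 * u₁))) - ι 12 * (π * ((v₁ - u₁) * (v₁ - u₁)))
            target = second-combination t′ c b′ x y z - ι 12 * π * (ι 3 * (u₁ * u₁) - ι 2 * (u₁ * v₁)) + ι 12 * (π * π) * w * (u₁ * u₁)

            V-error : V 3 error
            V-error = V-- (V-+ (V-+ (V-*ˡ (V-* (V-ι 24) V-w) (V-* V-π Y₄.Δ²β₀))
              (V-*ˡ (V-* (V-- (V-+ (V-* (V-ι 120) V-w) (V-* (V-ι 4) (V-ι p))) (V-ι 46)) (Y₆.integral 0 z≤n)) V-π³))
              (V-*ˡ (V-* (V-ι 12) V-w) (V-* (V-* V-π V-π) (V-*ʳ Y₂.β₁-β₀ (V-- (Y₂.integral 1 (s≤s z≤n)) (V-* (V-ι 3) (Y₂.integral 0 z≤n)))))))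
              (V-*ˡ (V-ι 12) (V-* V-π (V-* Y₂.β₁-β₀ Y₂.β₁-β₀)))

          second-congruence : V 3 (second-combination (𝓣 n) (𝓒 n) (y₆ 0) (y₄ 0) (y₄ 1) (y₄ 2)
            - ι 12 * π * (ι 3 * (y₂ 0 * y₂ 0) - ι 2 * (y₂ 0 * y₂ 1)) + ι 12 * (π * π) * w * (y₂ 0 * y₂ 0))
          second-congruence = V-resp (rearrange₅ target error) (V-- (V-π-cancel (V-resp (second-congruence-identity₁ π w (F* 4) (h 2) (h 4) x y z b′ c t′ u₁ v₁)
            (V-- (V-+ (V-- V-tail (V-*ˡ (V-ι 3) (V-*ˡ V-u V-F*₄))) (V-*ˡ V-u harmonic₄)) (V-*ˡ (V-ι 3) (V-*ˡ V-u V-h₂²))))) V-error)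

        V-β : ∀ k → k < q → V 0 (β k)
        V-β zero          _   = V-0 0
        V-β (suc zero)    _   = V-0 0
        V-β (suc (suc k)) k<q = V-𝓑-small (suc (suc k)) (<q⇒1+<p k<q)

        V-𝓒 : ∀ v → Coefficients.n v < q → V 0 (𝓒 (Coefficients.n v))
        V-𝓒 v n<q = V-resp (β² (3 ℕ.+ 2 ℕ.* v)) (V-⋆ n vβ vβ)
          where
          open Coefficients v
          vβ : ∀ i → i ≤ n → V 0 (β i)
          vβ i i≤n = V-β i (ℕP.≤-<-trans i≤n n<q)

        V-𝓣 : ∀ v → Coefficients.n v < q → V 0 (𝓣 (Coefficients.n v))
        V-𝓣 v n<q = V-resp (β³ (suc (2 ℕ.* v))) (V-⋆ n vβ (λ i i≤n → V-⋆ i (λ j j≤i → vβ j (ℕP.≤-trans j≤i i≤n)) (λ j j≤i → vβ j (ℕP.≤-trans j≤i i≤n))))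
          where
          open Coefficients v
          vβ : ∀ i → i ≤ n → V 0 (β i)
          vβ i i≤n = V-β i (ℕP.≤-<-trans i≤n n<q)

        -- Translation to the indices of the statement

        module Theorem (d : ℕ → ℚ → ℚ) (digit-function : DigitFunction d) where

          private
            index : ∀ k m → k ℕ.+ m ≡ p → k ≡ p ∸ m
            index k m e = trans (sym (ℕP.m+n∸n≡m k m)) (cong (_∸ m) e)

            -- `Interpolation.K+r+i` reads K e i + (r + i + 1) = (i + 1) p. For r = 2 this gives the
            -- indices p - 3, 2p - 4, 3p - 5, for r = 4 the indices p - 5, 2p - 6, 3p - 7, and for r
            -- = 6 the index p - 7.
            index-* : ∀ k m j → k ℕ.+ m ≡ j ℕ.* p → k ≡ j ℕ.* p ∸ m
            index-* k m j e = trans (sym (ℕP.m+n∸n≡m k m)) (cong (_∸ m) e)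

            1*p : ∀ {k} → k ≡ 1 ℕ.* p → k ≡ p
            1*p e = trans e (ℕP.*-identityˡ p)

            n₂<q : Coefficients.n (suc s) < q
            n₂<q = subst (Coefficients.n (suc s) <_) (trans (solve 1 (λ s → con 6 :+ con 2 :* (con 1 :+ s) :+ con 2 := con 10 :+ con 2 :* s) refl s) (sym q≡10+2s)) (ℕP.m<m+n (Coefficients.n (suc s)) {2} (s≤s z≤n))
              where open ℕSolver.+-*-Solver

            n₄<q : Coefficients.n s < q
            n₄<q = subst (Coefficients.n s <_) (trans (solve 1 (λ s → con 6 :+ con 2 :* s :+ con 4 := con 10 :+ con 2 :* s) refl s) (sym q≡10+2s)) (ℕP.m<m+n (Coefficients.n s) {4} (s≤s z≤n))
              where open ℕSolver.+-*-Solver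

            n₂≡ : Coefficients.n (suc s) ≡ p ∸ 3
            n₂≡ = index (Coefficients.n (suc s)) 3 (trans (solve 1 (λ s → con 6 :+ con 2 :* (con 1 :+ s) :+ con 3 := con 11 :+ con 2 :* s) refl s) (sym (trans p≡1+q (cong suc q≡10+2s))))
              where open ℕSolver.+-*-Solver

            n₄≡ : Coefficients.n s ≡ p ∸ 5
            n₄≡ = index (Coefficients.n s) 5 (trans (solve 1 (λ s → con 6 :+ con 2 :* s :+ con 5 := con 11 :+ con 2 :* s) refl s) (sym (trans p≡1+q (cong suc q≡10+2s))))
              where open ℕSolver.+-*-Solver

            -- The indices are independent variables so that the equalities between `K e i` and
            -- truncated subtractions can be substituted by matching, without unfolding Bernoulli
            -- numbers.
            First : (n m k₀ k₁ k₂ : ℕ) → ℚ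
            First n m k₀ k₁ k₂ =
                ι 3 * d 1 (𝓒 n)
                - ((ℤ.+ 11) / 4) * 𝓑 m
                + ι 6 * d 2 (𝓑 k₂ - ι 3 * 𝓑 k₁ + ι 2 * 𝓑 k₀)
                + d 1 (ι 6 * d 1 (𝓑 k₀ - 𝓑 k₁))
                + d 1 (ι 3 * d 0 E₁)
                + d 1 (ι (wilson p)) * d 0 (- ι 6 * 𝓑 k₀)
                + d 0 (ι (wilson p)) * d 1 (ι 6 * (𝓑 k₁ - ι 2 * 𝓑 k₀))
                + d 1 (d 0 (ι (wilson p)) * d 0 (- ι 6 * 𝓑 k₀))
                + d 1 (d 0 (ι 6 * d 1 (𝓑 k₀ - 𝓑 k₁))
                       + d 0 (- ι 6 * d 0 (ι (wilson p)) * 𝓑 k₀)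
                       + d 0 (ι 3 * d 0 E₁))
              where E₁ = ι 2 * d 1 (𝓑 k₁ - 𝓑 k₀) + ι 2 * d 0 (ι (wilson p)) * 𝓑 k₀

            Second : (n m k₀ k₁ k₂ l₀ l₁ : ℕ) → ℚ
            Second n m k₀ k₁ k₂ l₀ l₁ =
                ι 3 * d 1 (𝓒 n)
                - ((ℤ.+ 15) / 4) * 𝓑 m
                + d 1 (ι 3 * (d 0 (𝓑 l₀) * d 0 (𝓑 l₀)))
                + ι 6 * 𝓑 l₀ * d 1 (ι 2 * 𝓑 l₀ - 𝓑 l₁)
                + ι 6 * d 2 (𝓑 k₂ - ι 3 * 𝓑 k₁ + ι 2 * 𝓑 k₀)
                + d 1 (ι 6 * d 1 (𝓑 k₀ - 𝓑 k₁))
                + d 0 (ι (wilson p)) * d 1 (- ι 6 * 𝓑 k₀)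
                + d 1 (ι (wilson p)) * d 0 (- ι 6 * 𝓑 k₀)
                + d 1 (d 0 (ι (wilson p)) * d 0 (- ι 6 * 𝓑 k₀))
                + d 0 (- ι 6 * (d 0 (ι (wilson p)) * d 0 (ι (wilson p))) * 𝓑 k₀)
                + d 0 (ι 3 * d 0 (ι (wilson p)) * d 0 E₂)
                + d 1 (ι 3 * d 0 E₂)
                + d 1 (d 0 (ι 3 * (d 0 (𝓑 l₀) * d 0 (𝓑 l₀)))
                       + d 0 (ι 6 * d 1 (𝓑 k₀ - 𝓑 k₁))
                       + d 0 (- ι 6 * d 0 (ι (wilson p)) * d 0 (𝓑 k₀))
                       + d 0 (ι 3 * d 0 E₂))
              where E₂ = ι 2 * d 0 (ι (wilson p)) * 𝓑 k₀ + ι 2 * d 1 (𝓑 k₁ - 𝓑 k₀) - 𝓑 l₀ * 𝓑 l₀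

            First-cong : ∀ {n n′ m m′ k₀ k₀′ k₁ k₁′ k₂ k₂′} → n ≡ n′ → m ≡ m′ → k₀ ≡ k₀′ → k₁ ≡ k₁′ → k₂ ≡ k₂′ →
                         𝓣 n - First n m k₀ k₁ k₂ ≡ 𝓣 n′ - First n′ m′ k₀′ k₁′ k₂′
            First-cong refl refl refl refl refl = refl

            Second-cong : ∀ {n n′ m m′ k₀ k₀′ k₁ k₁′ k₂ k₂′ l₀ l₀′ l₁ l₁′} → n ≡ n′ → m ≡ m′ → k₀ ≡ k₀′ → k₁ ≡ k₁′ → k₂ ≡ k₂′ → l₀ ≡ l₀′ → l₁ ≡ l₁′ →
                          𝓣 n - Second n m k₀ k₁ k₂ l₀ l₁ ≡ 𝓣 n′ - Second n′ m′ k₀′ k₁′ k₂′ l₀′ l₁′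
            Second-cong refl refl refl refl refl refl refl = refl

          first : 𝓣 (p ∸ 3) ≡ First (p ∸ 3) (p ∸ 5) (p ∸ 3) (2 ℕ.* p ∸ 4) (3 ℕ.* p ∸ 5) [modₚ p ]
          first = V1⇒≡modₚ {𝓣 (p ∸ 3)} {First (p ∸ 3) (p ∸ 5) (p ∸ 3) (2 ℕ.* p ∸ 4) (3 ℕ.* p ∸ 5)} (V-resp (First-cong n₂≡ (index (K (5 ℕ.+ 2 ℕ.* s) 0) 5 (1*p (Interpolation.K+r+i 4 (5 ℕ.+ 2 ℕ.* s) (q-split 6 4 refl) 0))) (index (K (7 ℕ.+ 2 ℕ.* s) 0) 3 (1*p (Interpolation.K+r+i 2 (7 ℕ.+ 2 ℕ.* s) (q-split 8 2 refl) 0))) (index-* (K (7 ℕ.+ 2 ℕ.* s) 1) 4 2 (Interpolation.K+r+i 2 (7 ℕ.+ 2 ℕ.* s) (q-split 8 2 refl) 1)) (index-* (K (7 ℕ.+ 2 ℕ.* s) 2) 5 3 (Interpolation.K+r+i 2 (7 ℕ.+ 2 ℕ.* s) (q-split 8 2 refl) 2)))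
            (DigitCombination.Common.first-digits d digit-function (Y₂.integral 0 z≤n) (Y₂.integral 1 (s≤s z≤n)) (Y₂.integral 2 (s≤s (s≤s z≤n)))
              (V-𝓒 (suc s) n₂<q) (Y₄.integral 0 z≤n) (V-ι (wilson p)) (V-𝓣 (suc s) n₂<q) Y₂.β₁-β₀ Y₂.Δ²β₀ first-congruence))

          second : 𝓣 (p ∸ 5) ≡ Second (p ∸ 5) (p ∸ 7) (p ∸ 5) (2 ℕ.* p ∸ 6) (3 ℕ.* p ∸ 7) (p ∸ 3) (2 ℕ.* p ∸ 4) [modₚ p ]
          second = V1⇒≡modₚ {𝓣 (p ∸ 5)} {Second (p ∸ 5) (p ∸ 7) (p ∸ 5) (2 ℕ.* p ∸ 6) (3 ℕ.* p ∸ 7) (p ∸ 3) (2 ℕ.* p ∸ 4)} (V-resp (Second-cong n₄≡ (index (K (3 ℕ.+ 2 ℕ.* s) 0) 7 (1*p (Interpolation.K+r+i 6 (3 ℕ.+ 2 ℕ.* s) (q-split 4 6 refl) 0))) (index (K (5 ℕ.+ 2 ℕ.* s) 0) 5 (1*p (Interpolation.K+r+i 4 (5 ℕ.+ 2 ℕ.* s) (q-split 6 4 refl) 0))) (index-* (K (5 ℕ.+ 2 ℕ.* s) 1) 6 2 (Interpolation.K+r+i 4 (5 ℕ.+ 2 ℕ.* s) (q-split 6 4 refl) 1)) (index-* (K (5 ℕ.+ 2 ℕ.* s) 2) 7 3 (Interpolation.K+r+i 4 (5 ℕ.+ 2 ℕ.* s) (q-split 6 4 refl) 2))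
              (index (K (7 ℕ.+ 2 ℕ.* s) 0) 3 (1*p (Interpolation.K+r+i 2 (7 ℕ.+ 2 ℕ.* s) (q-split 8 2 refl) 0))) (index-* (K (7 ℕ.+ 2 ℕ.* s) 1) 4 2 (Interpolation.K+r+i 2 (7 ℕ.+ 2 ℕ.* s) (q-split 8 2 refl) 1)))
            (DigitCombination.Common.second-digits d digit-function (Y₄.integral 0 z≤n) (Y₄.integral 1 (s≤s z≤n)) (Y₄.integral 2 (s≤s (s≤s z≤n)))
              (V-𝓒 s n₄<q) (Y₆.integral 0 z≤n) (V-ι (wilson p)) (V-𝓣 s n₄<q) Y₄.β₁-β₀ Y₄.Δ²β₀
              (Y₂.integral 0 z≤n) (Y₂.integral 1 (s≤s z≤n)) Y₂.β₁-β₀ second-congruence))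

          main :
            let w₀ = d 0 (ι (wilson p))
                w₁ = d 1 (ι (wilson p))
                b : ℕ → ℚ
                b = 𝓑
                E₁ = ι 2 * d 1 (b (2 ℕ.* p ∸ 4) - b (p ∸ 3)) + ι 2 * w₀ * b (p ∸ 3)
                E₂ = ι 2 * w₀ * b (p ∸ 5) + ι 2 * d 1 (b (2 ℕ.* p ∸ 6) - b (p ∸ 5)) - b (p ∸ 3) * b (p ∸ 3)
            in
            (𝓣 (p ∸ 3) ≡
                ι 3 * d 1 (𝓒 (p ∸ 3))
                - ((ℤ.+ 11) / 4) * b (p ∸ 5)
                + ι 6 * d 2 (b (3 ℕ.* p ∸ 5) - ι 3 * b (2 ℕ.* p ∸ 4) + ι 2 * b (p ∸ 3))
                + d 1 (ι 6 * d 1 (b (p ∸ 3) - b (2 ℕ.* p ∸ 4)))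
                + d 1 (ι 3 * d 0 E₁)
                + w₁ * d 0 (- ι 6 * b (p ∸ 3))
                + w₀ * d 1 (ι 6 * (b (2 ℕ.* p ∸ 4) - ι 2 * b (p ∸ 3)))
                + d 1 (w₀ * d 0 (- ι 6 * b (p ∸ 3)))
                + d 1 (d 0 (ι 6 * d 1 (b (p ∸ 3) - b (2 ℕ.* p ∸ 4)))
                       + d 0 (- ι 6 * w₀ * b (p ∸ 3))
                       + d 0 (ι 3 * d 0 E₁))
              [modₚ p ])
            ×
            (𝓣 (p ∸ 5) ≡
                ι 3 * d 1 (𝓒 (p ∸ 5))
                - ((ℤ.+ 15) / 4) * b (p ∸ 7)
                + d 1 (ι 3 * (d 0 (b (p ∸ 3)) * d 0 (b (p ∸ 3))))
                + ι 6 * b (p ∸ 3) * d 1 (ι 2 * b (p ∸ 3) - b (2 ℕ.* p ∸ 4))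
                + ι 6 * d 2 (b (3 ℕ.* p ∸ 7) - ι 3 * b (2 ℕ.* p ∸ 6) + ι 2 * b (p ∸ 5))
                + d 1 (ι 6 * d 1 (b (p ∸ 5) - b (2 ℕ.* p ∸ 6)))
                + w₀ * d 1 (- ι 6 * b (p ∸ 5))
                + w₁ * d 0 (- ι 6 * b (p ∸ 5))
                + d 1 (w₀ * d 0 (- ι 6 * b (p ∸ 5)))
                + d 0 (- ι 6 * (w₀ * w₀) * b (p ∸ 5))
                + d 0 (ι 3 * w₀ * d 0 E₂)
                + d 1 (ι 3 * d 0 E₂)
                + d 1 (d 0 (ι 3 * (d 0 (b (p ∸ 3)) * d 0 (b (p ∸ 3))))
                       + d 0 (ι 6 * d 1 (b (p ∸ 5) - b (2 ℕ.* p ∸ 6)))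
                       + d 0 (- ι 6 * w₀ * d 0 (b (p ∸ 5)))
                       + d 0 (ι 3 * d 0 E₂))
              [modₚ p ])
          main = first , second

p≡11+2s : ∀ {p} → Prime p → 11 ≤ p → Σ[ s ∈ ℕ ] p ≡ 11 ℕ.+ 2 ℕ.* s
p≡11+2s {p} p-prime 11≤p = h ∸ 5 , trans p≡ (trans (cong (λ z → suc (2 ℕ.* z)) (sym (ℕP.m+[n∸m]≡n 5≤h))) (cong suc (ℕP.*-distribˡ-+ 2 5 (h ∸ 5))))
  where
  h = proj₁ (Padic.Large.p-odd p p-prime 11≤p)
  p≡ = proj₂ (Padic.Large.p-odd p p-prime 11≤p)
  5≤h : 5 ≤ h
  5≤h = ℕP.*-cancelˡ-≤ 2 (ℕP.≤-pred (subst (11 ≤_) p≡ 11≤p))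

import Data.Nat
open import Data.Integer using (+_)

theorem1 : (p : ℕ) → Prime p → 11 ≤ p →
  let d : ℕ → ℚ → ℚ
      d = D p
      w₀ = d 0 (ι (wilson p))
      w₁ = d 1 (ι (wilson p))
      b : ℕ → ℚ
      b = 𝓑
      E₁ = ι 2 * d 1 (b (2 Data.Nat.* p ∸ 4) - b (p ∸ 3)) + ι 2 * w₀ * b (p ∸ 3)
      E₂ = ι 2 * w₀ * b (p ∸ 5) + ι 2 * d 1 (b (2 Data.Nat.* p ∸ 6) - b (p ∸ 5)) - b (p ∸ 3) * b (p ∸ 3)
  in
  (𝓣 (p ∸ 3) ≡
      ι 3 * d 1 (𝓒 (p ∸ 3))
      - ((+ 11) / 4) * b (p ∸ 5)
      + ι 6 * d 2 (b (3 Data.Nat.* p ∸ 5) - ι 3 * b (2 Data.Nat.* p ∸ 4) + ι 2 * b (p ∸ 3))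
      + d 1 (ι 6 * d 1 (b (p ∸ 3) - b (2 Data.Nat.* p ∸ 4)))
      + d 1 (ι 3 * d 0 E₁)
      + w₁ * d 0 (- ι 6 * b (p ∸ 3))
      + w₀ * d 1 (ι 6 * (b (2 Data.Nat.* p ∸ 4) - ι 2 * b (p ∸ 3)))
      + d 1 (w₀ * d 0 (- ι 6 * b (p ∸ 3)))
      + d 1 (d 0 (ι 6 * d 1 (b (p ∸ 3) - b (2 Data.Nat.* p ∸ 4)))
             + d 0 (- ι 6 * w₀ * b (p ∸ 3))
             + d 0 (ι 3 * d 0 E₁))
    [modₚ p ])
  ×
  (𝓣 (p ∸ 5) ≡
      ι 3 * d 1 (𝓒 (p ∸ 5))
      - ((+ 15) / 4) * b (p ∸ 7)
      + d 1 (ι 3 * (d 0 (b (p ∸ 3)) * d 0 (b (p ∸ 3))))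
      + ι 6 * b (p ∸ 3) * d 1 (ι 2 * b (p ∸ 3) - b (2 Data.Nat.* p ∸ 4))
      + ι 6 * d 2 (b (3 Data.Nat.* p ∸ 7) - ι 3 * b (2 Data.Nat.* p ∸ 6) + ι 2 * b (p ∸ 5))
      + d 1 (ι 6 * d 1 (b (p ∸ 5) - b (2 Data.Nat.* p ∸ 6)))
      + w₀ * d 1 (- ι 6 * b (p ∸ 5))
      + w₁ * d 0 (- ι 6 * b (p ∸ 5))
      + d 1 (w₀ * d 0 (- ι 6 * b (p ∸ 5)))
      + d 0 (- ι 6 * (w₀ * w₀) * b (p ∸ 5))
      + d 0 (ι 3 * w₀ * d 0 E₂)
      + d 1 (ι 3 * d 0 E₂)
      + d 1 (d 0 (ι 3 * (d 0 (b (p ∸ 3)) * d 0 (b (p ∸ 3))))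
             + d 0 (ι 6 * d 1 (b (p ∸ 5) - b (2 Data.Nat.* p ∸ 6)))
             + d 0 (- ι 6 * w₀ * d 0 (b (p ∸ 5)))
             + d 0 (ι 3 * d 0 E₂))
    [modₚ p ])
theorem1 p p-prime 11≤p = main p p-prime 11≤p (10 ℕ.+ 2 ℕ.* s) p≡ (5 ℕ.+ s) (sym (ℕP.*-distribˡ-+ 2 5 s)) s refl (D p) (Padic.D-digits p p-prime)
  where
  open Padic.Large.Regular.Convolutions.Theorem using (main)
  s = proj₁ (p≡11+2s p-prime 11≤p)
  p≡ = proj₂ (p≡11+2s p-prime 11≤p)
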